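{- Let $\lambda\in\mathcal{P}^k$ and $1\le r\le k$, put $\widetilde{h}_r=h_0+h_1+\dots+h_r$ (with $h_0=1$), and let $d_{A_1}\lambda,d_{A_2}\lambda,\dots$ be the list of all weak strips of size $r$ over $\lambda$ (with distinct $A_a\subsetneq I$). Then for every choice of indices $a_1<\dots<a_m$, $d_{A_{a_1}\cap\dots\cap A_{a_m}}\lambda$ is defined and equals the meet $(d_{A_{a_1}}\lambda)\wedge\dots\wedge(d_{A_{a_m}}\lambda)$ in $(\mathcal{P}^k,\le)$, and \[ \widetilde{g}^{(k)}_{\lambda}\,\widetilde{h}_r=\sum_{m\ge1}(-1)^{m-1}\sum_{a_1<\dots<a_m}\widetilde{g}^{(k)}_{d_{A_{a_1}\cap\dots\cap A_{a_m}}\lambda}. \]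
   Context: Fix a positive integer $k$. Let $I=\mathbb{Z}/(k+1)\mathbb{Z}=\{0,1,\dots,k\}$ and let $W=\tilde S_{k+1}$ be the affine symmetric group with Coxeter generators $s_i$ ($i\in I$), relations $s_i^2=1$, $s_is_{i+1}s_i=s_{i+1}s_is_{i+1}$, and $s_is_j=s_js_i$ when $i-j\not\equiv 0,\pm1 \pmod{k+1}$. Let $l$ be the length function, $\le$ the strong (Bruhat) order, and $\le_L$ the left weak order: $u\le_L v$ iff $l(vu^{ -1})+l(u)=l(v)$. Let $W^\circ\subset W$ be the set of affine Grassmannian elements, i.e. $w$ with $ws_i>w$ for all $i\in\{1,\dots,k\}$. For $A\subsetneq I$, $d_A=s_{i_1}\cdots s_{i_m}$ where $A=\{i_1,\dots,i_m\}$ and the word $i_1\cdots i_m$ is cyclically decreasing (distinct letters, and no $j$ occurs to the left of $j+1$, indices mod $k+1$); this is independent of the choice of word. $\mathcal{P}^k$ is the set of partitions $\lambda$ with $\lambda_1\le k$. The residue of the cell in row $i$, column $j$ is $j-i \bmod (k+1)$. For $\lambda\in\mathcal{P}^k$, $w_\lambda=s_{i_1}\cdots s_{i_l}$ where $(i_1,\dots,i_l)$ are the residues of the cells of $\lambda$ read from the shortest row to the longest, each row from right to left; $\lambda\mapsto w_\lambda$ is a bijection $\mathcal{P}^k\to W^\circ$, and $\mathcal P^k$ carries the strong order $\mu\le\lambda\iff w_\mu\le w_\lambda$; $\wedge$ denotes meet in this poset. For $A\subsetneq I$ with $d_Aw_\lambda\in W^\circ$, $d_A\lambda$ denotes the partition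 $\mu$ with $w_\mu=d_Aw_\lambda$. We say $d_A\lambda$ is a weak strip of size $r$ over $\lambda$ if $d_Aw_\lambda\in W^\circ$, $d_Aw_\lambda\ge_L w_\lambda$ and $|A|=r$. Demazure action: for $s=s_i$, $\phi_s(x)=sx$ if $sx>x$ and $\phi_s(x)=x$ otherwise; for $x=t_1\cdots t_n$ reduced, $x*y=\phi_{t_1}\cdots\phi_{t_n}(y)$. Let $h_r$ be the complete homogeneous symmetric functions and $\Lambda^{(k)}=\mathbb{Z}[h_1,\dots,h_k]$. The $K$-$k$-Schur functions $\{g^{(k)}_w\}_{w\in W^\circ}$ are the family (a basis of $\Lambda^{(k)}$) determined by $g^{(k)}_e=1$ and, for $w\in W^\circ$ and $1\le r\le k$, $h_r\,g^{(k)}_w=\sum (-1)^{r+l(w)-l(d_A*w)} g^{(k)}_{d_A*w}$, summed over $A\subsetneq I$ with $|A|=r$ and $d_A*w\in W^\circ$. Write $g^{(k)}_\lambda=g^{(k)}_{w_\lambda}$ and $\widetilde{g}^{(k)}_{\lambda}=\sum_{\mu\in\mathcal{P}^k,\ \mu\le\lambda} g^{(k)}_{\mu}$. -}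

module Defs where

open import Level using (Level)
open import Data.Bool using (Bool; true; false; if_then_else_; _∧_; not; T)
open import Data.Nat as ℕ using (ℕ; zero; suc; _∸_; _≡ᵇ_; _<ᵇ_; _≤ᵇ_)
open import Data.Nat.DivMod using (_mod_)
open import Data.Integer as ℤ using (ℤ; +_)
open import Data.Integer.DivMod using (n%ℕd<d)
open import Data.Bool.ListAction using (any; all)
open import Data.Fin as Fin using (Fin; toℕ; fromℕ<)
open import Data.Fin.Subset as Sub using (Subset; ⊤; _∩_; ∣_∣)
open import Data.Vec as Vec using (Vec; lookup; tabulate)
open import Data.Vec.Properties as VecP using ()
open import Data.List as List
  using (List; []; _∷_; [_]; _++_; map; concatMap; filterᵇ; length; upTo; downFrom; reverse; foldr; allFin)
open import Data.List.Relation.Unary.All using (All)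
open import Data.List.Relation.Unary.Linked using (Linked)
open import Data.Product using (_×_)
open import Relation.Nullary.Decidable using (⌊_⌋)
open import Relation.Binary.PropositionalEquality using (_≡_)
open import Algebra.Bundles using (CommutativeRing)

sublists : ∀ {a} {A : Set a} → List A → List (List A)
sublists []       = [ [] ]
sublists (x ∷ xs) = let r = sublists xs in map (x ∷_) r ++ r

-- all nonempty sublists: these correspond exactly to the index choices a₁ < … < aₘ, m ≥ 1
nonemptySublists : ∀ {a} {A : Set a} → List A → List (List A)
nonemptySublists xs = filterᵇ (λ ys → not (length ys ≡ᵇ 0)) (sublists xs)

allSubsets : (m : ℕ) → List (Subset m)
allSubsets zero    = [ Vec.[] ]
allSubsets (suc m) = concatMap (λ A → (true Vec.∷ A) ∷ (false Vec.∷ A) ∷ []) (allSubsets m)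

IsPk : ℕ → List ℕ → Set
IsPk k lam = All (λ a → 1 ℕ.≤ a × a ℕ.≤ k) lam × Linked ℕ._≥_ lam

-- partitions of size exactly N with all parts ≤ m (fuel argument f ≥ N)
ptnsF : ℕ → ℕ → ℕ → List (List ℕ)
ptnsF _       zero    m = [ [] ]
ptnsF zero    (suc N) m = []
ptnsF (suc f) (suc N) m =
  concatMap (λ a → map (suc a ∷_) (ptnsF f (N ∸ a) (suc a)))
            (filterᵇ (λ a → suc a ≤ᵇ m) (upTo (suc N)))

kparts : ℕ → ℕ → List (List ℕ)
kparts k N = concatMap (λ s → ptnsF s s k) (upTo (suc N))

-- The affine symmetric group S̃_{k+1}, n = k+1, realised faithfully by
-- affine permutations f : ℤ → ℤ (f(j+n) = f(j)+n) stored by their window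
-- [f(1),…,f(n)].  Elements of W are represented by words (List (Fin n))
-- over the generators s_i, two words being equal in W iff their windows agree.

module Aff (k : ℕ) where

  n : ℕ
  n = suc k

  I : Set
  I = Fin n

  Word : Set
  Word = List I

  Window : Set
  Window = Vec ℤ n

  apply : Window → ℤ → ℤ
  apply w m = lookup w (fromℕ< (n%ℕd<d (m ℤ.- + 1) n)) ℤ.+ ((m ℤ.- + 1) ℤ./ℕ n) ℤ.* + n

  compose : Window → Window → Window
  compose f g = tabulate (λ j → apply f (lookup g j))

  idWin : Window
  idWin = tabulate (λ j → + suc (toℕ j))

  genVal : I → ℕ → ℤ
  genVal Fin.zero j =
    if j ≡ᵇ 1 then + 0 else if j ≡ᵇ n then + suc n else + j
  genVal (Fin.suc i) j =
    let a = suc (toℕ i) in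
    if j ≡ᵇ a then + suc a else if j ≡ᵇ suc a then + a else + j

  gen : I → Window
  gen i = tabulate (λ j → genVal i (suc (toℕ j)))

  eval : Word → Window
  eval []      = idWin
  eval (i ∷ w) = compose (gen i) (eval w)

  _≈W_ : Word → Word → Set
  u ≈W v = eval u ≡ eval v

  _≈ᵇ_ : Word → Word → Bool
  u ≈ᵇ v = ⌊ VecP.≡-dec ℤ._≟_ (eval u) (eval v) ⌋

  inv : Word → Word
  inv = reverse

  words : ℕ → List Word
  words zero    = [ [] ]
  words (suc m) = concatMap (λ i → map (i ∷_) (words m)) (allFin n)

  len : Word → ℕ
  len w = go 0 (length w)
    where
    go : ℕ → ℕ → ℕ
    go m zero    = m
    go m (suc f) = if any (_≈ᵇ w) (words m) then m else go (suc m) f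

  reducedWords : Word → List Word
  reducedWords w = filterᵇ (_≈ᵇ w) (words (len w))

  -- strong (Bruhat) order, via the subword property:
  -- u ≤ v iff some reduced word of v has a subword that is a reduced word of u
  bruhatᵇ : Word → Word → Bool
  bruhatᵇ u v = any (λ r → any (λ s → (length s ≡ᵇ len u) ∧ (s ≈ᵇ u)) (sublists r)) (reducedWords v)

  _≤B_ : Word → Word → Set
  u ≤B v = T (bruhatᵇ u v)

  _≤L_ : Word → Word → Set
  u ≤L v = len (v ++ inv u) ℕ.+ len u ≡ len v

  leftWeakᵇ : Word → Word → Bool
  leftWeakᵇ u v = (len (v ++ inv u) ℕ.+ len u) ≡ᵇ len v

  grassᵇ : Word → Bool
  grassᵇ w = all (λ i → len w <ᵇ len (w ++ [ Fin.suc i ])) (allFin k)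

  Grass : Word → Set
  Grass w = T (grassᵇ w)

  _∈ᵇ_ : I → Subset n → Bool
  i ∈ᵇ A = lookup A i

  properᵇ : Subset n → Bool
  properᵇ A = not (all (_∈ᵇ A) (allFin n))

  -- least element of I not in A (exists when A ⊊ I); default 0
  firstOut : Subset n → I
  firstOut A = pick (allFin n)
    where
    pick : List I → I
    pick []       = Fin.zero
    pick (i ∷ is) = if i ∈ᵇ A then pick is else i

  -- cyclically decreasing word for A ⊊ I: with j ∉ A, read j-1, j-2, …, j+1 (mod n),
  -- keeping the letters in A
  dword : Subset n → Word
  dword A =
    filterᵇ (_∈ᵇ A)
      (map (λ t → ((toℕ (firstOut A) ℕ.+ n) ∸ suc t) mod n) (upTo k))

  phi : I → Word → Word
  phi s x = if len x <ᵇ len (s ∷ x) then s ∷ x else x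

  demazure : Word → Word → Word
  demazure []      y = y
  demazure (t ∷ x) y = phi t (demazure x y)

  res : ℕ → ℕ → I
  res i j = (j ℕ.+ k ℕ.* i) mod n

  -- w_λ : read rows from shortest (last) to longest (first), each right to left
  wλ : List ℕ → Word
  wλ lam = build 1 lam
    where
      row : ℕ → ℕ → Word
      row i a = map (λ t → res i (suc t)) (downFrom a)
      build : ℕ → List ℕ → Word
      build i []       = []
      build i (a ∷ as) = build (suc i) as ++ row i a

  strips : List ℕ → ℕ → List (Subset n)
  strips lam r = filterᵇ
    (λ A → properᵇ A ∧ (∣ A ∣ ≡ᵇ r) ∧ grassᵇ (dword A ++ wλ lam) ∧ leftWeakᵇ (wλ lam) (dword A ++ wλ lam))
    (allSubsets n)

  ⋂ : List (Subset n) → Subset n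
  ⋂ = foldr _∩_ ⊤

  IsMeet : Word → List Word → Set
  IsMeet x ys = All (x ≤B_) ys × (∀ ν → IsPk k ν → All (wλ ν ≤B_) ys → wλ ν ≤B x)

module KS {c ℓ : Level} (R : CommutativeRing c ℓ) (k : ℕ) where
  open CommutativeRing R
  open Aff k

  sumR : List Carrier → Carrier
  sumR = foldr _+_ 0#

  signed : ℕ → Carrier → Carrier
  signed e x = if (e ℕ.% 2) ≡ᵇ 0 then x else - x

  -- right-hand side of the K-k-Schur Pieri rule for h_r g_w
  -- (sign (-1)^{r + l(w) - l(d_A*w)}, same parity as r + l(w) + l(d_A*w))
  pieriRHS : (Word → Carrier) → Word → ℕ → Carrier
  pieriRHS g w r = sumR (map (λ A → signed (r ℕ.+ len w ℕ.+ len (demazure (dword A) w))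
                                           (g (demazure (dword A) w)))
                        (filterᵇ (λ A → properᵇ A ∧ (∣ A ∣ ≡ᵇ r) ∧ grassᵇ (demazure (dword A) w))
                                 (allSubsets n)))

  -- g̃ at a Grassmannian element x: sum of g_μ over μ ∈ P^k with w_μ ≤ x
  -- (μ ≤ x forces |μ| = l(w_μ) ≤ l(x) ≤ length of the word x)
  gtilde : (Word → Carrier) → Word → Carrier
  gtilde g x = sumR (map (λ μ → g (wλ μ)) (filterᵇ (λ μ → bruhatᵇ (wλ μ) x) (kparts k (length x))))

  htilde : (ℕ → Carrier) → ℕ → Carrier
  htilde h r = 1# + sumR (map (λ i → h (suc i)) (upTo r))

  inclExcl : (Word → Carrier) → List ℕ → ℕ → Carrier
  inclExcl g lam r = sumR (map (λ S → signed (suc (length S)) (gtilde g (dword (⋂ S) ++ wλ lam)))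
                             (nonemptySublists (strips lam r)))

{-# OPTIONS --safe #-}
-- To w in the affine symmetric group attach F w : ℤ → ℕ, F w y = #{p ≤ 0 : w(p) > y}.  On Grassmannian
-- elements the Bruhat order is the pointwise order of these functions.  In terms of F, both
-- t * v = max(t v, v) and dn t u = min(t u, u) change only the values at residue t, to the largest,
-- respectively the smallest, values compatible with the neighbouring ones; hence the adjunction
-- dn t u ≤ v ⇔ u ≤ t * v.  For a cyclically decreasing word with set of letters A it follows that
-- ν ≤ d_A * λ is a condition on A closed under supersets and under intersections.
--
-- Summing the Pieri rule over all μ ≤ λ and moving the operators to the other side, the coefficient of g_ν
-- in g̃_λ h̃_r becomes the sum over the sets A with |A| ≤ r of Σ_{B ⊆ A} (-1)^{|A| - |B|} [ν ≤ d_B * λ].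
-- By the closure properties the inner sum is 1 if A is the least set with ν ≤ d_A * λ, and 0 otherwise.
-- A least set is always a weak strip, and a weak strip of size < k can be enlarged by one letter, so the
-- coefficient is 1 exactly if ν lies below some weak strip of size r.  By inclusion–exclusion that is also
-- the coefficient on the right-hand side, since closure under intersections identifies the meets.
module Submission where

import Data.Nat

-- The obstacle is that `d_A * w` need not be Grassmannian when `w` is, while `F` determines an
-- element only up to permutations inside the windows, so that outside the Grassmannian elements the
-- pointwise order says less than the Bruhat order. The lower operators `dn` do preserve
-- Grassmannian elements; hence ν ≤ `d_A * w` is decided as a relation between the Grassmannian
-- elements `dn* b ν` and `w`. For the same reason `g` is extended by zero: the Pieri operator
-- becomes a product of one operator per letter, each preserving functions supported on Grassmannian
-- elements, and the letters can be moved to the other side one at a time. Recording only the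
-- positions p ≤ 0 suffices, because a translation by a multiple of n brings any two different
-- windows to the two sides of this threshold. Questions about neighbouring values y and y + 1 thus
-- become comparisons of the windows `κ` that contain them, and weak strips turn into inequalities
-- between such windows.

module Development (k' : Data.Nat.ℕ) where
  open import Defs
  open import Data.Bool using (Bool; true; false; if_then_else_; _∧_; _∨_; not; T)
  import Data.Bool.Properties as BoolP
  open import Data.Nat as ℕ using (ℕ; zero; suc; s≤s; z≤n; _∸_; _≡ᵇ_; _<ᵇ_; _≤ᵇ_)
  import Data.Nat.Properties as ℕP
  import Algebra.Properties.CommutativeSemigroup ℕP.+-commutativeSemigroup as ℕG
  open import Data.Integer as ℤ using (ℤ; +_; -[1+_]; _+_; _*_; _-_; -_; pred; _≤_; _<_; +≤+; -≤+; -<+; +<+; _/ℕ_; _%ℕ_)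
  import Data.Integer.Properties as ℤP
  open import Data.Integer.DivMod using (n%ℕd<d; a≡a%ℕn+[a/ℕn]*n)
  open import Algebra.Bundles using (module AbelianGroup; CommutativeRing)
  import Algebra.Properties.Group (AbelianGroup.group ℤP.+-0-abelianGroup) as ℤG
  open import Data.Fin as Fin using (Fin; toℕ; fromℕ<)
  import Data.Fin.Properties as FinP
  open import Data.Fin.Subset using (Subset; ∣_∣) renaming (⊤ to full; _∩_ to _∩ˢ_)
  open import Data.Vec as Vec using (lookup; tabulate)
  import Data.Vec.Properties as VecP
  open import Data.List as List using (List; []; _∷_; [_]; _++_; map; concatMap; filterᵇ; length; upTo; downFrom; reverse; foldr; allFin)
  import Data.List.Properties as ListP
  open import Data.Bool.ListAction using (any; all)
  open import Data.List.Relation.Unary.All as All using (All; []; _∷_)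
  import Data.List.Relation.Unary.All.Properties as AllP
  open import Data.List.Relation.Unary.Any as Any using (Any; here; there)
  import Data.List.Relation.Unary.Any.Properties as AnyP
  open import Data.List.Relation.Unary.Linked using ([]; [-]; _∷_)
  open import Data.List.Relation.Unary.AllPairs using ([]; _∷_)
  open import Data.List.Relation.Unary.Unique.Propositional using (Unique)
  import Data.List.Relation.Unary.Unique.Propositional.Properties as UniqueP
  open import Data.List.Membership.Propositional using (_∈_; _∉_; find; lose)
  import Data.List.Membership.Propositional.Properties as MemP
  open import Data.List.Relation.Binary.Sublist.Propositional as Sub using (_⊆_; []; _∷_; _∷ʳ_)
  import Data.List.Relation.Binary.Sublist.Propositional.Properties as SubP
  open import Data.Fin.Subset.Properties using (∣p∣≤n)
  open import Data.Vec using (_[_]≔_)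
  open import Data.List.Relation.Binary.Disjoint.Propositional using (Disjoint)
  open import Data.Nat.DivMod using (_mod_; m%n<n; [m+n]%n≡m%n)
  open import Data.Product using (_×_; _,_; proj₁; proj₂; ∃; ∃₂)
  open import Data.Sum using (_⊎_; inj₁; inj₂; [_,_]′)
  open import Data.Unit using (tt)
  open import Data.Empty using (⊥; ⊥-elim)
  open import Function using (_∘_; Equivalence)
  open import Relation.Nullary using (¬_; yes; no; Dec; contradiction)
  open import Relation.Nullary.Decidable using (toWitness; fromWitness; map′; _×-dec_; ⌊_⌋)
  open import Relation.Binary.PropositionalEquality hiding ([_])
  open import Relation.Binary.Definitions using (tri<; tri≈; tri>)
  open Aff (suc k')

  -- Division by `n`: residues, blocks and translations

  ÷n-< : ∀ q p a b → q < p → a ℕ.< n → + a + q * + n < + b + p * + n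
  ÷n-< q p a b q<p a<n = begin-strict
    + a + q * + n  <⟨ ℤP.+-monoˡ-< (q * + n) (+<+ a<n) ⟩
    + n + q * + n  ≡⟨ sym (ℤP.suc-* q (+ n)) ⟩
    ℤ.suc q * + n  ≤⟨ ℤP.*-monoʳ-≤-nonNeg (+ n) (ℤP.i<j⇒suc[i]≤j q<p) ⟩
    p * + n        ≤⟨ ℤP.i≤j+i (p * + n) (+ b) ⟩
    + b + p * + n  ∎ where open ℤP.≤-Reasoning

  ÷n-unique : ∀ {a b} q p → a ℕ.< n → b ℕ.< n → + a + q * + n ≡ + b + p * + n → a ≡ b × q ≡ p
  ÷n-unique {a} {b} q p a<n b<n e with ℤP.<-cmp q p
  ... | tri≈ _ refl _ = ℤP.+-injective (ℤG.∙-cancelʳ (q * + n) (+ a) (+ b) e) , refl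
  ... | tri< q<p _ _ = contradiction e (ℤP.<⇒≢ (÷n-< q p a b q<p a<n))
  ... | tri> _ _ p<q = contradiction (sym e) (ℤP.<⇒≢ (÷n-< p q b a p<q b<n))

  infix 8 _⁺ _⁻
  infixl 6 _⊕_

  opaque
    r : ℤ → I
    r y = fromℕ< (n%ℕd<d y n)

    block : ℤ → ℤ
    block y = y /ℕ n

    _⁺ _⁻ : ℤ → ℤ
    y ⁺ = ℤ.suc y
    y ⁻ = pred y

    _⊕_ : ℤ → ℤ → ℤ
    y ⊕ j = y + j * + n

  opaque
    unfolding r block

    toℕ-r : ∀ y → toℕ (r y) ≡ y %ℕ n
    toℕ-r y = FinP.toℕ-fromℕ< (n%ℕd<d y n)

    ÷n : ∀ y → y ≡ + toℕ (r y) + block y * + n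
    ÷n y = trans (a≡a%ℕn+[a/ℕn]*n y n) (cong (λ a → + a + block y * + n) (sym (toℕ-r y)))

  opaque
    unfolding _⁺ _⁻ _⊕_

    ⁺-def : ∀ y → y ⁺ ≡ ℤ.suc y
    ⁺-def y = refl

    ⊕-def : ∀ y j → y ⊕ j ≡ y + j * + n
    ⊕-def y j = refl

    ⁺⁻ : ∀ y → (y ⁺) ⁻ ≡ y
    ⁺⁻ = ℤP.pred-suc

    ⁻⁺ : ∀ y → (y ⁻) ⁺ ≡ y
    ⁻⁺ = ℤP.suc-pred

    ⊕-⁺ : ∀ y j → (y ⊕ j) ⁺ ≡ (y ⁺) ⊕ j
    ⊕-⁺ y j = sym (ℤP.+-assoc (+ 1) y (j * + n))

    ⊕-⁻ : ∀ y j → (y ⊕ j) ⁻ ≡ (y ⁻) ⊕ j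
    ⊕-⁻ y j = sym (ℤP.+-assoc (-[1+ 0 ]) y (j * + n))

    y<y⁺ : ∀ y → y < y ⁺
    y<y⁺ y = ℤP.suc[i]≤j⇒i<j ℤP.≤-refl

    <⇒⁺≤ : ∀ {y z} → y < z → y ⁺ ≤ z
    <⇒⁺≤ = ℤP.i<j⇒suc[i]≤j

    ⊕-mono-< : ∀ {y z} j → y < z → y ⊕ j < z ⊕ j
    ⊕-mono-< j = ℤP.+-monoˡ-< (j * + n)

    ⊕-cancel-< : ∀ {y z} j → y ⊕ j < z ⊕ j → y < z
    ⊕-cancel-< {y} {z} j p with y ℤP.<? z
    ... | yes q = q
    ... | no ¬q = contradiction p (ℤP.≤⇒≯ (ℤP.+-monoˡ-≤ (j * + n) (ℤP.≮⇒≥ ¬q)))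

  ⁻<y : ∀ y → y ⁻ < y
  ⁻<y y = subst (y ⁻ <_) (⁻⁺ y) (y<y⁺ (y ⁻))

  <⁺⇒≤ : ∀ {y z} → y < z ⁺ → y ≤ z
  <⁺⇒≤ {y} {z} p with y ℤP.≤? z
  ... | yes q = q
  ... | no ¬q = contradiction p (ℤP.≤⇒≯ (<⇒⁺≤ (ℤP.≰⇒> ¬q)))

  r-block-unique : ∀ {a} q y → a ℕ.< n → y ≡ + a + q * + n → toℕ (r y) ≡ a × block y ≡ q
  r-block-unique {a} q y a<n e = ÷n-unique (block y) q (FinP.toℕ<n (r y)) a<n (trans (sym (÷n y)) e)

  regroup : ∀ a q j m → (a + q * m) + j * m ≡ a + (q + j) * m
  regroup a q j m = trans (ℤP.+-assoc a (q * m) (j * m)) (cong (λ x → a + x) (sym (ℤP.*-distribʳ-+ m q j)))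

  cancel : ∀ q p → q + (p - q) ≡ p
  cancel q p = trans (ℤP.+-comm q (p - q)) (trans (ℤP.+-assoc p (- q) q)
    (trans (cong (λ x → p + x) (ℤP.+-inverseˡ q)) (ℤP.+-identityʳ p)))

  shift-÷ : ∀ y j → y ⊕ j ≡ + toℕ (r y) + (block y + j) * + n
  shift-÷ y j = trans (⊕-def y j) (trans (cong (_+ j * + n) (÷n y)) (regroup (+ toℕ (r y)) (block y) j (+ n)))

  r-⊕ : ∀ y j → r (y ⊕ j) ≡ r y
  r-⊕ y j = FinP.toℕ-injective (proj₁ (r-block-unique (block y + j) _ (FinP.toℕ<n (r y)) (shift-÷ y j)))

  block-⊕ : ∀ y j → block (y ⊕ j) ≡ block y + j
  block-⊕ y j = proj₂ (r-block-unique (block y + j) _ (FinP.toℕ<n (r y)) (shift-÷ y j))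

  r-≡⇒⊕ : ∀ y z → r y ≡ r z → ∃ λ j → z ≡ y ⊕ j
  r-≡⇒⊕ y z e = block z - block y ,
    trans (÷n z) (trans (cong₂ (λ i q → + toℕ i + q * + n) (sym e) (sym (cancel (block y) (block z))))
      (sym (shift-÷ y (block z - block y))))

  r-+ : ∀ j → j ℕ.< n → toℕ (r (+ j)) ≡ j
  r-+ j j<n = proj₁ (r-block-unique (+ 0) (+ j) j<n (sym (ℤP.+-identityʳ (+ j))))

  block-+ : ∀ j → j ℕ.< n → block (+ j) ≡ + 0
  block-+ j j<n = proj₂ (r-block-unique (+ 0) (+ j) j<n (sym (ℤP.+-identityʳ (+ j))))

  rep : I → ℤ
  rep t = + toℕ t

  r-rep : ∀ t → r (rep t) ≡ t
  r-rep t = FinP.toℕ-injective (r-+ (toℕ t) (FinP.toℕ<n t))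

  block-mono : ∀ {y z} → y ≤ z → block y ≤ block z
  block-mono {y} {z} y≤z with (block y) ℤP.≤? (block z)
  ... | yes p = p
  ... | no ¬p = let z<y = ℤP.≰⇒> ¬p in contradiction y≤z (ℤP.<⇒≱ (begin-strict
      z                                ≡⟨ ÷n z ⟩
      + toℕ (r z) + (block z) * + n     <⟨ ℤP.+-monoˡ-< (block z * + n) (+<+ (FinP.toℕ<n (r z))) ⟩
      + n + (block z) * + n             ≡⟨ sym (ℤP.suc-* (block z) (+ n)) ⟩
      ℤ.suc (block z) * + n             ≤⟨ ℤP.*-monoʳ-≤-nonNeg (+ n) (ℤP.i<j⇒suc[i]≤j z<y) ⟩
      (block y) * + n                   ≤⟨ ℤP.i≤j+i _ (+ toℕ (r y)) ⟩
      + toℕ (r y) + (block y) * + n     ≡⟨ sym (÷n y) ⟩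
      y                                ∎))
    where open ℤP.≤-Reasoning

  r-suc : ∀ {y z} → r y ≡ r z → r (y ⁺) ≡ r (z ⁺)
  r-suc {y} {z} e with r-≡⇒⊕ y z e
  ... | j , refl = sym (trans (cong r (⊕-⁺ y j)) (r-⊕ (y ⁺) j))

  r-pred : ∀ {y z} → r y ≡ r z → r (y ⁻) ≡ r (z ⁻)
  r-pred {y} {z} e with r-≡⇒⊕ y z e
  ... | j , refl = sym (trans (cong r (⊕-⁻ y j)) (r-⊕ (y ⁻) j))

  r-suc-inj : ∀ {y z} → r (y ⁺) ≡ r (z ⁺) → r y ≡ r z
  r-suc-inj {y} {z} e = subst₂ (λ a b → r a ≡ r b) (⁺⁻ y) (⁺⁻ z) (r-pred e)

  1≢jn : ∀ j → + 1 ≢ j * + n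
  1≢jn (+ 0) ()
  1≢jn (+ suc m) e with ℤP.+-injective (trans e (sym (ℤP.pos-* (suc m) n)))
  ... | ()
  1≢jn (-[1+ m ]) ()

  -- The assumption k ≥ 1 enters here: as n ≥ 2, neighbouring integers have different residues, so
  -- `lo` and `hi` below exclude each other and `s` is consistent.
  r-suc≢ : ∀ y → r (y ⁺) ≢ r y
  r-suc≢ y e with r-≡⇒⊕ y (y ⁺) (sym e)
  ... | j , q = 1≢jn j (ℤG.∙-cancelˡ y (+ 1) (j * + n)
    (trans (ℤP.+-comm y (+ 1)) (trans (sym (⁺-def y)) (trans q (⊕-def y j)))))

  r-pred≢ : ∀ y → r (y ⁻) ≢ r y
  r-pred≢ y e = r-suc≢ (y ⁻) (trans (cong r (⁻⁺ y)) (sym e))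

  -- The simple reflections on ℤ

  data Pos (t : I) (y : ℤ) : Set where
    lo  : r y ≡ t → Pos t y
    hi  : r (y ⁻) ≡ t → Pos t y
    off : r y ≢ t → r (y ⁻) ≢ t → Pos t y

  pos : ∀ t y → Pos t y
  pos t y with r y FinP.≟ t | r (y ⁻) FinP.≟ t
  ... | yes e | _ = lo e
  ... | no _ | yes e = hi e
  ... | no a | no b = off a b

  opaque
    s : I → ℤ → ℤ
    s t y with pos t y
    ... | lo _ = y ⁺
    ... | hi _ = y ⁻
    ... | off _ _ = y

    s-lo : ∀ {t y} → r y ≡ t → s t y ≡ y ⁺
    s-lo {t} {y} e with pos t y
    ... | lo _ = refl
    ... | hi e' = contradiction (trans e' (sym e)) (r-pred≢ y)
    ... | off ¬e _ = contradiction e ¬e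

    s-hi : ∀ {t y} → r (y ⁻) ≡ t → s t y ≡ y ⁻
    s-hi {t} {y} e with pos t y
    ... | lo e' = contradiction (trans e (sym e')) (r-pred≢ y)
    ... | hi _ = refl
    ... | off _ ¬e = contradiction e ¬e

    s-off : ∀ {t y} → r y ≢ t → r (y ⁻) ≢ t → s t y ≡ y
    s-off {t} {y} a b with pos t y
    ... | lo e = contradiction e a
    ... | hi e = contradiction e b
    ... | off _ _ = refl

  r⁺⁻ : ∀ {t} y → r y ≡ t → r ((y ⁺) ⁻) ≡ t
  r⁺⁻ y e = trans (cong r (⁺⁻ y)) e

  s-⁺ : ∀ {t y} → r y ≡ t → s t (y ⁺) ≡ y
  s-⁺ {t} {y} e = trans (s-hi (r⁺⁻ y e)) (⁺⁻ y)

  s-invol : ∀ t y → s t (s t y) ≡ y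
  s-invol t y with pos t y
  ... | lo e = trans (cong (s t) (s-lo e)) (s-⁺ e)
  ... | hi e = trans (cong (s t) (s-hi e)) (trans (s-lo e) (⁻⁺ y))
  ... | off a b = trans (cong (s t) (s-off a b)) (s-off a b)

  s-inj : ∀ t {y z} → s t y ≡ s t z → y ≡ z
  s-inj t {y} {z} e = trans (sym (s-invol t y)) (trans (cong (s t) e) (s-invol t z))

  r-⊕⁻ : ∀ y j → r ((y ⊕ j) ⁻) ≡ r (y ⁻)
  r-⊕⁻ y j = trans (cong r (⊕-⁻ y j)) (r-⊕ (y ⁻) j)

  s-⊕ : ∀ t y j → s t (y ⊕ j) ≡ s t y ⊕ j
  s-⊕ t y j with pos t y
  ... | lo e = trans (s-lo (trans (r-⊕ y j) e)) (trans (⊕-⁺ y j) (cong (_⊕ j) (sym (s-lo e))))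
  ... | hi e = trans (s-hi (trans (r-⊕⁻ y j) e)) (trans (⊕-⁻ y j) (cong (_⊕ j) (sym (s-hi e))))
  ... | off a b = trans (s-off (λ e → a (trans (sym (r-⊕ y j)) e)) (λ e → b (trans (sym (r-⊕⁻ y j)) e)))
                    (cong (_⊕ j) (sym (s-off a b)))

  -- Words acting on ℤ, and the exchange property

  -- `act w` is the affine permutation of `w` and `ia w` its inverse, so `ia w y` is the position of
  -- the value y. Left multiplication exchanges values, hence left ascents and descents are read off
  -- from `ia`.
  act ia : Word → ℤ → ℤ
  act []      y = y
  act (t ∷ w) y = s t (act w y)
  ia []      y = y
  ia (t ∷ w) y = ia w (s t y)

  act-ia : ∀ w y → act w (ia w y) ≡ y
  act-ia []      y = refl
  act-ia (t ∷ w) y = trans (cong (s t) (act-ia w (s t y))) (s-invol t y)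

  ia-act : ∀ w y → ia w (act w y) ≡ y
  ia-act []      y = refl
  ia-act (t ∷ w) y = trans (cong (ia w) (s-invol t (act w y))) (ia-act w y)

  act-++ : ∀ u v y → act (u ++ v) y ≡ act u (act v y)
  act-++ []      v y = refl
  act-++ (t ∷ u) v y = cong (s t) (act-++ u v y)

  ia-++ : ∀ u v y → ia (u ++ v) y ≡ ia v (ia u y)
  ia-++ []      v y = refl
  ia-++ (t ∷ u) v y = ia-++ u v (s t y)

  ia-⊕ : ∀ w y j → ia w (y ⊕ j) ≡ ia w y ⊕ j
  ia-⊕ []      y j = refl
  ia-⊕ (t ∷ w) y j = trans (cong (ia w) (s-⊕ t y j)) (ia-⊕ w (s t y) j)

  act-⊕ : ∀ w y j → act w (y ⊕ j) ≡ act w y ⊕ j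
  act-⊕ []      y j = refl
  act-⊕ (t ∷ w) y j = trans (cong (s t) (act-⊕ w y j)) (s-⊕ t (act w y) j)

  ia-inj : ∀ w {y z} → ia w y ≡ ia w z → y ≡ z
  ia-inj w {y} {z} e = trans (sym (act-ia w y)) (trans (cong (act w) e) (act-ia w z))

  act-inj : ∀ w {y z} → act w y ≡ act w z → y ≡ z
  act-inj w {y} {z} e = trans (sym (ia-act w y)) (trans (cong (ia w) e) (ia-act w z))

  ia-reverse : ∀ w y → ia (reverse w) y ≡ act w y
  ia-reverse []      y = refl
  ia-reverse (t ∷ w) y = trans (cong (λ v → ia v y) (ListP.unfold-reverse t w))
    (trans (ia-++ (reverse w) [ t ] y) (cong (s t) (ia-reverse w y)))

  infix 4 _~_
  -- Stated through the inverses because a letter put in front only precomposes `ia` with `s t`,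
  -- which makes `~-∷` immediate.
  record _~_ (u v : Word) : Set where
    constructor mk~
    field at : ∀ y → ia u y ≡ ia v y
  open _~_ public

  ~-refl : ∀ {u} → u ~ u
  ~-refl = mk~ λ _ → refl

  ~-sym : ∀ {u v} → u ~ v → v ~ u
  ~-sym e = mk~ λ y → sym (at e y)

  ~-trans : ∀ {u v w} → u ~ v → v ~ w → u ~ w
  ~-trans e f = mk~ λ y → trans (at e y) (at f y)

  ~⇒act : ∀ u v → u ~ v → ∀ y → act u y ≡ act v y
  ~⇒act u v e y = ia-inj u (trans (ia-act u y) (sym (trans (at e (act v y)) (ia-act v y))))

  act⇒~ : ∀ u v → (∀ y → act u y ≡ act v y) → u ~ v
  act⇒~ u v e = mk~ λ y → act-inj u (trans (act-ia u y) (sym (trans (e (ia v y)) (act-ia v y))))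

  ~-∷ : ∀ {u v} t → u ~ v → (t ∷ u) ~ (t ∷ v)
  ~-∷ t e = mk~ λ y → at e (s t y)

  ~-++ : ∀ {u u' v v'} → u ~ u' → v ~ v' → (u ++ v) ~ (u' ++ v')
  ~-++ {u} {u'} {v} {v'} e f = mk~ λ y →
    trans (ia-++ u v y) (trans (trans (at f (ia u y)) (cong (ia v') (at e y))) (sym (ia-++ u' v' y)))

  ~-reverse : ∀ u v → u ~ v → reverse u ~ reverse v
  ~-reverse u v e = mk~ λ y → trans (ia-reverse u y) (trans (~⇒act u v e y) (sym (ia-reverse v y)))

  tt~ : ∀ t w → (t ∷ t ∷ w) ~ w
  tt~ t w = mk~ λ y → cong (ia w) (s-invol t y)

  -- Windows and the comparison with `_≈W_`

  opaque
    unfolding r block _⊕_ _⁻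

    apply-r : ∀ w y → apply w y ≡ lookup w (r (y ⁻)) ⊕ block (y ⁻)
    apply-r w y = cong (λ z → lookup w (fromℕ< (n%ℕd<d z n)) + (z /ℕ n) * + n) (ℤP.+-comm y -[1+ 0 ])

    +suc : ∀ j → (+ suc j) ⁻ ≡ + j
    +suc j = refl

    suc+ : ∀ j → (+ j) ⁺ ≡ + suc j
    suc+ j = refl

    ⊕0 : ∀ y → y ⊕ + 0 ≡ y
    ⊕0 y = ℤP.+-identityʳ y

    +n⊕ : + n ≡ + 0 ⊕ + 1
    +n⊕ = sym (trans (ℤP.+-identityˡ _) (ℤP.*-identityˡ (+ n)))

    window-÷n : ∀ y → y ≡ + suc (toℕ (r (y ⁻))) ⊕ block (y ⁻)
    window-÷n y = trans (sym (ℤP.suc-pred y)) (trans (cong ℤ.suc (÷n (pred y)))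
      (sym (ℤP.+-assoc (+ 1) (+ toℕ (r (y ⁻))) (block (y ⁻) * + n))))

    ⊕-+ : ∀ y i j → y ⊕ (i + j) ≡ (y ⊕ i) ⊕ j
    ⊕-+ y i j = sym (regroup y i j (+ n))

  apply-⊕ : ∀ w y j → apply w (y ⊕ j) ≡ apply w y ⊕ j
  apply-⊕ w y j = begin
    apply w (y ⊕ j)                                       ≡⟨ apply-r w (y ⊕ j) ⟩
    lookup w (r ((y ⊕ j) ⁻)) ⊕ block ((y ⊕ j) ⁻)          ≡⟨ cong (λ z → lookup w (r z) ⊕ block z) (⊕-⁻ y j) ⟩
    lookup w (r (y ⁻ ⊕ j)) ⊕ block (y ⁻ ⊕ j)              ≡⟨ cong₂ (λ i q → lookup w i ⊕ q) (r-⊕ (y ⁻) j) (block-⊕ (y ⁻) j) ⟩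
    lookup w (r (y ⁻)) ⊕ (block (y ⁻) + j)                ≡⟨ ⊕-+ _ (block (y ⁻)) j ⟩
    (lookup w (r (y ⁻)) ⊕ block (y ⁻)) ⊕ j                ≡⟨ cong (_⊕ j) (sym (apply-r w y)) ⟩
    apply w y ⊕ j                                         ∎ where open ≡-Reasoning

  r-+n : r (+ n) ≡ Fin.zero
  r-+n = trans (cong r +n⊕) (trans (r-⊕ (+ 0) (+ 1)) (FinP.toℕ-injective (r-+ 0 (s≤s z≤n))))

  r-+suc⁻ : ∀ j → r ((+ suc j) ⁻) ≡ r (+ j)
  r-+suc⁻ j = cong r (+suc j)

  T⇒≡ : ∀ {b} → T b → b ≡ true
  T⇒≡ = Equivalence.to BoolP.T-≡

  ≡⇒T : ∀ {b} → b ≡ true → T b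
  ≡⇒T = Equivalence.from BoolP.T-≡

  ≡ᵇ-true : ∀ a b → (a ≡ᵇ b) ≡ true → a ≡ b
  ≡ᵇ-true a b e = ℕP.≡ᵇ⇒≡ a b (subst T (sym e) tt)

  ≡ᵇ-false : ∀ a b → (a ≡ᵇ b) ≡ false → a ≢ b
  ≡ᵇ-false a b e refl = subst T e (ℕP.≡⇒≡ᵇ a a refl)

  genVal-s : ∀ i m → m ℕ.< n → genVal i (suc m) ≡ s i (+ suc m)
  genVal-s Fin.zero zero _ = sym (trans (s-hi (trans (r-+suc⁻ 0) (FinP.toℕ-injective (r-+ 0 (s≤s z≤n))))) (+suc 0))
  -- The generator of residue 0 acts on a window only at its ends: n, of residue 0, goes up to n +
  -- 1, and 1 goes down to 0. The test asks whether the entry m + 2 is the last one.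
  genVal-s Fin.zero (suc m) m<n with m ≡ᵇ k' in e
  ... | true = sym (trans (s-lo (trans (cong (λ j → r (+ suc (suc j))) (≡ᵇ-true m k' e)) r-+n))
                 (trans (suc+ (suc (suc m))) (cong (λ j → + suc (suc (suc j))) (≡ᵇ-true m k' e))))
  ... | false = sym (s-off
      (λ q → ℕP.1+n≢0 (trans (sym (r-+ (suc (suc m)) (ℕP.≤∧≢⇒< m<n (λ q' → ≡ᵇ-false m k' e (ℕP.suc-injective (ℕP.suc-injective q')))))) (cong toℕ q)))
      (λ q → ℕP.1+n≢0 (trans (sym (r-+ (suc m) m<n)) (cong toℕ (trans (sym (r-+suc⁻ (suc m))) q)))))
  genVal-s (Fin.suc i) m m<n with m ≡ᵇ toℕ i in e
  ... | true = sym (trans (s-lo (FinP.toℕ-injective (trans (r-+ (suc m) (s≤s (subst (ℕ._< suc k') (sym q) (FinP.toℕ<n i)))) (cong suc q))))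
                 (trans (suc+ (suc m)) (cong (λ j → + suc (suc j)) q)))
    where q = ≡ᵇ-true m (toℕ i) e
  ... | false with m ≡ᵇ suc (toℕ i) in e'
  ...   | true = sym (trans (s-hi (trans (r-+suc⁻ m) (FinP.toℕ-injective (trans (r-+ m m<n) q)))) (trans (+suc m) (cong +_ q)))
    where q = ≡ᵇ-true m (suc (toℕ i)) e'
  ...   | false = sym (s-off lemma
      (λ q → ≡ᵇ-false m (suc (toℕ i)) e' (trans (sym (r-+ m m<n)) (cong toℕ (trans (sym (r-+suc⁻ m)) q)))))
    where
    lemma : r (+ suc m) ≢ Fin.suc i
    lemma q with ℕP.m≤n⇒m<n∨m≡n m<n
    ... | inj₁ p = ≡ᵇ-false m (toℕ i) e (ℕP.suc-injective (trans (sym (r-+ (suc m) p)) (cong toℕ q)))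
    ... | inj₂ refl = FinP.0≢1+n (trans (sym r-+n) q)

  apply-gen : ∀ i y → apply (gen i) y ≡ s i y
  apply-gen i y = begin
    apply (gen i) y                          ≡⟨ apply-r (gen i) y ⟩
    lookup (gen i) (r (y ⁻)) ⊕ block (y ⁻)   ≡⟨ cong (_⊕ block (y ⁻)) (VecP.lookup∘tabulate (λ j → genVal i (suc (toℕ j))) (r (y ⁻))) ⟩
    genVal i (suc (toℕ (r (y ⁻)))) ⊕ block (y ⁻) ≡⟨ cong (_⊕ block (y ⁻)) (genVal-s i _ (FinP.toℕ<n (r (y ⁻)))) ⟩
    s i (+ suc (toℕ (r (y ⁻)))) ⊕ block (y ⁻) ≡⟨ sym (s-⊕ i _ _) ⟩
    s i (+ suc (toℕ (r (y ⁻))) ⊕ block (y ⁻)) ≡⟨ cong (s i) (sym (window-÷n y)) ⟩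
    s i y ∎ where open ≡-Reasoning

  apply-eval : ∀ w y → apply (eval w) y ≡ act w y
  apply-eval [] y = trans (apply-r idWin y) (trans (cong (_⊕ block (y ⁻)) (VecP.lookup∘tabulate (λ j → + suc (toℕ j)) (r (y ⁻)))) (sym (window-÷n y)))
  apply-eval (i ∷ w) y = begin
    apply (compose (gen i) (eval w)) y                              ≡⟨ apply-r (compose (gen i) (eval w)) y ⟩
    lookup (compose (gen i) (eval w)) (r (y ⁻)) ⊕ block (y ⁻)       ≡⟨ cong (_⊕ block (y ⁻)) (VecP.lookup∘tabulate (λ j → apply (gen i) (lookup (eval w) j)) (r (y ⁻))) ⟩
    apply (gen i) (lookup (eval w) (r (y ⁻))) ⊕ block (y ⁻)         ≡⟨ sym (apply-⊕ (gen i) (lookup (eval w) (r (y ⁻))) (block (y ⁻))) ⟩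
    apply (gen i) (lookup (eval w) (r (y ⁻)) ⊕ block (y ⁻))         ≡⟨ cong (apply (gen i)) (sym (apply-r (eval w) y)) ⟩
    apply (gen i) (apply (eval w) y)                                ≡⟨ cong (apply (gen i)) (apply-eval w y) ⟩
    apply (gen i) (act w y)                                         ≡⟨ apply-gen i (act w y) ⟩
    s i (act w y)                                                   ∎ where open ≡-Reasoning

  lookup-apply : ∀ w (j : I) → lookup w j ≡ apply w (+ suc (toℕ j))
  lookup-apply w j = sym (trans (apply-r w (+ suc (toℕ j))) (trans (cong₂ (λ i q → lookup w i ⊕ q)
     (trans (r-+suc⁻ (toℕ j)) (r-rep j)) (trans (cong block (+suc (toℕ j))) (block-+ (toℕ j) (FinP.toℕ<n j)))) (⊕0 _)))

  ≈W⇒~ : ∀ u v → u ≈W v → u ~ v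
  ≈W⇒~ u v e = act⇒~ u v (λ y → trans (sym (apply-eval u y)) (trans (cong (λ f → apply f y) e) (apply-eval v y)))

  ~⇒≈W : ∀ u v → u ~ v → u ≈W v
  ~⇒≈W u v e = begin
    eval u                    ≡⟨ sym (VecP.tabulate∘lookup (eval u)) ⟩
    tabulate (lookup (eval u)) ≡⟨ VecP.tabulate-cong (λ j → trans (lookup-apply (eval u) j) (trans (apply-eval u (+ suc (toℕ j)))
        (trans (~⇒act u v e _) (sym (trans (lookup-apply (eval v) j) (apply-eval v (+ suc (toℕ j)))))))) ⟩
    tabulate (lookup (eval v)) ≡⟨ VecP.tabulate∘lookup (eval v) ⟩
    eval v ∎ where open ≡-Reasoning

  ≈ᵇ⇒~ : ∀ u v → T (u ≈ᵇ v) → u ~ v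
  ≈ᵇ⇒~ u v p = ≈W⇒~ u v (toWitness p)

  ~⇒≈ᵇ : ∀ u v → u ~ v → T (u ≈ᵇ v)
  ~⇒≈ᵇ u v e = fromWitness (~⇒≈W u v e)

  s≤⁺ : ∀ t y → s t y ≤ y ⁺
  s≤⁺ t y with pos t y
  ... | lo e = ℤP.≤-reflexive (s-lo e)
  ... | hi e = ℤP.≤-trans (ℤP.≤-reflexive (s-hi e)) (ℤP.<⇒≤ (ℤP.<-trans (⁻<y y) (y<y⁺ y)))
  ... | off a b = ℤP.≤-trans (ℤP.≤-reflexive (s-off a b)) (ℤP.<⇒≤ (y<y⁺ y))

  ⁻≤s : ∀ t y → y ⁻ ≤ s t y
  ⁻≤s t y with pos t y
  ... | lo e = ℤP.≤-trans (ℤP.<⇒≤ (ℤP.<-trans (⁻<y y) (y<y⁺ y))) (ℤP.≤-reflexive (sym (s-lo e)))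
  ... | hi e = ℤP.≤-reflexive (sym (s-hi e))
  ... | off a b = ℤP.≤-trans (ℤP.<⇒≤ (⁻<y y)) (ℤP.≤-reflexive (sym (s-off a b)))

  s≤ : ∀ t y → r y ≢ t → s t y ≤ y
  s≤ t y ¬e with pos t y
  ... | lo e = contradiction e ¬e
  ... | hi e = ℤP.≤-trans (ℤP.≤-reflexive (s-hi e)) (ℤP.<⇒≤ (⁻<y y))
  ... | off a b = ℤP.≤-reflexive (s-off a b)

  <⇒≤⁻ : ∀ {y z} → y < z → y ≤ z ⁻
  <⇒≤⁻ {y} {z} p = <⁺⇒≤ (subst (y <_) (sym (⁻⁺ z)) p)

  -- A letter moves every value by at most one, and upwards only at residue t; so the only pairs it
  -- can reverse are the adjacent pairs it exchanges.
  s-inversion : ∀ t {a b} → a < b → s t b < s t a → r a ≡ t × b ≡ a ⁺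
  s-inversion t {a} {b} a<b p with r a FinP.≟ t
  ... | no ¬e = contradiction (ℤP.≤-trans (s≤ t a ¬e) (ℤP.≤-trans (<⇒≤⁻ a<b) (⁻≤s t b))) (ℤP.<⇒≱ p)
  ... | yes e with b ℤP.≟ a ⁺
  ...   | yes q = e , q
  ...   | no ¬q = contradiction (ℤP.≤-trans (s≤⁺ t a) (ℤP.≤-trans (<⇒≤⁻ (ℤP.≤∧≢⇒< (<⇒⁺≤ a<b) (λ q → ¬q (sym q)))) (⁻≤s t b))) (ℤP.<⇒≱ p)

  -- Conjugation of a simple reflection by `q`: where the inverse of `q` keeps y and y + 1 adjacent,
  -- the letter t′ behind `q` can be carried through `q` to the front, where it becomes the letter r
  -- y.
  s-conj : ∀ q y t′ → r (ia q y) ≡ t′ → ia q (y ⁺) ≡ ia q y ⁺ → ∀ z → s t′ (ia q z) ≡ ia q (s (r y) z)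
  s-conj q y t′ e f z with pos (r y) z
  ... | lo p with r-≡⇒⊕ y z (sym p)
  ...   | j , refl = begin
    s t′ (ia q (y ⊕ j))   ≡⟨ s-lo (trans (cong r (ia-⊕ q y j)) (trans (r-⊕ _ j) e)) ⟩
    ia q (y ⊕ j) ⁺        ≡⟨ cong _⁺ (ia-⊕ q y j) ⟩
    (ia q y ⊕ j) ⁺        ≡⟨ ⊕-⁺ _ j ⟩
    ia q y ⁺ ⊕ j          ≡⟨ cong (_⊕ j) (sym f) ⟩
    ia q (y ⁺) ⊕ j        ≡⟨ sym (ia-⊕ q (y ⁺) j) ⟩
    ia q (y ⁺ ⊕ j)        ≡⟨ cong (ia q) (sym (⊕-⁺ y j)) ⟩
    ia q ((y ⊕ j) ⁺)      ≡⟨ cong (ia q) (sym (s-lo p)) ⟩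
    ia q (s (r y) (y ⊕ j)) ∎ where open ≡-Reasoning
  s-conj q y t′ e f z | hi p with r-≡⇒⊕ y (z ⁻) (sym p)
  ...   | j , z⁻≡ = begin
    s t′ (ia q z)          ≡⟨ cong (s t′) iaz ⟩
    s t′ ((ia q y ⊕ j) ⁺)  ≡⟨ s-⁺ (trans (r-⊕ _ j) e) ⟩
    ia q y ⊕ j             ≡⟨ sym (ia-⊕ q y j) ⟩
    ia q (y ⊕ j)           ≡⟨ cong (ia q) (sym z⁻≡) ⟩
    ia q (z ⁻)             ≡⟨ cong (ia q) (sym (s-hi p)) ⟩
    ia q (s (r y) z)       ∎
    where
    open ≡-Reasoning
    iaz : ia q z ≡ (ia q y ⊕ j) ⁺
    iaz = begin
      ia q z           ≡⟨ cong (ia q) (trans (sym (⁻⁺ z)) (trans (cong _⁺ z⁻≡) (⊕-⁺ y j))) ⟩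
      ia q (y ⁺ ⊕ j)   ≡⟨ ia-⊕ q (y ⁺) j ⟩
      ia q (y ⁺) ⊕ j   ≡⟨ cong (_⊕ j) f ⟩
      ia q y ⁺ ⊕ j     ≡⟨ sym (⊕-⁺ _ j) ⟩
      (ia q y ⊕ j) ⁺   ∎
  s-conj q y t′ e f z | off a b = trans (s-off c d) (cong (ia q) (sym (s-off a b)))
    where
    c : r (ia q z) ≢ t′
    c p with r-≡⇒⊕ (ia q y) (ia q z) (trans e (sym p))
    ... | j , h = a (trans (cong r (ia-inj q (trans h (sym (ia-⊕ q y j))))) (r-⊕ y j))
    d : r (ia q z ⁻) ≢ t′
    d p with r-≡⇒⊕ (ia q y) (ia q z ⁻) (trans e (sym p))
    ... | j , h = b (trans (cong (λ x → r (x ⁻)) z≡) (trans (r-⊕⁻ (y ⁺) j) (cong r (⁺⁻ y))))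
      where
      z≡ : z ≡ y ⁺ ⊕ j
      z≡ = ia-inj q (trans (sym (⁻⁺ (ia q z))) (trans (cong _⁺ h) (trans (⊕-⁺ _ j)
             (trans (cong (_⊕ j) (sym f)) (sym (ia-⊕ q (y ⁺) j))))))

  -- If w, entered after the prefix q, inverts the pair of values y, y + 1, then one letter of w can be
  -- traded for the letter of residue y at the front.
  exchange : ∀ w q y → ia q y < ia q (y ⁺) → ia w (ia q (y ⁺)) < ia w (ia q y) →
             ∃ λ w′ → length w ≡ suc (length w′) × (q ++ w) ~ (r y ∷ q ++ w′)
  exchange [] q y p p′ = contradiction p′ (ℤP.<-asym p)
  exchange (t′ ∷ v) q y p p′ with ℤP.<-cmp (s t′ (ia q y)) (s t′ (ia q (y ⁺)))
  ... | tri≈ _ e _ = contradiction (s-inj t′ e) (ℤP.<⇒≢ p)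
  ... | tri> _ _ g with s-inversion t′ p g
  ...   | e , f = v , refl , mk~ λ z → trans (ia-++ q (t′ ∷ v) z)
                    (trans (cong (ia v) (s-conj q y t′ e f z)) (sym (ia-++ q v (s (r y) z))))
  exchange (t′ ∷ v) q y p p′ | tri< g _ _ with exchange v (q ++ [ t′ ]) y
       (subst₂ _<_ (sym (ia-++ q [ t′ ] y)) (sym (ia-++ q [ t′ ] (y ⁺))) g)
       (subst₂ (λ a b → ia v b < ia v a) (sym (ia-++ q [ t′ ] y)) (sym (ia-++ q [ t′ ] (y ⁺))) p′)
  ... | w″ , l , e = t′ ∷ w″ , cong suc l , subst₂ (λ a b → a ~ (r y ∷ b)) (ListP.++-assoc q [ t′ ] v) (ListP.++-assoc q [ t′ ] w″) e

  -- Length and Grassmannian elements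

  words-length : ∀ m u → u ∈ words m → length u ≡ m
  words-length zero    u (here refl) = refl
  words-length (suc m) u p with Any.satisfied (AnyP.concatMap⁻ (λ i → map (i ∷_) (words m)) {xs = allFin n} p)
  ... | i , q with MemP.∈-map⁻ (i ∷_) q
  ...   | v , v∈ , refl = cong suc (words-length m v v∈)

  ∈-words : ∀ u → u ∈ words (length u)
  ∈-words []      = here refl
  ∈-words (i ∷ u) = AnyP.concatMap⁺ (λ j → map (j ∷_) (words (length u))) {xs = allFin n}
    (Any.map (λ { refl → MemP.∈-map⁺ (i ∷_) (∈-words u) }) (MemP.∈-allFin i))

  -- Unification recovers the local search function of len, which cannot be named.
  mutual
    search : Word → ℕ → ℕ → ℕ
    search = _
    len-search : ∀ w → len w ≡ search w 0 (length w)
    len-search w with length w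
    ... | f with 0
    ... | m = refl

  -- The invariant of the search: no word shorter than m represents `w`, and the fuel f still
  -- reaches some representative. Hence m, the default answer on exhausted fuel, is the right one.
  search-spec : ∀ w m f → (∀ u → u ~ w → m ℕ.≤ length u) → (∃ λ u → length u ℕ.≤ m ℕ.+ f × u ~ w) →
                (∃ λ u → length u ≡ search w m f × u ~ w) × (∀ u → u ~ w → search w m f ℕ.≤ length u)
  search-spec w m zero lb (u , p , e) =
    (u , ℕP.≤-antisym (ℕP.≤-trans p (ℕP.≤-reflexive (ℕP.+-identityʳ m))) (lb u e) , e) , lb
  search-spec w m (suc f) lb (u , p , e) with any (_≈ᵇ w) (words m) in eq
  ... | true with find (AnyP.any⁻ (_≈ᵇ w) (words m) (subst T (sym eq) tt))
  ...   | v , v∈ , q = (v , words-length m v v∈ , ≈ᵇ⇒~ v w q) , lb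
  search-spec w m (suc f) lb (u , p , e) | false =
    search-spec w (suc m) f
      (λ v q → ℕP.≤∧≢⇒< (lb v q) (λ { refl → subst T eq (AnyP.any⁺ (_≈ᵇ w) (lose (∈-words v) (~⇒≈ᵇ v w q))) }))
      (u , ℕP.≤-trans p (ℕP.≤-reflexive (ℕP.+-suc m f)) , e)

  len-spec : ∀ w → (∃ λ u → length u ≡ len w × u ~ w) × (∀ u → u ~ w → len w ℕ.≤ length u)
  len-spec w rewrite len-search w = search-spec w 0 (length w) (λ _ _ → z≤n) (w , ℕP.≤-refl , ~-refl)

  shortest : ∀ w → ∃ λ u → length u ≡ len w × u ~ w
  shortest w = proj₁ (len-spec w)

  len≤ : ∀ u w → u ~ w → len w ℕ.≤ length u
  len≤ u w = proj₂ (len-spec w) u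

  len-mono : ∀ u v → u ~ v → len u ℕ.≤ len v
  len-mono u v e with shortest v
  ... | v′ , l , q = ℕP.≤-trans (len≤ v′ u (~-trans q (~-sym e))) (ℕP.≤-reflexive l)

  len-cong : ∀ u v → u ~ v → len u ≡ len v
  len-cong u v e = ℕP.≤-antisym (len-mono u v e) (len-mono v u (~-sym e))

  len≤length : ∀ w → len w ℕ.≤ length w
  len≤length w = len≤ w w ~-refl

  len-++ : ∀ u v → len (u ++ v) ℕ.≤ len u ℕ.+ len v
  len-++ u v with shortest u | shortest v
  ... | u′ , l , e | v′ , l′ , e′ = ℕP.≤-trans (len≤ (u′ ++ v′) (u ++ v) (~-++ e e′))
    (ℕP.≤-reflexive (trans (ListP.length-++ u′) (cong₂ ℕ._+_ l l′)))

  len-∷ : ∀ t w → len (t ∷ w) ℕ.≤ suc (len w)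
  len-∷ t w with shortest w
  ... | w′ , l , e = ℕP.≤-trans (len≤ (t ∷ w′) (t ∷ w) (~-∷ t e)) (ℕP.≤-reflexive (cong suc l))

  len-∷-≥ : ∀ t w → len w ℕ.≤ suc (len (t ∷ w))
  len-∷-≥ t w = ℕP.≤-trans (len-mono w (t ∷ t ∷ w) (~-sym (tt~ t w))) (len-∷ t (t ∷ w))

  len-reverse≤ : ∀ w → len (reverse w) ℕ.≤ len w
  len-reverse≤ w with shortest w
  ... | w′ , l , e = ℕP.≤-trans (len≤ (reverse w′) (reverse w) (~-reverse w′ w e))
                       (ℕP.≤-reflexive (trans (ListP.length-reverse w′) l))

  len-reverse : ∀ w → len (reverse w) ≡ len w
  len-reverse w = ℕP.≤-antisym (len-reverse≤ w)
    (subst (λ v → len v ℕ.≤ len (reverse w)) (ListP.reverse-involutive w) (len-reverse≤ (reverse w)))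

  -- The exchange property with empty prefix, applied to a shortest word for `w`, removes a letter
  -- of it; `len-∷-≥` prevents the length from dropping by more than one.
  descent : ∀ w y → ia w (y ⁺) < ia w y → len w ≡ suc (len (r y ∷ w))
  descent w y p with shortest w
  ... | w′ , l , e with exchange w′ [] y (y<y⁺ y) (subst₂ _<_ (sym (at e (y ⁺))) (sym (at e y)) p)
  ...   | w″ , l′ , e′ = ℕP.≤-antisym (len-∷-≥ (r y) w)
    (ℕP.≤-trans (s≤s (len≤ w″ (r y ∷ w) (~-trans
        (~-sym (tt~ (r y) w″))
        (~-∷ (r y) (~-trans (~-sym e′) e)))))
      (ℕP.≤-reflexive (trans (sym l′) l)))

  ascent : ∀ w y → ia w y < ia w (y ⁺) → len (r y ∷ w) ≡ suc (len w)
  ascent w y p = trans (descent (r y ∷ w) y (subst₂ (λ a b → ia w a < ia w b) (sym (s-⁺ refl)) (sym (s-lo refl)) p))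
                       (cong suc (len-cong (r y ∷ r y ∷ w) w (tt~ (r y) w)))

  ia-≢⁺ : ∀ w y → ia w y ≢ ia w (y ⁺)
  ia-≢⁺ w y e = ℤP.<⇒≢ (y<y⁺ y) (ia-inj w e)

  ascent⁻¹ : ∀ w y → len w ℕ.< len (r y ∷ w) → ia w y < ia w (y ⁺)
  ascent⁻¹ w y p with ℤP.<-cmp (ia w y) (ia w (y ⁺))
  ... | tri< q _ _ = q
  ... | tri≈ _ e _ = contradiction e (ia-≢⁺ w y)
  ... | tri> _ _ q = contradiction (ℕP.<-trans (ℕP.≤-reflexive (sym (descent w y q))) p) (ℕP.<-irrefl refl)

  len-snoc : ∀ w t → len (w ++ [ t ]) ≡ len (t ∷ reverse w)
  len-snoc w t = trans (sym (len-reverse (w ++ [ t ]))) (cong len (ListP.reverse-++ w [ t ]))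

  ascentʳ : ∀ w y → act w y < act w (y ⁺) → len (w ++ [ r y ]) ≡ suc (len w)
  ascentʳ w y p = trans (len-snoc w (r y)) (trans (ascent (reverse w) y
    (subst₂ _<_ (sym (ia-reverse w y)) (sym (ia-reverse w (y ⁺))) p)) (cong suc (len-reverse w)))

  ascentʳ⁻¹ : ∀ w y → len w ℕ.< len (w ++ [ r y ]) → act w y < act w (y ⁺)
  ascentʳ⁻¹ w y p = subst₂ _<_ (ia-reverse w y) (ia-reverse w (y ⁺))
    (ascent⁻¹ (reverse w) y (subst₂ ℕ._<_ (sym (len-reverse w)) (len-snoc w (r y)) p))

  -- The exceptional residue c is a parameter because removing the first row of a partition shifts
  -- it by one, so that the induction over rows runs through all maximal parabolic quotients.
  Inc : I → Word → Set
  Inc c w = ∀ y → r y ≢ c → act w y < act w (y ⁺)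

  -- The Grassmannian condition.
  Inc₀ : Word → Set
  Inc₀ = Inc Fin.zero

  Inc-cong : ∀ {c} u v → u ~ v → Inc c u → Inc c v
  Inc-cong u v e g y q = subst₂ _<_ (~⇒act u v e y) (~⇒act u v e (y ⁺)) (g y q)

  Inc⇒Grass : ∀ w → Inc₀ w → Grass w
  Inc⇒Grass w g = AllP.all⁻ (λ i → len w <ᵇ len (w ++ [ Fin.suc i ])) (All.tabulate {xs = allFin (suc k')} (λ {i} _ →
    ℕP.<⇒<ᵇ (ℕP.≤-reflexive (sym (subst (λ t → len (w ++ [ t ]) ≡ suc (len w)) (r-rep (Fin.suc i))
      (ascentʳ w (rep (Fin.suc i)) (g (rep (Fin.suc i)) (λ e → FinP.0≢1+n (trans (sym e) (r-rep (Fin.suc i)))))))))))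

  Grass⇒Inc : ∀ w → Grass w → Inc₀ w
  Grass⇒Inc w g y q with r y in e
  ... | Fin.zero = contradiction refl q
  ... | Fin.suc i = ascentʳ⁻¹ w y (subst (λ t → len w ℕ.< len (w ++ [ t ])) (sym e)
        (ℕP.<ᵇ⇒< _ _ (All.lookup (AllP.all⁺ (λ i → len w <ᵇ len (w ++ [ Fin.suc i ])) (allFin (suc k')) g) (MemP.∈-allFin i))))

  Grass-cong : ∀ u v → u ~ v → Grass u → Grass v
  Grass-cong u v e g = Inc⇒Grass v (Inc-cong u v e (Grass⇒Inc u g))

  -- The Bruhat order on Grassmannian elements

  opaque
    unfolding _⁺ _⁻

    ⁻-÷n : ∀ y a → toℕ (r y) ≡ suc a → y ⁻ ≡ + a + block y * + n
    ⁻-÷n y a e = trans (cong pred (trans (÷n y) (cong (λ j → + j + block y * + n) e)))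
      (sym (ℤP.+-assoc -[1+ 0 ] (+ suc a) (block y * + n)))

    -1-÷n : (+ 0) ⁻ ≡ + suc k' + -[1+ 0 ] * + n
    -1-÷n = sym (trans (cong (λ z → + suc k' + z) (ℤP.-1*i≡-i (+ n))) (trans (ℤP.m-n≡m⊖n (suc k') n) (lemma (suc k'))))
      where
      lemma : ∀ a → a ℤ.⊖ suc a ≡ -[1+ 0 ]
      lemma zero = refl
      lemma (suc a) = trans (ℤP.[1+m]⊖[1+n]≡m⊖n a (suc a)) (lemma a)

  ≤⇒⁻≤⁻ : ∀ {p q} → p ≤ q → p ⁻ ≤ q ⁻
  ≤⇒⁻≤⁻ {p} p≤q = <⇒≤⁻ (ℤP.<-≤-trans (⁻<y p) p≤q)

  block-⁻1 : block ((+ 0) ⁻) ≡ -[1+ 0 ]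
  block-⁻1 = proj₂ (r-block-unique -[1+ 0 ] ((+ 0) ⁻) ℕP.≤-refl -1-÷n)

  block-⁻-≡ : ∀ y → r y ≢ Fin.zero → block (y ⁻) ≡ block y
  block-⁻-≡ y ¬z with r y in e
  ... | Fin.zero = contradiction refl ¬z
  ... | Fin.suc i = proj₂ (r-block-unique (block y) (y ⁻) (ℕP.<-trans (FinP.toℕ<n i) ℕP.≤-refl) (⁻-÷n y (toℕ i) (cong toℕ e)))

  block-⁻-≢ : ∀ y → r y ≡ Fin.zero → block (y ⁻) ≢ block y
  block-⁻-≢ y z e with r-≡⇒⊕ (+ 0) y (trans (FinP.toℕ-injective (r-+ 0 (s≤s z≤n))) (sym z))
  ... | j , refl = ℤP.<⇒≢ (ℤP.+-monoˡ-< j (-<+ {0} {0})) (begin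
      -[1+ 0 ] + j              ≡⟨ cong (_+ j) (sym block-⁻1) ⟩
      block ((+ 0) ⁻) + j       ≡⟨ sym (block-⊕ _ j) ⟩
      block ((+ 0) ⁻ ⊕ j)       ≡⟨ cong block (sym (⊕-⁻ (+ 0) j)) ⟩
      block ((+ 0 ⊕ j) ⁻)       ≡⟨ e ⟩
      block (+ 0 ⊕ j)           ≡⟨ block-⊕ (+ 0) j ⟩
      block (+ 0) + j           ≡⟨ cong (_+ j) (block-+ 0 (s≤s z≤n)) ⟩
      + 0 + j                   ∎)
    where open ≡-Reasoning

  infixl 6 _↑_
  _↑_ : ℤ → ℕ → ℤ
  y ↑ zero  = y
  y ↑ suc d = y ⁺ ↑ d

  ↑-def : ∀ d y → y ↑ d ≡ + d + y
  ↑-def zero    y = sym (ℤP.+-identityˡ y)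
  ↑-def (suc d) y = trans (↑-def d (y ⁺)) (trans (cong (λ z → + d + z) (⁺-def y))
    (trans (sym (ℤP.+-assoc (+ d) (+ 1) y)) (cong (λ j → + j + y) (ℕP.+-comm d 1))))

  ↑n : ∀ y → y ↑ n ≡ y ⊕ + 1
  ↑n y = trans (↑-def n y) (trans (ℤP.+-comm (+ n) y) (trans (cong (λ x → y + x) (sym (ℤP.*-identityˡ (+ n)))) (sym (⊕-def y (+ 1)))))

  ≤⇒↑ : ∀ y z → y ≤ z → ∃ λ d → y ↑ d ≡ z
  ≤⇒↑ y z p with z - y in e | ℤP.i≤j⇒0≤j-i p
  ... | + d | _ = d , trans (↑-def d y) (trans (ℤP.+-comm (+ d) y) (trans (cong (λ x → y + x) (sym e)) (cancel y z)))

  ≤↑ : ∀ y d → y ≤ y ↑ d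
  ≤↑ y zero    = ℤP.≤-refl
  ≤↑ y (suc d) = ℤP.≤-trans (ℤP.<⇒≤ (y<y⁺ y)) (≤↑ (y ⁺) d)

  ↑-above : ∀ y z → ∃ λ d → z ≤ y ↑ d
  ↑-above y z with z ℤP.≤? y
  ... | yes p = 0 , p
  ... | no ¬p with ≤⇒↑ y z (ℤP.<⇒≤ (ℤP.≰⇒> ¬p))
  ...   | d , e = d , ℤP.≤-reflexive (sym e)

  -- κ w y is the window {1 + qn, …, n + qn} in which the value y of w is placed.
  κ : Word → ℤ → ℤ
  κ w y = block (ia w y ⁻)

  κ-⊕ : ∀ w y j → κ w (y ⊕ j) ≡ κ w y + j
  κ-⊕ w y j = trans (cong (λ p → block (p ⁻)) (ia-⊕ w y j)) (trans (cong block (⊕-⁻ _ j)) (block-⊕ _ j))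

  κ-mono : ∀ w y z → ia w y ≤ ia w z → κ w y ≤ κ w z
  κ-mono w y z p = block-mono (≤⇒⁻≤⁻ p)

  κ<⇒< : ∀ w y z → κ w y < κ w z → ia w y < ia w z
  κ<⇒< w y z p with ia w y ℤP.<? ia w z
  ... | yes q = q
  ... | no ¬q = contradiction p (ℤP.≤⇒≯ (κ-mono w z y (ℤP.≮⇒≥ ¬q)))

  -- Both ends of the walk from p to p + d lie in one window, so by monotonicity of `block` no step
  -- starts at residue 0, the last place of a window, where `u` may decrease.
  inc-↑ : ∀ u → Inc₀ u → ∀ d p → block (p ⁻) ≡ block ((p ↑ d) ⁻) → act u p ≤ act u (p ↑ d)
  inc-↑ u g zero    p e = ℤP.≤-refl
  inc-↑ u g (suc d) p e = ℤP.≤-trans (ℤP.<⇒≤ (g p (λ z → block-⁻-≢ p z e₁)))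
      (inc-↑ u g d (p ⁺) (trans (cong block (⁺⁻ p)) (trans (sym e₁) e)))
    where
    e₁ : block (p ⁻) ≡ block p
    e₁ = ℤP.≤-antisym (block-mono (ℤP.<⇒≤ (⁻<y p))) (ℤP.≤-trans (ℤP.≤-reflexive (cong block (sym (⁺⁻ p))))
      (ℤP.≤-trans (block-mono (≤⇒⁻≤⁻ (≤↑ (p ⁺) d))) (ℤP.≤-reflexive (sym e))))

  inc-≤ : ∀ u → Inc₀ u → ∀ {p q} → p ≤ q → block (p ⁻) ≡ block (q ⁻) → act u p ≤ act u q
  inc-≤ u g {p} {q} p≤q e with ≤⇒↑ p q p≤q
  ... | d , refl = inc-↑ u g d p e

  κ-≡-asc : ∀ u → Inc₀ u → ∀ y → κ u y ≡ κ u (y ⁺) → ia u y < ia u (y ⁺)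
  κ-≡-asc u g y e with ia u y ℤP.<? ia u (y ⁺)
  ... | yes p = p
  ... | no ¬p = contradiction (subst₂ _≤_ (act-ia u (y ⁺)) (act-ia u y) (inc-≤ u g (ℤP.≮⇒≥ ¬p) (sym e)))
                  (ℤP.<⇒≱ (y<y⁺ y))

  -- The new letter can destroy the Grassmannian condition only by reversing the values at two
  -- neighbouring positions of one window. These values would be a translate of y, y + 1, which
  -- would put y and y + 1 into the same window.
  κ-≢-Inc : ∀ u → Inc₀ u → ∀ y → κ u y ≢ κ u (y ⁺) → Inc₀ (r y ∷ u)
  κ-≢-Inc u g y ¬e x r≢0 with ℤP.<-cmp (s (r y) (act u x)) (s (r y) (act u (x ⁺)))
  ... | tri< p _ _ = p
  ... | tri≈ _ e _ = contradiction (act-inj u (s-inj (r y) e)) (ℤP.<⇒≢ (y<y⁺ x))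
  ... | tri> _ _ p with s-inversion (r y) (g x r≢0) p
  ...   | e , f with r-≡⇒⊕ y (act u x) (sym e)
  ...     | j , h = contradiction (ℤG.∙-cancelʳ j _ _ (begin
        κ u y + j                   ≡⟨ sym (κ-⊕ u y j) ⟩
        κ u (y ⊕ j)                 ≡⟨ cong (κ u) (sym h) ⟩
        κ u (act u x)               ≡⟨ cong (λ p → block (p ⁻)) (ia-act u x) ⟩
        block (x ⁻)                 ≡⟨ block-⁻-≡ x r≢0 ⟩
        block x                     ≡⟨ cong block (sym (⁺⁻ x)) ⟩
        block ((x ⁺) ⁻)             ≡⟨ cong (λ p → block (p ⁻)) (sym (ia-act u (x ⁺))) ⟩
        κ u (act u (x ⁺))           ≡⟨ cong (κ u) (trans f (trans (cong _⁺ h) (⊕-⁺ y j))) ⟩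
        κ u (y ⁺ ⊕ j)               ≡⟨ κ-⊕ u (y ⁺) j ⟩
        κ u (y ⁺) + j               ∎)) ¬e
    where open ≡-Reasoning

  Inc-descent : ∀ u → Inc₀ u → ∀ y → ia u (y ⁺) < ia u y → κ u (y ⁺) < κ u y
  Inc-descent u g y p with ℤP.<-cmp (κ u (y ⁺)) (κ u y)
  ... | tri< q _ _ = q
  ... | tri≈ _ e _ = contradiction p (ℤP.<-asym (κ-≡-asc u g y (sym e)))
  ... | tri> _ _ q = contradiction p (ℤP.<-asym (κ<⇒< u y (y ⁺) q))

  Inc-descent-Inc : ∀ u → Inc₀ u → ∀ y → ia u (y ⁺) < ia u y → Inc₀ (r y ∷ u)
  Inc-descent-Inc u g y p = κ-≢-Inc u g y (λ e → ℤP.<⇒≢ (Inc-descent u g y p) (sym e))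

  κ-∷ : ∀ w y → κ (r y ∷ w) y ≡ κ w (y ⁺) × κ (r y ∷ w) (y ⁺) ≡ κ w y
  κ-∷ w y = cong (κ w) (s-lo refl) , cong (κ w) (s-⁺ refl)

  -- The pair y, y + 1 is a descent of `r y ∷ w`, and going down from a Grassmannian element is
  -- safe. Thus Grassmannian elements form a lower set of the left weak order.
  Inc-∷⁻¹ : ∀ w y → Inc₀ (r y ∷ w) → ia w y < ia w (y ⁺) → Inc₀ w × κ w y < κ w (y ⁺)
  Inc-∷⁻¹ w y g p = Inc-cong (r y ∷ r y ∷ w) w (tt~ (r y) w) (Inc-descent-Inc (r y ∷ w) g y d)
                  , subst₂ _<_ (proj₂ (κ-∷ w y)) (proj₁ (κ-∷ w y)) (Inc-descent (r y ∷ w) g y d)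
    where
    d : ia (r y ∷ w) (y ⁺) < ia (r y ∷ w) y
    d = subst₂ (λ a b → ia w a < ia w b) (sym (s-⁺ refl)) (sym (s-lo refl)) p

  -- The first letter of a shortest word is a descent: were it an ascent, cancelling it would give a
  -- word that is too short.
  has-descent : ∀ v L → len v ≡ suc L → ∃ λ y → ia v (y ⁺) < ia v y
  has-descent v L e with shortest v
  ... | [] , l , q = contradiction (trans l e) ℕP.0≢1+n
  ... | t ∷ v″ , l , q with ℤP.<-cmp (ia v (rep t)) (ia v (rep t ⁺))
  ...   | tri> _ _ p = rep t , p
  ...   | tri≈ _ f _ = contradiction f (ia-≢⁺ v (rep t))
  ...   | tri< p _ _ = contradiction (begin-strict
      len v                <⟨ ℕP.n<1+n _ ⟩
      suc (len v)          ≡⟨ sym (subst (λ i → len (i ∷ v) ≡ suc (len v)) (r-rep t) (ascent v (rep t) p)) ⟩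
      len (t ∷ v)          ≤⟨ len≤ v″ (t ∷ v) (~-trans (~-sym (tt~ t v″)) (~-∷ t q)) ⟩
      length v″            ≤⟨ ℕP.n≤1+n _ ⟩
      suc (length v″)      ≡⟨ l ⟩
      len v                ∎) (ℕP.<-irrefl refl)
    where open ℕP.≤-Reasoning

  -- The counting function `F`

  bit : Bool → ℕ
  bit true  = 1
  bit false = 0

  nonpos : ℤ → Bool
  nonpos (+ 0)       = true
  nonpos (+ suc _)   = false
  nonpos -[1+ _ ]    = true

  m : Word → ℤ → Bool
  m w y = nonpos (ia w y)

  -- Window 0 begins at position 1, so the positions p ≤ 0 are exactly those in negative windows.
  -- The marks `m` are therefore monotone in `κ`.
  m⇒κ<0 : ∀ w y → m w y ≡ true → κ w y < + 0
  m⇒κ<0 w y e = ℤP.≤-<-trans (block-mono (≤⇒⁻≤⁻ (lemma (ia w y) e))) (subst (_< + 0) (sym block-⁻1) -<+)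
    where
    lemma : ∀ p → nonpos p ≡ true → p ≤ + 0
    lemma (+ 0) _ = ℤP.≤-refl
    lemma -[1+ _ ] _ = -≤+

  κ<0⇒m : ∀ w y → κ w y < + 0 → m w y ≡ true
  κ<0⇒m w y p with ia w y
  ... | + 0 = refl
  ... | -[1+ _ ] = refl
  ... | + suc j = contradiction p (ℤP.≤⇒≯ (subst (_≤ block ((+ suc j) ⁻)) (block-+ 0 (s≤s z≤n))
          (block-mono (subst (+ 0 ≤_) (sym (+suc j)) (+≤+ z≤n)))))

  m-mono : ∀ w y z → κ w y ≤ κ w z → m w z ≡ true → m w y ≡ true
  m-mono w y z p e = κ<0⇒m w y (ℤP.≤-<-trans p (m⇒κ<0 w z e))

  m-mono-ia : ∀ w y z → ia w y ≤ ia w z → m w z ≡ true → m w y ≡ true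
  m-mono-ia w y z p = m-mono w y z (κ-mono w y z p)

  F₀ : ℤ → ℕ
  F₀ (+ _)      = 0
  F₀ -[1+ j ]   = suc j

  -- F w y counts the positions p ≤ 0 of w holding values > y, in a form that is computed letter by letter.
  F : Word → ℤ → ℕ
  F []      y = F₀ y
  F (t ∷ w) y with r y FinP.≟ t
  ... | yes _ = bit (m w y) ℕ.+ F w (y ⁺)
  ... | no _  = F w y

  -- When t exchanges y and y + 1, the values that end up above y are y itself and those that were
  -- above y + 1.
  F-lo : ∀ {t} w {y} → r y ≡ t → F (t ∷ w) y ≡ bit (m w y) ℕ.+ F w (y ⁺)
  F-lo {t} w {y} e with r y FinP.≟ t
  ... | yes _ = refl
  ... | no ¬e = contradiction e ¬e

  F-off : ∀ {t} w {y} → r y ≢ t → F (t ∷ w) y ≡ F w y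
  F-off {t} w {y} ¬e with r y FinP.≟ t
  ... | yes e = contradiction e ¬e
  ... | no _ = refl

  opaque
    unfolding _⁻
    F₀-⁻ : ∀ y → F₀ (y ⁻) ≡ bit (nonpos y) ℕ.+ F₀ y
    F₀-⁻ (+ 0)     = refl
    F₀-⁻ (+ suc j) = refl
    F₀-⁻ -[1+ j ]  = refl

  F-⁻ : ∀ w y → F w (y ⁻) ≡ bit (m w y) ℕ.+ F w y
  F-⁻ []      y = F₀-⁻ y
  F-⁻ (t ∷ w) y with pos t y
  ... | lo e = begin
    F (t ∷ w) (y ⁻)                                ≡⟨ F-off w (λ e' → r-pred≢ y (trans e' (sym e))) ⟩
    F w (y ⁻)                                      ≡⟨ F-⁻ w y ⟩
    bit (m w y) ℕ.+ F w y                          ≡⟨ cong (λ z → bit (m w y) ℕ.+ F w z) (sym (⁺⁻ y)) ⟩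
    bit (m w y) ℕ.+ F w ((y ⁺) ⁻)                  ≡⟨ cong (bit (m w y) ℕ.+_) (F-⁻ w (y ⁺)) ⟩
    bit (m w y) ℕ.+ (bit (m w (y ⁺)) ℕ.+ F w (y ⁺)) ≡⟨ ℕG.x∙yz≈y∙xz (bit (m w y)) (bit (m w (y ⁺))) (F w (y ⁺)) ⟩
    bit (m w (y ⁺)) ℕ.+ (bit (m w y) ℕ.+ F w (y ⁺)) ≡⟨ cong₂ (λ z a → bit (m w z) ℕ.+ a) (sym (s-lo e)) (sym (F-lo w e)) ⟩
    bit (m w (s t y)) ℕ.+ F (t ∷ w) y              ∎
    where open ≡-Reasoning
  ... | hi e = begin
    F (t ∷ w) (y ⁻)                          ≡⟨ F-lo w e ⟩
    bit (m w (y ⁻)) ℕ.+ F w ((y ⁻) ⁺)        ≡⟨ cong (λ z → bit (m w (y ⁻)) ℕ.+ F w z) (⁻⁺ y) ⟩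
    bit (m w (y ⁻)) ℕ.+ F w y                ≡⟨ cong₂ (λ z a → bit (m w z) ℕ.+ a) (sym (s-hi e)) (sym (F-off w (λ e' → r-pred≢ y (trans e (sym e'))))) ⟩
    bit (m w (s t y)) ℕ.+ F (t ∷ w) y        ∎ where open ≡-Reasoning
  ... | off a b = trans (F-off w b) (trans (F-⁻ w y) (cong₂ (λ z c → bit (m w z) ℕ.+ c) (sym (s-off a b)) (sym (F-off w a))))

  F-⁺ : ∀ w y → F w y ≡ bit (m w (y ⁺)) ℕ.+ F w (y ⁺)
  F-⁺ w y = trans (cong (F w) (sym (⁺⁻ y))) (F-⁻ w (y ⁺))

  bit≤1 : ∀ b → bit b ℕ.≤ 1
  bit≤1 true  = ℕP.≤-refl
  bit≤1 false = z≤n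

  F-anti : ∀ w y → F w y ℕ.≤ F w (y ⁻)
  F-anti w y = ℕP.≤-trans (ℕP.m≤n+m (F w y) (bit (m w y))) (ℕP.≤-reflexive (sym (F-⁻ w y)))

  F-slope : ∀ w y → F w y ℕ.≤ suc (F w (y ⁺))
  F-slope w y = ℕP.≤-trans (ℕP.≤-reflexive (F-⁺ w y)) (ℕP.+-monoˡ-≤ (F w (y ⁺)) (bit≤1 _))

  F-bound : ∀ w → ∃ λ B → ∀ y → B ≤ y → F w y ≡ 0
  F-bound [] = + 0 , λ { (+ _) _ → refl }
  F-bound (t ∷ w) with F-bound w
  ... | B , b = B ⁺ , λ y p → lemma y (ℤP.<-≤-trans (y<y⁺ B) p)
    where
    lemma : ∀ y → B < y → F (t ∷ w) y ≡ 0
    lemma y p with r y FinP.≟ t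
    ... | no _  = b y (ℤP.<⇒≤ p)
    ... | yes _ = cong₂ ℕ._+_
      (ℕP.n≤0⇒n≡0 (ℕP.≤-trans (ℕP.m≤m+n (bit (m w y)) (F w y)) (ℕP.≤-reflexive (trans (sym (F-⁻ w y)) (b (y ⁻) (<⇒≤⁻ p))))))
      (b (y ⁺) (ℤP.<⇒≤ (ℤP.<-trans p (y<y⁺ y))))

  -- Although `F` is computed from the word, it vanishes far above and its differences are the marks
  -- `m`, which depend on the permutation only.
  F-cong : ∀ u v → u ~ v → ∀ y → F u y ≡ F v y
  F-cong u v e y with F-bound u | F-bound v
  ... | B , b | C , c with ↑-above y (B ℤ.⊔ C)
  ...   | d , p = down d y (trans (b _ (ℤP.≤-trans (ℤP.i≤i⊔j B C) p)) (sym (c _ (ℤP.≤-trans (ℤP.i≤j⊔i B C) p))))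
    where
    down : ∀ d y → F u (y ↑ d) ≡ F v (y ↑ d) → F u y ≡ F v y
    down zero    y q = q
    down (suc d) y q = trans (F-⁺ u y) (trans (cong₂ (λ p a → bit (nonpos p) ℕ.+ a) (at e (y ⁺)) (down d (y ⁺) q)) (sym (F-⁺ v y)))

  -- The pointwise order and the Demazure adjunction

  infix 4 _⊑_
  _⊑_ : Word → Word → Set
  u ⊑ v = ∀ x → F u x ℕ.≤ F v x

  Off : I → Word → Word → Set
  Off t u v = ∀ x → r x ≢ t → F u x ℕ.≤ F v x

  -- The lower Demazure action, min (t v, v).
  dn : I → Word → Word
  dn t w = if len w <ᵇ len (t ∷ w) then w else t ∷ w

  ascends? : ∀ t w y → r y ≡ t → (ia w y < ia w (y ⁺) × (len w <ᵇ len (t ∷ w)) ≡ true) ⊎ (ia w (y ⁺) < ia w y × (len w <ᵇ len (t ∷ w)) ≡ false)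
  ascends? t w y refl with ℤP.<-cmp (ia w y) (ia w (y ⁺))
  ... | tri< p _ _ = inj₁ (p , T⇒≡ (ℕP.<⇒<ᵇ (ℕP.≤-reflexive (sym (ascent w y p)))))
  ... | tri≈ _ e _ = contradiction e (ia-≢⁺ w y)
  ... | tri> _ _ p = inj₂ (p , lemma (len w <ᵇ len (t ∷ w)) refl)
    where
    lemma : ∀ b → (len w <ᵇ len (t ∷ w)) ≡ b → b ≡ false
    lemma false _ = refl
    lemma true  e = contradiction (ascent⁻¹ w y (ℕP.<ᵇ⇒< _ _ (subst T (sym e) tt))) (ℤP.<-asym p)

  phi-asc : ∀ w y → ia w y < ia w (y ⁺) → phi (r y) w ≡ r y ∷ w × dn (r y) w ≡ w
  phi-asc w y p with ascends? (r y) w y refl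
  ... | inj₁ (_ , e) rewrite e = refl , refl
  ... | inj₂ (q , _) = contradiction q (ℤP.<-asym p)

  phi-desc : ∀ w y → ia w (y ⁺) < ia w y → phi (r y) w ≡ w × dn (r y) w ≡ r y ∷ w
  phi-desc w y p with ascends? (r y) w y refl
  ... | inj₂ (_ , e) rewrite e = refl , refl
  ... | inj₁ (q , _) = contradiction q (ℤP.<-asym p)

  phi-off : ∀ t w {x} → r x ≢ t → F (phi t w) x ≡ F w x
  phi-off t w ¬e with len w <ᵇ len (t ∷ w)
  ... | true  = F-off w ¬e
  ... | false = refl

  dn-off : ∀ t w {x} → r x ≢ t → F (dn t w) x ≡ F w x
  dn-off t w ¬e with len w <ᵇ len (t ∷ w)
  ... | true  = refl
  ... | false = F-off w ¬e

  -- The letter r x permutes the marks of x and x + 1. The larger of the two elements carries the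
  -- larger mark at x + 1, the smaller element the smaller one, whence the disjunction and the
  -- conjunction.
  F-phi-dn : ∀ w x → F (phi (r x) w) x ≡ bit (m w x ∨ m w (x ⁺)) ℕ.+ F w (x ⁺)
                   × F (dn (r x) w) x ≡ bit (m w x ∧ m w (x ⁺)) ℕ.+ F w (x ⁺)
  F-phi-dn w x with ascends? (r x) w x refl
  ... | inj₁ (p , e) rewrite e = trans (F-lo w refl) (cong (λ b → bit b ℕ.+ F w (x ⁺)) (sym (proj₁ bs)))
                               , trans (F-⁺ w x) (cong (λ b → bit b ℕ.+ F w (x ⁺)) (sym (proj₂ bs)))
    where
    bs : (m w x ∨ m w (x ⁺)) ≡ m w x × (m w x ∧ m w (x ⁺)) ≡ m w (x ⁺)
    bs with m w x in e₁ | m w (x ⁺) in e₂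
    ... | true  | _ = refl , refl
    ... | false | false = refl , refl
    ... | false | true = contradiction (trans (sym e₁) (m-mono-ia w x (x ⁺) (ℤP.<⇒≤ p) e₂)) λ ()
  ... | inj₂ (p , e) rewrite e = trans (F-⁺ w x) (cong (λ b → bit b ℕ.+ F w (x ⁺)) (sym (proj₁ bs)))
                               , trans (F-lo w refl) (cong (λ b → bit b ℕ.+ F w (x ⁺)) (sym (proj₂ bs)))
    where
    bs : (m w x ∨ m w (x ⁺)) ≡ m w (x ⁺) × (m w x ∧ m w (x ⁺)) ≡ m w x
    bs with m w x in e₁ | m w (x ⁺) in e₂
    ... | true  | true = refl , refl
    ... | false | _ = refl , refl
    ... | true  | false = contradiction (trans (sym e₂) (m-mono-ia w (x ⁺) x (ℤP.<⇒≤ p) e₁)) λ ()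

  F-window : ∀ w x → F w (x ⁻) ≡ bit (m w x) ℕ.+ (bit (m w (x ⁺)) ℕ.+ F w (x ⁺))
  F-window w x = trans (F-⁻ w x) (cong (bit (m w x) ℕ.+_) (F-⁺ w x))

  phi-min : ∀ w x z → z ℕ.≤ F w (x ⁻) → z ℕ.≤ suc (F w (x ⁺)) → z ℕ.≤ F (phi (r x) w) x
  phi-min w x z p q = subst (z ℕ.≤_) (sym (proj₁ (F-phi-dn w x))) (lemma (m w x) (m w (x ⁺)) (subst (z ℕ.≤_) (F-window w x) p))
    where
    lemma : ∀ a b → z ℕ.≤ bit a ℕ.+ (bit b ℕ.+ F w (x ⁺)) → z ℕ.≤ bit (a ∨ b) ℕ.+ F w (x ⁺)
    lemma false b p = p
    lemma true  b p = q

  phi-min⁻¹ : ∀ w x z → z ℕ.≤ F (phi (r x) w) x → z ℕ.≤ F w (x ⁻) × z ℕ.≤ suc (F w (x ⁺))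
  phi-min⁻¹ w x z p = subst (z ℕ.≤_) (sym (F-window w x)) (lemma (m w x) (m w (x ⁺)) p′) , ℕP.≤-trans p′ (ℕP.+-monoˡ-≤ (F w (x ⁺)) (bit≤1 (m w x ∨ m w (x ⁺))))
    where
    p′ : z ℕ.≤ bit (m w x ∨ m w (x ⁺)) ℕ.+ F w (x ⁺)
    p′ = subst (z ℕ.≤_) (proj₁ (F-phi-dn w x)) p
    lemma : ∀ a b → z ℕ.≤ bit (a ∨ b) ℕ.+ F w (x ⁺) → z ℕ.≤ bit a ℕ.+ (bit b ℕ.+ F w (x ⁺))
    lemma false b p = p
    lemma true  b p = ℕP.≤-trans p (s≤s (ℕP.m≤n+m _ (bit b)))

  -- F (phi t v) and F (dn t v) are the largest and the smallest function of slopes 0, -1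
  -- agreeing with F v off the residue t; both sides of the adjunction thus mean Off t.
  Off⇒⊑phi : ∀ t u v → Off t u v → u ⊑ phi t v
  Off⇒⊑phi t u v h x with r x FinP.≟ t
  ... | no ¬e = subst (F u x ℕ.≤_) (sym (phi-off t v ¬e)) (h x ¬e)
  ... | yes refl = phi-min v x (F u x) (ℕP.≤-trans (F-anti u x) (h (x ⁻) (r-pred≢ x)))
                    (ℕP.≤-trans (F-slope u x) (s≤s (h (x ⁺) (r-suc≢ x))))

  ⊑phi⇒Off : ∀ t u v → u ⊑ phi t v → Off t u v
  ⊑phi⇒Off t u v h x ¬e = subst (F u x ℕ.≤_) (phi-off t v ¬e) (h x)

  dn⊑⇒Off : ∀ t u v → dn t u ⊑ v → Off t u v
  dn⊑⇒Off t u v h x ¬e = subst (ℕ._≤ F v x) (dn-off t u ¬e) (h x)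

  Off⇒dn⊑ : ∀ t u v → Off t u v → dn t u ⊑ v
  Off⇒dn⊑ t u v h x with r x FinP.≟ t
  ... | no ¬e = subst (ℕ._≤ F v x) (sym (dn-off t u ¬e)) (h x ¬e)
  ... | yes refl = subst (ℕ._≤ F v x) (sym (proj₂ (F-phi-dn u x)))
        (lemma (m u x) (m u (x ⁺)) (subst (ℕ._≤ suc (F v x)) (F-window u x) (ℕP.≤-trans (h (x ⁻) (r-pred≢ x))
           (subst (λ z → F v (x ⁻) ℕ.≤ suc (F v z)) (⁻⁺ x) (F-slope v (x ⁻))))))
    where
    base : F u (x ⁺) ℕ.≤ F v x
    base = ℕP.≤-trans (h (x ⁺) (r-suc≢ x)) (subst (λ z → F v (x ⁺) ℕ.≤ F v z) (⁺⁻ x) (F-anti v (x ⁺)))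
    lemma : ∀ a b → bit a ℕ.+ (bit b ℕ.+ F u (x ⁺)) ℕ.≤ suc (F v x) → bit (a ∧ b) ℕ.+ F u (x ⁺) ℕ.≤ F v x
    lemma false b p = base
    lemma true false p = base
    lemma true true (s≤s p) = p

  ⊑-refl : ∀ u → u ⊑ u
  ⊑-refl u x = ℕP.≤-refl

  ⊑-trans : ∀ {u v w} → u ⊑ v → v ⊑ w → u ⊑ w
  ⊑-trans p q x = ℕP.≤-trans (p x) (q x)

  ~⇒⊑ : ∀ u v → u ~ v → u ⊑ v
  ~⇒⊑ u v e x = ℕP.≤-reflexive (F-cong u v e x)

  -- Subwords of reduced words

  Reduced : Word → Set
  Reduced w = len w ≡ length w

  Reduced-∷⁻¹ : ∀ t w → Reduced (t ∷ w) → Reduced w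
  Reduced-∷⁻¹ t w e = ℕP.≤-antisym (len≤length w) (ℕ.s≤s⁻¹ (ℕP.≤-trans (ℕP.≤-reflexive (sym e)) (len-∷ t w)))

  phi-reduced : ∀ t w → Reduced (t ∷ w) → phi t w ≡ t ∷ w
  phi-reduced t w e with len w <ᵇ len (t ∷ w) in q
  ... | true = refl
  ... | false = contradiction (ℕP.<⇒<ᵇ (ℕP.≤-reflexive (trans (cong suc (Reduced-∷⁻¹ t w e)) (sym e)))) (λ p → subst T q p)

  -- Each letter of a reduced word acts as `phi`, and below `phi t v` only the values off residue t
  -- have to be compared. There `F` does not notice whether the smaller word contains the letter t.
  subword⇒⊑ : ∀ {u v} → u ⊆ v → Reduced v → u ⊑ v
  subword⇒⊑ []          e = ⊑-refl []
  subword⇒⊑ {u} {t ∷ v} (.t ∷ʳ p)   e = subst (u ⊑_) (phi-reduced t v e)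
    (Off⇒⊑phi t u v (λ x _ → subword⇒⊑ p (Reduced-∷⁻¹ t v e) x))
  subword⇒⊑ {t ∷ u} {.t ∷ v} (refl ∷ p) e = subst ((t ∷ u) ⊑_) (phi-reduced t v e)
    (Off⇒⊑phi t (t ∷ u) v (λ x ¬e → subst (ℕ._≤ F v x) (sym (F-off u ¬e)) (subword⇒⊑ p (Reduced-∷⁻¹ t v e) x)))

  ∈-sublists⇒⊆ : ∀ {A : Set} {xs ys : List A} → xs ∈ sublists ys → xs ⊆ ys
  ∈-sublists⇒⊆ {ys = []} (here refl) = []
  ∈-sublists⇒⊆ {ys = y ∷ ys} p with MemP.∈-++⁻ (map (y ∷_) (sublists ys)) p
  ... | inj₂ q = y ∷ʳ ∈-sublists⇒⊆ q
  ... | inj₁ q with MemP.∈-map⁻ (y ∷_) q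
  ...   | _ , q′ , refl = refl ∷ ∈-sublists⇒⊆ q′

  ⊆⇒∈-sublists : ∀ {A : Set} {xs ys : List A} → xs ⊆ ys → xs ∈ sublists ys
  ⊆⇒∈-sublists [] = here refl
  ⊆⇒∈-sublists {ys = y ∷ ys} (.y ∷ʳ p) = MemP.∈-++⁺ʳ (map (y ∷_) (sublists ys)) (⊆⇒∈-sublists p)
  ⊆⇒∈-sublists {ys = y ∷ ys} (refl ∷ p) = MemP.∈-++⁺ˡ (MemP.∈-map⁺ (y ∷_) (⊆⇒∈-sublists p))

  ∈-filterᵇ⁻ : ∀ {a} {A : Set a} (p : A → Bool) {x} {xs : List A} → x ∈ filterᵇ p xs → x ∈ xs × T (p x)
  ∈-filterᵇ⁻ p = MemP.∈-filter⁻ (BoolP.T? ∘ p)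

  ∈-filterᵇ⁺ : ∀ {a} {A : Set a} (p : A → Bool) {x} {xs : List A} → x ∈ xs → T (p x) → x ∈ filterᵇ p xs
  ∈-filterᵇ⁺ p = MemP.∈-filter⁺ (BoolP.T? ∘ p)

  ≤B⇒⊑ : ∀ u v → u ≤B v → u ⊑ v
  ≤B⇒⊑ u v p with find (AnyP.any⁻ _ (reducedWords v) p)
  ... | w , w∈ , q with find (AnyP.any⁻ _ (sublists w) q)
  ...   | x , x∈ , c with Equivalence.to BoolP.T-∧ c | ∈-filterᵇ⁻ (_≈ᵇ v) w∈
  ...     | _ , d | w∈′ , e = ⊑-trans {u} {x} {v} (~⇒⊑ u x (~-sym (≈ᵇ⇒~ x u d)))
     (⊑-trans {x} {w} {v} (subword⇒⊑ {x} {w} (∈-sublists⇒⊆ x∈) (trans (len-cong w v w~v) (sym (words-length (len v) w w∈′)))) (~⇒⊑ w v w~v))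
    where
    w~v : w ~ v
    w~v = ≈ᵇ⇒~ w v e

  Subword : Word → Word → Set
  Subword u v = ∃₂ λ w x → length w ≡ len v × w ~ v × x ⊆ w × length x ≡ len u × x ~ u

  subword⇒≤B : ∀ u v → Subword u v → u ≤B v
  subword⇒≤B u v (w , x , l , e , p , l′ , e′) = AnyP.any⁺ _ (lose
    (∈-filterᵇ⁺ (_≈ᵇ v) (subst (λ j → w ∈ words j) l (∈-words w)) (~⇒≈ᵇ w v e))
    (AnyP.any⁺ _ (lose (⊆⇒∈-sublists p) (Equivalence.from BoolP.T-∧ (ℕP.≡⇒≡ᵇ _ _ l′ , ~⇒≈ᵇ x u e′)))))

  dn-Inc : ∀ u → Inc₀ u → ∀ y → Inc₀ (dn (r y) u)
  dn-Inc u g y with ascends? (r y) u y refl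
  ... | inj₁ (p , e) rewrite e = g
  ... | inj₂ (p , e) rewrite e = Inc-descent-Inc u g y p

  len≡0⇒~[] : ∀ v → len v ≡ 0 → v ~ []
  len≡0⇒~[] v l with shortest v
  ... | [] , _ , e = ~-sym e
  ... | _ ∷ _ , l′ , _ = contradiction (trans l′ l) (λ ())

  -- The hypothesis forces `F u` = `F₀`, so exactly the nonpositive values sit at nonpositive
  -- positions. A descent of u, translated suitably, would put z + 1 at a nonpositive position and z
  -- at a positive one.
  ⊑[]⇒len≡0 : ∀ u → Inc₀ u → u ⊑ [] → len u ≡ 0
  ⊑[]⇒len≡0 u g h with len u in l
  ... | zero = refl
  ... | suc L with has-descent u L l
  ...   | y , p = contradiction (trans (sym false′) (trans (m≡ z) (z⇒ (trans (sym (m≡ (z ⁺))) true′)))) (λ ())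
    where
    u≡ : ∀ x → F u x ≡ F₀ x
    u≡ x with shortest u
    ... | u′ , l′ , e = ℕP.≤-antisym (h x) (ℕP.≤-trans (subword⇒⊑ {[]} {u′} (Sub.minimum u′) (trans (len-cong u′ u e) (sym l′)) x)
                         (ℕP.≤-reflexive (F-cong u′ u e x)))
    bit-inj : ∀ a b → bit a ≡ bit b → a ≡ b
    bit-inj true true _ = refl
    bit-inj false false _ = refl
    m≡ : ∀ x → m u x ≡ nonpos x
    m≡ x = bit-inj _ _ (ℕP.+-cancelʳ-≡ (F₀ x) _ _ (begin
      bit (m u x) ℕ.+ F₀ x        ≡⟨ cong (bit (m u x) ℕ.+_) (sym (u≡ x)) ⟩
      bit (m u x) ℕ.+ F u x       ≡⟨ sym (F-⁻ u x) ⟩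
      F u (x ⁻)                   ≡⟨ u≡ (x ⁻) ⟩
      F₀ (x ⁻)                    ≡⟨ F₀-⁻ x ⟩
      bit (nonpos x) ℕ.+ F₀ x     ∎)) where open ≡-Reasoning
    κ> : κ u (y ⁺) < κ u y
    κ> = Inc-descent u g y p
    -- The translation by j brings the window of y + 1 to -1, the last one before the threshold; the
    -- window of y, which is larger, becomes nonnegative.
    j : ℤ
    j = -[1+ 0 ] - κ u (y ⁺)
    z : ℤ
    z = y ⊕ j
    κz⁺ : κ u (z ⁺) ≡ -[1+ 0 ]
    κz⁺ = trans (cong (κ u) (⊕-⁺ y j)) (trans (κ-⊕ u (y ⁺) j) (cancel (κ u (y ⁺)) -[1+ 0 ]))
    true′ : m u (z ⁺) ≡ true
    true′ = κ<0⇒m u (z ⁺) (subst (_< + 0) (sym κz⁺) -<+)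
    false′ : m u z ≡ false
    false′ with m u z in e
    ... | false = refl
    ... | true = contradiction (begin-strict
        -[1+ 0 ]           ≡⟨ sym (cancel (κ u (y ⁺)) -[1+ 0 ]) ⟩
        κ u (y ⁺) + j      <⟨ ℤP.+-monoˡ-< j κ> ⟩
        κ u y + j          ≡⟨ sym (κ-⊕ u y j) ⟩
        κ u z              ≤⟨ <⇒≤⁻′ (m⇒κ<0 u z e) ⟩
        -[1+ 0 ]           ∎) (ℤP.<-irrefl refl)
      where
      open ℤP.≤-Reasoning
      <⇒≤⁻′ : ∀ {a} → a < + 0 → a ≤ -[1+ 0 ]
      <⇒≤⁻′ -<+ = ℤ.-≤- z≤n
    z⇒ : ∀ {x} → nonpos (x ⁺) ≡ true → nonpos x ≡ true
    z⇒ {x} = m-mono-ia [] x (x ⁺) (ℤP.<⇒≤ (y<y⁺ x))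

  dn-cases : ∀ y u → dn (r y) u ≡ u ⊎ (dn (r y) u ≡ r y ∷ u × ia u (y ⁺) < ia u y)
  dn-cases y u with ℤP.<-cmp (ia u y) (ia u (y ⁺))
  ... | tri< p _ _ = inj₁ (proj₂ (phi-asc u y p))
  ... | tri≈ _ e _ = contradiction e (ia-≢⁺ u y)
  ... | tri> _ _ p = inj₂ (proj₂ (phi-desc u y p) , p)

  -- The lifting property: the letter r y is put in front of the word for v, and also in front of
  -- the subword if lowering has removed it from u.
  lift-subword : ∀ y u v → ia v (y ⁺) < ia v y → dn (r y) u ≡ u ⊎ (dn (r y) u ≡ r y ∷ u × ia u (y ⁺) < ia u y) →
                 Subword (dn (r y) u) (r y ∷ v) → Subword u v
  lift-subword y u v p c (w , x , l₁ , e , q , l₂ , e′) = pick c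
    where
    t : I
    t = r y
    l : length (t ∷ w) ≡ len v
    l = trans (cong suc l₁) (sym (descent v y p))
    w~ : (t ∷ w) ~ v
    w~ = ~-trans (~-∷ t e) (tt~ t v)
    pick : dn (r y) u ≡ u ⊎ (dn (r y) u ≡ r y ∷ u × ia u (y ⁺) < ia u y) → Subword u v
    pick (inj₁ b) = t ∷ w , x , l , w~ , (t ∷ʳ q) , trans l₂ (cong len b) , subst (x ~_) b e′
    pick (inj₂ (b , a)) = t ∷ w , t ∷ x , l , w~ , (refl ∷ q) ,
      trans (cong suc (trans l₂ (cong len b))) (sym (descent u y a)) ,
      ~-trans (~-∷ t (subst (x ~_) b e′)) (tt~ t u)

  -- Induction along a descent t of v. With v′ = t v one has v = `phi t v′`, so the adjunction turns
  -- u ⊑ v into `dn t u` ⊑ v′, and `dn t u` is again Grassmannian.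
  ⊑⇒subword : ∀ L v u → len v ≡ L → Inc₀ u → Inc₀ v → u ⊑ v → Subword u v
  ⊑⇒subword zero v u l gu gv h = [] , [] , sym l , ~-sym v~ , [] , sym lu , ~-sym (len≡0⇒~[] u lu)
    where
    v~ : v ~ []
    v~ = len≡0⇒~[] v l
    lu : len u ≡ 0
    lu = ⊑[]⇒len≡0 u gu (⊑-trans {u} {v} {[]} h (~⇒⊑ v [] v~))
  ⊑⇒subword (suc L) v u l gu gv h = from-descent (has-descent v L l)
    where
    from-descent : (∃ λ y → ia v (y ⁺) < ia v y) → Subword u v
    from-descent (y , p) = lift-subword y u v p (dn-cases y u)
        (⊑⇒subword L v′ (dn t u) (ℕP.suc-injective (trans (sym (descent v y p)) l))
          (dn-Inc u gu y) (Inc-descent-Inc v gv y p) (Off⇒dn⊑ t u v′ off′))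
      where
      t : I
      t = r y
      v′ : Word
      v′ = t ∷ v
      asc : ia v′ y < ia v′ (y ⁺)
      asc = subst₂ (λ a b → ia v a < ia v b) (sym (s-lo refl)) (sym (s-⁺ refl)) p
      v~ : v ~ phi t v′
      v~ = subst (v ~_) (sym (proj₁ (phi-asc v′ y asc))) (~-sym (tt~ t v))
      off′ : Off t u v′
      off′ = ⊑phi⇒Off t u v′ (⊑-trans {u} {v} {phi t v′} h (~⇒⊑ v (phi t v′) v~))

  ⊑⇒≤B : ∀ u v → Grass u → Grass v → u ⊑ v → u ≤B v
  ⊑⇒≤B u v gu gv h = subword⇒≤B u v (⊑⇒subword (len v) v u refl (Grass⇒Inc u gu) (Grass⇒Inc v gv) h)

  -- Cyclically decreasing words

  next : I → I
  next t = r (rep t ⁺)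

  r-⁺ : ∀ x → r (x ⁺) ≡ next (r x)
  r-⁺ x = r-suc (sym (r-rep (r x)))

  next≢ : ∀ t → next t ≢ t
  next≢ t e = r-suc≢ (rep t) (trans e (sym (r-rep t)))

  data CycDec : Word → Set where
    []  : CycDec []
    cons : ∀ {t b} → t ∉ b → next t ∉ b → CycDec b → CycDec (t ∷ b)

  -- Some marked value at or below x + 1 can be carried up to x + 1 by letters of P, the lowest
  -- letter acting first, as it does in a cyclically decreasing word.
  data Reach (w : Word) (P : I → Set) (x : ℤ) : Set where
    stop : m w (x ⁺) ≡ true → Reach w P x
    step : P (r x) → Reach w P (x ⁻) → Reach w P x

  Reach-mono : ∀ {w} {P P′ : I → Set} → (∀ t → P t → P′ t) → ∀ {x} → Reach w P x → Reach w P′ x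
  Reach-mono h (stop e)   = stop e
  Reach-mono h (step p q) = step (h _ p) (Reach-mono h q)

  -- Both paths descend from the same x in unit steps and can differ only in length, so the shorter
  -- one uses letters of both sets. The closure of `Q` under intersections rests on this.
  Reach-∩ : ∀ {w} {P P′ : I → Set} {x} → Reach w P x → Reach w P′ x → Reach w (λ t → P t × P′ t) x
  Reach-∩ (stop e)   _            = stop e
  Reach-∩ (step _ _) (stop e)     = stop e
  Reach-∩ (step p q) (step p′ q′) = step (p , p′) (Reach-∩ q q′)

  -- z ≤ F (b * w) x for a cyclically decreasing word b with set of letters P.
  Level : Word → (I → Set) → ℤ → ℕ → Set
  Level w P x z = z ℕ.≤ F w (x ⁺) ⊎ (z ℕ.≤ suc (F w (x ⁺)) × Reach w P x)

  demazure-off : ∀ b w {y} → r y ∉ b → F (demazure b w) y ≡ F w y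
  demazure-off []      w h = refl
  demazure-off (t ∷ b) w h = trans (phi-off t (demazure b w) (λ e → h (here e))) (demazure-off b w (h ∘ there))

  tail-∈ : ∀ {t u : I} {b} → u ∈ t ∷ b → u ≢ t → u ∈ b
  tail-∈ (here e) ¬e = contradiction e ¬e
  tail-∈ (there p) _ = p

  r-pred-next : ∀ {t} x → r (x ⁻) ≡ t → r x ≡ next t
  r-pred-next x refl = trans (cong r (sym (⁻⁺ x))) (r-⁺ (x ⁻))

  -- A descending path arrives at residue t only by way of `next t`, which does not occur in b; so
  -- the head letter t serves no path starting elsewhere.
  Reach-tail : ∀ {w t b x} → next t ∉ b → r x ≢ t → Reach w (_∈ t ∷ b) x → Reach w (_∈ b) x
  Reach-tail nt ¬e (stop e) = stop e
  Reach-tail {b = b} {x = x} nt ¬e (step p q) =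
    step x∈ (Reach-tail nt (λ e → nt (subst (_∈ b) (r-pred-next x e) x∈)) q)
    where x∈ = tail-∈ p ¬e

  -- At residue t the head letter replaces the value by the smaller of the value at x - 1 and one
  -- more than the value at x + 1. The latter is still that of w, since `next t` does not occur in
  -- b, and the former is the level condition one step lower.
  Level⇒ : ∀ {b} w → CycDec b → ∀ x z → Level w (_∈ b) x z → z ℕ.≤ F (demazure b w) x
  Level⇐ : ∀ {b} w → CycDec b → ∀ x z → z ℕ.≤ F (demazure b w) x → Level w (_∈ b) x z

  F-anti⁺ : ∀ w x → F w (x ⁺) ℕ.≤ F w x
  F-anti⁺ w x = ℕP.≤-trans (F-anti w (x ⁺)) (ℕP.≤-reflexive (cong (F w) (⁺⁻ x)))

  Level⇒ w [] x z (inj₁ p) = ℕP.≤-trans p (F-anti⁺ w x)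
  Level⇒ w [] x z (inj₂ (p , stop e)) = subst (z ℕ.≤_) (sym (trans (F-⁺ w x) (cong (λ b → bit b ℕ.+ F w (x ⁺)) e))) p
  Level⇒ {t ∷ b} w (cons t∉ nt∉ c) x z h with r x FinP.≟ t
  ... | no ¬e = subst (z ℕ.≤_) (sym (phi-off t (demazure b w) ¬e)) (Level⇒ w c x z (tail-level h))
    where
    tail-level : Level w (_∈ t ∷ b) x z → Level w (_∈ b) x z
    tail-level (inj₁ p) = inj₁ p
    tail-level (inj₂ (p , q)) = inj₂ (p , Reach-tail nt∉ ¬e q)
  ... | yes refl = phi-min (demazure b w) x z (Level⇒ w c (x ⁻) z (subst (λ y → z ℕ.≤ F w y ⊎ (z ℕ.≤ suc (F w y) × Reach w (_∈ b) (x ⁻))) (sym (⁻⁺ x)) (low h)))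
        (subst (λ a → z ℕ.≤ suc a) (sym (demazure-off b w (λ p → nt∉ (subst (_∈ b) (r-⁺ x) p)))) (high h))
    where
    high : Level w (_∈ t ∷ b) x z → z ℕ.≤ suc (F w (x ⁺))
    high (inj₁ p) = ℕP.m≤n⇒m≤1+n p
    high (inj₂ (p , _)) = p
    low : Level w (_∈ t ∷ b) x z → z ℕ.≤ F w x ⊎ (z ℕ.≤ suc (F w x) × Reach w (_∈ b) (x ⁻))
    low (inj₁ p) = inj₁ (ℕP.≤-trans p (F-anti⁺ w x))
    low (inj₂ (p , stop e)) = inj₁ (subst (z ℕ.≤_) (sym (trans (F-⁺ w x) (cong (λ b → bit b ℕ.+ F w (x ⁺)) e))) p)
    low (inj₂ (p , step _ q)) = inj₂ (ℕP.≤-trans p (s≤s (F-anti⁺ w x)) , Reach-tail nt∉ (r-pred≢ x) q)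

  Level⇐ w [] x z p with m w (x ⁺) in e
  ... | true  = inj₂ (subst (z ℕ.≤_) (trans (F-⁺ w x) (cong (λ b → bit b ℕ.+ F w (x ⁺)) e)) p , stop e)
  ... | false = inj₁ (subst (z ℕ.≤_) (trans (F-⁺ w x) (cong (λ b → bit b ℕ.+ F w (x ⁺)) e)) p)
  Level⇐ {t ∷ b} w (cons t∉ nt∉ c) x z p with r x FinP.≟ t
  ... | no ¬e with Level⇐ w c x z (subst (z ℕ.≤_) (phi-off t (demazure b w) ¬e) p)
  ...   | inj₁ q = inj₁ q
  ...   | inj₂ (q , l) = inj₂ (q , Reach-mono (λ _ → there) l)
  Level⇐ {t ∷ b} w (cons t∉ nt∉ c) x z p | yes refl with phi-min⁻¹ (demazure b w) x z p
  ... | p₁ , p₂ = combine (m w (x ⁺)) refl (Level⇐ w c (x ⁻) z p₁)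
    where
    p₂′ : z ℕ.≤ suc (F w (x ⁺))
    p₂′ = subst (λ a → z ℕ.≤ suc a) (demazure-off b w (λ q → nt∉ (subst (_∈ b) (r-⁺ x) q))) p₂
    combine : ∀ a → m w (x ⁺) ≡ a → Level w (_∈ b) (x ⁻) z → Level w (_∈ t ∷ b) x z
    combine true  e _ = inj₂ (p₂′ , stop e)
    combine false e (inj₁ q) = inj₁ (subst (z ℕ.≤_) (trans (cong (F w) (⁻⁺ x)) (trans (F-⁺ w x) (cong (λ b → bit b ℕ.+ F w (x ⁺)) e))) q)
    combine false e (inj₂ (_ , l)) = inj₂ (p₂′ , step (here refl) (Reach-mono (λ _ → there) l))

  -- ν ≤ P * w, as a condition on the set of letters P.
  record Q (w ν : Word) (P : I → Set) : Set where
    constructor mkQ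
    field level : ∀ x → Level w P x (F ν x)
  open Q public

  Level-mono : ∀ {w x z} {P P′ : I → Set} → (∀ t → P t → P′ t) → Level w P x z → Level w P′ x z
  Level-mono h (inj₁ p)       = inj₁ p
  Level-mono h (inj₂ (p , l)) = inj₂ (p , Reach-mono h l)

  Level-∩ : ∀ {w x z} {P P′ : I → Set} → Level w P x z → Level w P′ x z → Level w (λ t → P t × P′ t) x z
  Level-∩ (inj₁ p)       _               = inj₁ p
  Level-∩ (inj₂ _)       (inj₁ p)        = inj₁ p
  Level-∩ (inj₂ (p , l)) (inj₂ (_ , l′)) = inj₂ (p , Reach-∩ l l′)

  Q-mono : ∀ {w ν} {P P′ : I → Set} → (∀ t → P t → P′ t) → Q w ν P → Q w ν P′
  Q-mono {w} {ν} h q = mkQ λ x → Level-mono {w} {x} {F ν x} h (level q x)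

  Q-∩ : ∀ {w ν} {P P′ : I → Set} → Q w ν P → Q w ν P′ → Q w ν (λ t → P t × P′ t)
  Q-∩ {w} {ν} q q′ = mkQ λ x → Level-∩ {w} {x} {F ν x} (level q x) (level q′ x)

  Q⇒⊑ : ∀ {b} w ν → CycDec b → Q w ν (_∈ b) → ν ⊑ demazure b w
  Q⇒⊑ w ν c q x = Level⇒ w c x (F ν x) (level q x)

  ⊑⇒Q : ∀ {b} w ν → CycDec b → ν ⊑ demazure b w → Q w ν (_∈ b)
  ⊑⇒Q w ν c h = mkQ λ x → Level⇐ w c x (F ν x) (h x)

  -- The letters act in the order opposite to `demazure`, as the adjoint of a composite requires.
  dn* : Word → Word → Word
  dn* []      v = v
  dn* (t ∷ b) v = dn* b (dn t v)

  dn*⊑⇒ : ∀ b u v → dn* b u ⊑ v → u ⊑ demazure b v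
  dn*⊑⇒ []      u v h = h
  dn*⊑⇒ (t ∷ b) u v h = Off⇒⊑phi t u (demazure b v) (dn⊑⇒Off t u (demazure b v) (dn*⊑⇒ b (dn t u) v h))

  ⇒dn*⊑ : ∀ b u v → u ⊑ demazure b v → dn* b u ⊑ v
  ⇒dn*⊑ []      u v h = h
  ⇒dn*⊑ (t ∷ b) u v h = ⇒dn*⊑ b (dn t u) v (Off⇒dn⊑ t u (demazure b v) (⊑phi⇒Off t u (demazure b v) h))

  CycDec-⊆ : ∀ {b d} → b ⊆ d → CycDec d → CycDec b
  CycDec-⊆ [] [] = []
  CycDec-⊆ (_ ∷ʳ p) (cons _ _ c) = CycDec-⊆ p c
  CycDec-⊆ (refl ∷ p) (cons a b c) = cons (λ q → a (Sub.lookup p q)) (λ q → b (Sub.lookup p q)) (CycDec-⊆ p c)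

  -- The words `dword A`

  infixl 6 _↓_
  _↓_ : ℤ → ℕ → ℤ
  y ↓ zero  = y
  y ↓ suc d = y ⁻ ↓ d

  ↓-def : ∀ d y → y ≡ + d + (y ↓ d)
  ↓-def zero    y = sym (ℤP.+-identityˡ y)
  ↓-def (suc d) y = trans (sym (⁻⁺ y)) (trans (⁺-def (y ⁻)) (trans (cong (λ z → + 1 + z) (↓-def d (y ⁻)))
    (sym (ℤP.+-assoc (+ 1) (+ d) (y ⁻ ↓ d)))))

  ↓-⊕ : ∀ d y j → (y ⊕ j) ↓ d ≡ (y ↓ d) ⊕ j
  ↓-⊕ zero    y j = refl
  ↓-⊕ (suc d) y j = trans (cong (_↓ d) (⊕-⁻ y j)) (↓-⊕ d (y ⁻) j)

  +↓ : ∀ d a → d ℕ.≤ a → + a ↓ d ≡ + (a ∸ d)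
  +↓ zero    a       _       = refl
  +↓ (suc d) (suc a) (s≤s p) = trans (cong (_↓ d) (+suc a)) (+↓ d a p)

  r-↓-≢ : ∀ z i → suc i ℕ.< n → r z ≢ r (z ↓ suc i)
  r-↓-≢ z i i<n e with r-≡⇒⊕ (z ↓ suc i) z (sym e)
  ... | j , q = contradiction (proj₁ (÷n-unique (+ 0) j i<n (s≤s z≤n)
      (trans (ℤP.+-identityʳ (+ suc i)) (trans (ℤG.∙-cancelʳ y _ _ (trans (sym (↓-def (suc i) z))
        (trans q (trans (⊕-def y j) (ℤP.+-comm y (j * + n)))))) (sym (ℤP.+-identityˡ (j * + n))))))) ℕP.1+n≢0
    where
    y : ℤ
    y = z ↓ suc i

  below : ℤ → ℕ → Word
  below z zero    = []
  below z (suc j) = r (z ⁻) ∷ below (z ⁻) j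

  ∈-below⁻ : ∀ j z {t} → t ∈ below z j → ∃ λ i → i ℕ.< j × t ≡ r (z ↓ suc i)
  ∈-below⁻ (suc j) z (here e) = 0 , s≤s z≤n , e
  ∈-below⁻ (suc j) z (there p) with ∈-below⁻ j (z ⁻) p
  ... | i , i<j , e = suc i , s≤s i<j , e

  ∈-below⁺ : ∀ j z i → i ℕ.< j → r (z ↓ suc i) ∈ below z j
  ∈-below⁺ (suc j) z zero _ = here refl
  ∈-below⁺ (suc j) z (suc i) (s≤s p) = there (∈-below⁺ j (z ⁻) i p)

  top∉below : ∀ z j → j ℕ.< n → r z ∉ below z j
  top∉below z j j<n p with ∈-below⁻ j z p
  ... | i , i<j , e = r-↓-≢ z i (ℕP.≤-<-trans i<j j<n) e

  CycDec-below : ∀ j z → j ℕ.< n → CycDec (below z j)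
  CycDec-below zero    z _ = []
  CycDec-below (suc j) z p = cons (top∉below (z ⁻) j j<n)
      (λ q → top∉below z (suc j) p (there (subst (_∈ below (z ⁻) j) (sym (r-pred-next z refl)) q)))
      (CycDec-below j (z ⁻) j<n)
    where j<n = ℕP.<-trans (ℕP.n<1+n j) p

  ∈-below-all : ∀ t z → t ≢ r z → t ∈ below z (suc k')
  ∈-below-all t z ¬e with toℕ (r (z - rep t)) in e | FinP.toℕ<n (r (z - rep t))
  ... | i | i<n = cont i e i<n
    where
    q : ℤ
    q = block (z - rep t)
    eq : ∀ i → toℕ (r (z - rep t)) ≡ i → z ↓ i ≡ rep t ⊕ q
    eq i e = ℤG.∙-cancelˡ (+ i) _ _ (begin
      + i + (z ↓ i)               ≡⟨ sym (↓-def i z) ⟩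
      z                           ≡⟨ sym (cancel (rep t) z) ⟩
      rep t + (z - rep t)         ≡⟨ cong (λ x → rep t + x) (trans (÷n (z - rep t)) (cong (λ a → + a + q * + n) e)) ⟩
      rep t + (+ i + q * + n)     ≡⟨ sym (ℤP.+-assoc (rep t) (+ i) (q * + n)) ⟩
      rep t + + i + q * + n       ≡⟨ cong (_+ q * + n) (ℤP.+-comm (rep t) (+ i)) ⟩
      + i + rep t + q * + n       ≡⟨ ℤP.+-assoc (+ i) (rep t) (q * + n) ⟩
      + i + (rep t + q * + n)     ≡⟨ cong (λ x → + i + x) (sym (⊕-def (rep t) q)) ⟩
      + i + (rep t ⊕ q)           ∎) where open ≡-Reasoning
    r≡ : ∀ i → toℕ (r (z - rep t)) ≡ i → r (z ↓ i) ≡ t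
    r≡ i e = trans (cong r (eq i e)) (trans (r-⊕ (rep t) q) (r-rep t))
    cont : ∀ i → toℕ (r (z - rep t)) ≡ i → i ℕ.< n → t ∈ below z (suc k')
    cont zero    e _ = contradiction (sym (r≡ 0 e)) ¬e
    cont (suc i) e (s≤s p) = subst (_∈ below z (suc k')) (r≡ (suc i) e) (∈-below⁺ (suc k') z i p)

  mod-r : ∀ a → a mod n ≡ r (+ a)
  mod-r a = FinP.toℕ-injective (trans (FinP.toℕ-fromℕ< (m%n<n a n)) (sym (toℕ-r (+ a))))

  applyUpTo-below : ∀ j z (f : ℕ → I) → (∀ i → i ℕ.< j → f i ≡ r (z ↓ suc i)) → List.applyUpTo f j ≡ below z j
  applyUpTo-below zero    z f h = refl
  applyUpTo-below (suc j) z f h = cong₂ _∷_ (h 0 (s≤s z≤n)) (applyUpTo-below j (z ⁻) (f ∘ suc) (λ i p → h (suc i) (s≤s p)))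

  dword-below : ∀ A → dword A ≡ filterᵇ (_∈ᵇ A) (below (rep (firstOut A)) (suc k'))
  dword-below A = cong (filterᵇ (_∈ᵇ A)) (trans (ListP.map-upTo (λ t → ((toℕ o ℕ.+ n) ∸ suc t) mod n) (suc k'))
     (applyUpTo-below (suc k') (rep o) _ letter))
    where
    o : I
    o = firstOut A
    -- The summand n in `dword` keeps the truncated subtraction exact; for the residue it is a
    -- translation and drops out.
    letter : ∀ i → i ℕ.< suc k' → ((toℕ o ℕ.+ n) ∸ suc i) mod n ≡ r (rep o ↓ suc i)
    letter i p = begin
      ((toℕ o ℕ.+ n) ∸ suc i) mod n   ≡⟨ mod-r _ ⟩
      r (+ ((toℕ o ℕ.+ n) ∸ suc i))   ≡⟨ cong r (sym (+↓ (suc i) (toℕ o ℕ.+ n) (ℕP.≤-trans (ℕP.m≤n⇒m≤1+n p) (ℕP.m≤n+m n (toℕ o))))) ⟩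
      r (+ (toℕ o ℕ.+ n) ↓ suc i)     ≡⟨ cong (λ y → r (y ↓ suc i)) (trans (cong (λ y → rep o + y) (sym (ℤP.*-identityˡ (+ n)))) (sym (⊕-def (rep o) (+ 1)))) ⟩
      r ((rep o ⊕ + 1) ↓ suc i)       ≡⟨ cong r (↓-⊕ (suc i) (rep o) (+ 1)) ⟩
      r ((rep o ↓ suc i) ⊕ + 1)       ≡⟨ r-⊕ _ (+ 1) ⟩
      r (rep o ↓ suc i)               ∎ where open ≡-Reasoning

  -- As for `search`, unification recovers a local function, here `pick` of `firstOut`. Its first
  -- two steps unfold because n ≥ 2; the rest of the list is abstracted into a variable.
  mutual
    pick-out : Subset n → List I → I
    pick-out = _
    firstOut-pick : ∀ A → firstOut A ≡ (if lookup A Fin.zero then (if lookup A (Fin.suc Fin.zero) then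
                      pick-out A (List.tabulate {n = k'} (λ i → Fin.suc (Fin.suc i))) else Fin.suc Fin.zero) else Fin.zero)
    firstOut-pick A with List.tabulate {n = k'} (λ i → Fin.suc {n = suc k'} (Fin.suc i))
    ... | is = refl

  pick-out-spec : ∀ A is {i} → i ∈ is → lookup A i ≡ false → lookup A (pick-out A is) ≡ false
  pick-out-spec A (i ∷ is) (here refl) e rewrite e = e
  pick-out-spec A (j ∷ is) (there p) e with lookup A j in q
  ... | true = pick-out-spec A is p e
  ... | false = q

  Proper : Subset n → Set
  Proper A = ∃ λ i → lookup A i ≡ false

  firstOut∉ : ∀ A → Proper A → lookup A (firstOut A) ≡ false
  firstOut∉ A (i , e) = pick-out-spec A (allFin n) (MemP.∈-allFin i) e

  properᵇ⁻ : ∀ A → T (properᵇ A) → Proper A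
  properᵇ⁻ A p with all (_∈ᵇ A) (allFin n) in e | FinP.all? (λ i → BoolP.T? (lookup A i))
  ... | false | yes h = contradiction (AllP.all⁻ (_∈ᵇ A) (All.tabulate {xs = allFin n} (λ {i} _ → h i))) (λ q → subst T e q)
  ... | false | no ¬h with FinP.¬∀⟶∃¬ n (λ i → T (lookup A i)) (λ i → BoolP.T? (lookup A i)) ¬h
  ...   | i , ¬t = i , Equivalence.to BoolP.T-not-≡ (lemma (lookup A i) ¬t)
    where
    lemma : ∀ b → ¬ T b → T (not b)
    lemma true f = contradiction tt f
    lemma false _ = tt

  properᵇ⁺ : ∀ A → Proper A → T (properᵇ A)
  properᵇ⁺ A (i , e) with all (_∈ᵇ A) (allFin n) in q
  ... | false = tt
  ... | true = subst T e (All.lookup (AllP.all⁺ (_∈ᵇ A) (allFin n) (subst T (sym q) tt)) (MemP.∈-allFin i))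

  CycDec-dword : ∀ A → CycDec (dword A)
  CycDec-dword A = subst CycDec (sym (dword-below A))
    (CycDec-⊆ (SubP.filter-⊆ (BoolP.T? ∘ (_∈ᵇ A)) (below (rep (firstOut A)) (suc k'))) (CycDec-below (suc k') _ ℕP.≤-refl))

  infix 4 _∈ₛ_
  _∈ₛ_ : I → Subset n → Set
  t ∈ₛ A = lookup A t ≡ true

  ∈-dword⁻ : ∀ A {t} → t ∈ dword A → t ∈ₛ A
  ∈-dword⁻ A {t} p = T⇒≡ (proj₂ (∈-filterᵇ⁻ (_∈ᵇ A) (subst (t ∈_) (dword-below A) p)))

  ∈-dword⁺ : ∀ A → Proper A → ∀ {t} → t ∈ₛ A → t ∈ dword A
  ∈-dword⁺ A pr {t} e = subst (t ∈_) (sym (dword-below A)) (∈-filterᵇ⁺ (_∈ᵇ A)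
    (∈-below-all t (rep (firstOut A)) (λ q → contradiction (trans (sym e) (trans (cong (lookup A) (trans q (r-rep _))) (firstOut∉ A pr))) (λ ())))
    (≡⇒T e))

  -- Weak strips

  -- Start P x a: the positions a, a + 1, …, x - 1 have residues in P, and a is the lowest such.
  data Start (P : I → Set) (x : ℤ) : ℤ → Set where
    base : ¬ P (r (x ⁻)) → Start P x x
    step : ∀ {a} → P (r (x ⁻)) → Start P (x ⁻) a → Start P x a

  -- When the letter r x comes to act, the run below has carried the place of a up to the value x,
  -- while x + 1 is untouched. The inequality says that this letter is an ascent and keeps the
  -- element Grassmannian, so that `Strip` describes weak strips.
  Strip : Word → (I → Set) → Set
  Strip w P = ∀ x a → P (r x) → Start P x a → κ w a < κ w (x ⁺)

  Start-≤ : ∀ {P x a} → Start P x a → a ≤ x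
  Start-≤ (base _) = ℤP.≤-refl
  Start-≤ {x = x} (step _ s) = ℤP.≤-trans (Start-≤ s) (ℤP.<⇒≤ (⁻<y x))

  Start-unique : ∀ {P x a a′} → Start P x a → Start P x a′ → a ≡ a′
  Start-unique (base _)   (base _)   = refl
  Start-unique (base ¬p)  (step p _) = contradiction p ¬p
  Start-unique (step p _) (base ¬p)  = contradiction p ¬p
  Start-unique (step _ s) (step _ s′) = Start-unique s s′

  Start-cong : ∀ {P P′ : I → Set} → (∀ t → P t → P′ t) → (∀ t → P′ t → P t) → ∀ {x a} → Start P x a → Start P′ x a
  Start-cong f g (base ¬p)  = base (¬p ∘ g _)
  Start-cong f g (step p s) = step (f _ p) (Start-cong f g s)

  Strip-cong : ∀ {w} {P P′ : I → Set} → (∀ t → P t → P′ t) → (∀ t → P′ t → P t) → Strip w P → Strip w P′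
  Strip-cong f g h x a p s = h x a (g _ p) (Start-cong g f s)

  Start-⊕ : ∀ {P x a} j → Start P x a → Start P (x ⊕ j) (a ⊕ j)
  Start-⊕ {P} {x} j (base ¬p)  = base (λ p → ¬p (subst P (r-⊕⁻ x j) p))
  Start-⊕ {P} {x} {a} j (step p s) = step (subst P (sym (r-⊕⁻ x j)) p) (subst (λ y → Start P y (a ⊕ j)) (sym (⊕-⁻ x j)) (Start-⊕ j s))

  r≡next⇒ : ∀ {t} x → r x ≡ next t → r (x ⁻) ≡ t
  r≡next⇒ {t} x e = trans (r-suc-inj (trans (cong r (⁻⁺ x)) e)) (r-rep t)

  Start-cons : ∀ {t b x a} → next t ∉ b → r x ≢ next t → Start (_∈ b) x a → Start (_∈ t ∷ b) x a
  Start-cons {x = x} nt ¬e (base ¬p) = base λ { (here e) → ¬e (r-pred-next x e) ; (there p) → ¬p p }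
  Start-cons {b = b} nt ¬e (step p s) = step (there p) (Start-cons nt (λ e → nt (subst (_∈ b) e p)) s)

  Start-tail : ∀ {t b x a} → next t ∉ b → r x ≢ next t → Start (_∈ t ∷ b) x a → Start (_∈ b) x a
  Start-tail nt ¬e (base ¬p) = base (¬p ∘ there)
  Start-tail {b = b} {x} nt ¬e (step p s) = step x∈ (Start-tail nt (λ e → nt (subst (_∈ b) e x∈)) s)
    where x∈ = tail-∈ p (λ e → ¬e (r-pred-next x e))

  -- A cyclically decreasing word carries a value outside of it to the start of the run below.
  Start-ia : ∀ {b} → CycDec b → ∀ x → r x ∉ b → Start (_∈ b) x (ia b x)
  Start-ia [] x _ = base λ ()
  Start-ia {t ∷ b} (cons t∉ nt∉ c) x x∉ with pos t x
  ... | lo e = contradiction (here e) x∉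
  ... | hi e = subst (λ y → Start (_∈ t ∷ b) x (ia b y)) (sym (s-hi e))
                 (step (here e) (Start-cons nt∉ (λ e' → next≢ t (trans (sym e') e)) (Start-ia c (x ⁻) (λ p → t∉ (subst (_∈ b) e p)))))
  ... | off ¬e ¬e′ = subst (λ y → Start (_∈ t ∷ b) x (ia b y)) (sym (s-off ¬e ¬e′))
                 (Start-cons nt∉ (λ e' → ¬e′ (r≡next⇒ x e')) (Start-ia c x (x∉ ∘ there)))

  module _ {t b} (t∉ : t ∉ b) (nt∉ : next t ∉ b) (c : CycDec b) {y} (e : r y ≡ t) where
    ia-run : Start (_∈ t ∷ b) y (ia b y)
    ia-run = Start-cons nt∉ (λ e' → next≢ t (trans (sym e') e)) (Start-ia c y (λ p → t∉ (subst (_∈ b) e p)))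

    ia-above : ia b (y ⁺) ≡ y ⁺
    ia-above = Start-unique (Start-ia c (y ⁺) (λ p → nt∉ (subst (_∈ b) (trans (r-⁺ y) (cong next e)) p)))
                            (base (λ p → t∉ (subst (_∈ b) (r⁺⁻ y e) p)))

    ia-asc : ia b y < ia b (y ⁺)
    ia-asc = subst (ia b y <_) (sym ia-above) (ℤP.≤-<-trans (Start-≤ ia-run) (y<y⁺ y))

    κ-++ : ∀ w → κ (b ++ w) y ≡ κ w (ia b y) × κ (b ++ w) (y ⁺) ≡ κ w (y ⁺)
    κ-++ w = cong (λ p → block (p ⁻)) (ia-++ b w y)
           , cong (λ p → block (p ⁻)) (trans (ia-++ b w (y ⁺)) (cong (ia w) ia-above))

  Reduced-CycDec : ∀ {b} → CycDec b → Reduced b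
  Reduced-CycDec [] = ℕP.n≤0⇒n≡0 (len≤length [])
  Reduced-CycDec {t ∷ b} (cons t∉ nt∉ c) = trans (subst (λ i → len (i ∷ b) ≡ suc (len b)) (r-rep t)
    (ascent b (rep t) (ia-asc t∉ nt∉ c (r-rep t)))) (cong suc (Reduced-CycDec c))

  Strip⇒ : ∀ {b} w → CycDec b → Inc₀ w → Strip w (_∈ b) →
           Inc₀ (b ++ w) × len (b ++ w) ≡ length b ℕ.+ len w × demazure b w ≡ b ++ w
  Strip⇒ w [] g h = g , refl , refl
  Strip⇒ {t ∷ b} w (cons t∉ nt∉ c) g h with Strip⇒ w c g
      (λ x a p s → h x a (there p) (Start-cons nt∉ (λ e → nt∉ (subst (_∈ b) e p)) s))
  ... | g′ , l′ , d′ = subst (λ i → Inc₀ (i ∷ b ++ w)) (r-rep t) (κ-≢-Inc (b ++ w) g′ x (ℤP.<⇒≢ κ<))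
                     , trans (subst (λ i → len (i ∷ b ++ w) ≡ suc (len (b ++ w))) (r-rep t) (ascent (b ++ w) x asc)) (cong suc l′)
                     , trans (cong (phi t) d′) (subst (λ i → phi i (b ++ w) ≡ i ∷ b ++ w) (r-rep t) (proj₁ (phi-asc (b ++ w) x asc)))
    where
    x : ℤ
    x = rep t
    κ< : κ (b ++ w) x < κ (b ++ w) (x ⁺)
    κ< = subst₂ _<_ (sym (proj₁ (κ-++ t∉ nt∉ c (r-rep t) w))) (sym (proj₂ (κ-++ t∉ nt∉ c (r-rep t) w)))
           (h x (ia b x) (here (r-rep t)) (ia-run t∉ nt∉ c (r-rep t)))
    asc : ia (b ++ w) x < ia (b ++ w) (x ⁺)
    asc = κ<⇒< (b ++ w) x (x ⁺) κ<

  ⇒Strip : ∀ {b} w → CycDec b → Inc₀ (b ++ w) → len (b ++ w) ≡ length b ℕ.+ len w → Strip w (_∈ b)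
  ⇒Strip w [] g l x a ()
  ⇒Strip {t ∷ b} w (cons t∉ nt∉ c) g l x a x∈ s with r x FinP.≟ t
  ... | yes refl = subst₂ _<_ (trans (proj₁ (κ-++ t∉ nt∉ c refl w)) (cong (κ w) (Start-unique (ia-run t∉ nt∉ c refl) s)))
                              (proj₂ (κ-++ t∉ nt∉ c refl w)) (proj₂ (Inc-∷⁻¹ (b ++ w) x g (asc x refl)))
    where
    asc : ∀ x → r x ≡ t → ia (b ++ w) x < ia (b ++ w) (x ⁺)
    asc x e = ascent⁻¹ (b ++ w) x (ℕP.≤-trans (s≤s (ℕP.≤-trans (len-++ b w) (ℕP.+-monoˡ-≤ (len w) (len≤length b))))
                (ℕP.≤-reflexive (trans (sym l) (cong (λ i → len (i ∷ b ++ w)) (sym e)))))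
  ... | no ¬e = ⇒Strip w c (proj₁ (Inc-∷⁻¹ (b ++ w) (rep t) (subst (λ i → Inc₀ (i ∷ b ++ w)) (sym (r-rep t)) g) asc))
        (ℕP.≤-antisym (ℕP.≤-trans (len-++ b w) (ℕP.+-monoˡ-≤ (len w) (len≤length b)))
           (ℕ.s≤s⁻¹ (ℕP.≤-trans (ℕP.≤-reflexive (sym l)) (len-∷ t (b ++ w)))))
        x a x∈b (Start-tail nt∉ (λ e → nt∉ (subst (_∈ b) e x∈b)) s)
    where
    x∈b : r x ∈ b
    x∈b = tail-∈ x∈ ¬e
    asc : ia (b ++ w) (rep t) < ia (b ++ w) (rep t ⁺)
    asc = ascent⁻¹ (b ++ w) (rep t) (ℕP.≤-trans (s≤s (ℕP.≤-trans (len-++ b w) (ℕP.+-monoˡ-≤ (len w) (len≤length b))))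
                (ℕP.≤-reflexive (trans (sym l) (cong (λ i → len (i ∷ b ++ w)) (sym (r-rep t))))))

  -- A run of the intersection ends where one of the two sets lacks a letter, so it is a full run of
  -- that set.
  Start-∩ : ∀ {P P′ : I → Set} → (∀ t → Dec (P t)) → ∀ {x a} → Start (λ t → P t × P′ t) x a → Start P x a ⊎ Start P′ x a
  Start-∩ P? {x} (base ¬p) with P? (r (x ⁻))
  ... | yes p = inj₂ (base (λ p′ → ¬p (p , p′)))
  ... | no ¬q = inj₁ (base ¬q)
  Start-∩ P? (step (p , p′) s) with Start-∩ P? s
  ... | inj₁ q = inj₁ (step p q)
  ... | inj₂ q = inj₂ (step p′ q)

  Strip-∩ : ∀ {w} {P P′ : I → Set} → (∀ t → Dec (P t)) → Strip w P → Strip w P′ → Strip w (λ t → P t × P′ t)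
  Strip-∩ P? h h′ x a (p , p′) s with Start-∩ P? s
  ... | inj₁ q = h x a p q
  ... | inj₂ q = h′ x a p′ q

  -- Minimal sets of letters are strips

  data Run (w : Word) (P : I → Set) (x : ℤ) : ℤ → Set where
    base : ¬ P (r (x ⁻)) → Run w P x x
    step : ∀ {a} → P (r (x ⁻)) → κ w a < κ w x → Run w P (x ⁻) a → Run w P x a

  -- The lowest violation within a run: `Run` records the strip inequality at all letters of the run
  -- below x, and it fails at x.
  FirstBad : Word → (I → Set) → Set
  FirstBad w P = ∃₂ λ x a → Run w P x a × P (r x) × κ w (x ⁺) ≤ κ w a

  run? : ∀ {w P x a} → Start P x a → Run w P x a ⊎ FirstBad w P
  run? (base ¬p) = inj₁ (base ¬p)
  run? {w} {P} {x} {a} (step p s) with run? {w} s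
  ... | inj₂ f = inj₂ f
  ... | inj₁ q with κ w a ℤP.<? κ w x
  ...   | yes l = inj₁ (step p l q)
  ...   | no ¬l = inj₂ (x ⁻ , a , q , p , subst (λ y → κ w y ≤ κ w a) (sym (⁻⁺ x)) (ℤP.≮⇒≥ ¬l))

  κ-⊕-≤ : ∀ w j y z → κ w y ≤ κ w z → κ w (y ⊕ j) ≤ κ w (z ⊕ j)
  κ-⊕-≤ w j y z p = subst₂ _≤_ (sym (κ-⊕ w y j)) (sym (κ-⊕ w z j)) (ℤP.+-monoˡ-≤ j p)

  -- In a run without violations the value a lies in the lowest window, so a is marked as soon as
  -- any value of the run is. A path cannot leave the run below a, where a letter is missing.
  Run-reach : ∀ {w P x a} → Run w P x a → ∀ j → Reach w P ((x ⊕ j) ⁻) → m w (a ⊕ j) ≡ true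
  Run-reach {w} {x = x} (base ¬p) j (stop e) = trans (cong (m w) (sym (⁻⁺ (x ⊕ j)))) e
  Run-reach {P = P} {x = x} (base ¬p) j (step p _) = contradiction (subst P (r-⊕⁻ x j) p) ¬p
  Run-reach {w} {x = x} {a} (step p l q) j (stop e) = m-mono w (a ⊕ j) (x ⊕ j) (κ-⊕-≤ w j a x (ℤP.<⇒≤ l)) (trans (cong (m w) (sym (⁻⁺ (x ⊕ j)))) e)
  Run-reach {w} {P} {x = x} (step p l q) j (step _ t) = Run-reach q j (subst (λ y → Reach w P (y ⁻)) (⊕-⁻ x j) t)

  -- A path through the violating letter ends in the run below it, so a is marked, and x + 1, whose
  -- window is not larger, is marked too. The path could have stopped before using that letter.
  Reach-remove : ∀ {w P} ((x , _) : FirstBad w P) → ∀ {y} → Reach w P y → Reach w (λ u → P u × u ≢ r x) y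
  Reach-remove f (stop e) = stop e
  Reach-remove {w} {P} f@(x , a , q , px , l) {y} (step p t) with r y FinP.≟ r x
  ... | no ¬e = step (p , ¬e) (Reach-remove f t)
  ... | yes e with r-≡⇒⊕ x y (sym e)
  ...   | j , refl = stop (m-mono w ((x ⊕ j) ⁺) (a ⊕ j) (subst (λ z → κ w z ≤ κ w (a ⊕ j)) (sym (⊕-⁺ x j)) (κ-⊕-≤ w j (x ⁺) a l)) (Run-reach q j t))

  -- A violation of the strip inequality would yield a first one, and by `Reach-remove` its letter
  -- could be dropped without losing `Q`.
  minimal⇒Strip : ∀ w ν {P : I → Set} → Q w ν P → (∀ t → P t → ¬ Q w ν (λ u → P u × u ≢ t)) → Strip w P
  minimal⇒Strip w ν {P} q h x a p s with κ w a ℤP.<? κ w (x ⁺)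
  ... | yes l = l
  ... | no ¬l = contradiction removed (h (r (proj₁ bad)) (proj₁ (proj₂ (proj₂ (proj₂ bad)))))
    where
    find-bad : Run w P x a ⊎ FirstBad w P → FirstBad w P
    find-bad (inj₁ q) = x , a , q , p , ℤP.≮⇒≥ ¬l
    find-bad (inj₂ f) = f
    bad : FirstBad w P
    bad = find-bad (run? s)
    remove-level : ∀ {y} → Level w P y (F ν y) → Level w (λ u → P u × u ≢ r (proj₁ bad)) y (F ν y)
    remove-level (inj₁ p)       = inj₁ p
    remove-level (inj₂ (p , t)) = inj₂ (p , Reach-remove bad t)
    removed : Q w ν (λ u → P u × u ≢ r (proj₁ bad))
    removed = mkQ λ y → remove-level (level q y)

  -- Enlarging a strip by one letter

  module Extend (w : Word) {P : I → Set} (P? : ∀ t → Dec (P t)) (o : I) (¬Po : ¬ P o) where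
    start-fuel : ∀ d x → ¬ P (r (x ↓ suc d)) → ∃ λ a → Start P x a
    start-fuel zero x ¬p = x , base ¬p
    start-fuel (suc d) x ¬p with P? (r (x ⁻))
    ... | no ¬q = x , base ¬q
    ... | yes q with start-fuel d (x ⁻) ¬p
    ...   | a , s = a , step q s

    start : ∀ x → ∃ λ a → Start P x a
    start x with o FinP.≟ r x
    ... | no ¬e with ∈-below⁻ (suc k') x (∈-below-all o x ¬e)
    ...   | i , _ , e = start-fuel i x (λ p → ¬Po (subst P (sym e) p))
    start x | yes e with ∈-below⁻ (suc k') (x ⁻) (∈-below-all o (x ⁻) (λ e' → r-pred≢ x (trans (sym e') e)))
    ...   | i , _ , e′ = start-fuel (suc i) x (λ p → ¬Po (subst P (sym e′) p))

    Addable : I → Set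
    Addable t = ¬ P t × κ w (proj₁ (start (rep t))) < κ w (rep t ⁺)

    addable? : ∀ t → Dec (Addable t)
    addable? t with P? t | κ w (proj₁ (start (rep t))) ℤP.<? κ w (rep t ⁺)
    ... | yes p | _ = no (λ a → proj₁ a p)
    ... | no ¬p | yes l = yes (¬p , l)
    ... | no ¬p | no ¬l = no (¬l ∘ proj₂)

    start-shift : ∀ t y a → r y ≡ t → Start P y a → ∃ λ j → y ≡ rep t ⊕ j × a ≡ proj₁ (start (rep t)) ⊕ j
    start-shift t y a e s with r-≡⇒⊕ (rep t) y (trans (r-rep t) (sym e))
    ... | j , refl = j , refl , Start-unique s (Start-⊕ j (proj₂ (start (rep t))))

    -- If no letter could be added, `κ` at the starts of the runs would never increase on a full
    -- turn from o + 1 to o + 1 + n, whereas this translation raises it by one.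
    not-addable : ¬ (∀ t → ¬ Addable t)
    not-addable none = ℤP.<⇒≱ (ℤP.+-monoʳ-< (κ w a₀) (+<+ {0} {1} (s≤s z≤n)))
        (ℤP.≤-trans (ℤP.≤-reflexive (sym (κ-⊕ w a₀ (+ 1)))) (ℤP.≤-trans
          (walk n a₀ a₀ a₀-start ℤP.≤-refl (a₀ ⊕ + 1) (subst (λ y → Start P y (a₀ ⊕ + 1)) (sym (↑n a₀)) (Start-⊕ (+ 1) a₀-start)))
          (ℤP.≤-reflexive (sym (ℤP.+-identityʳ (κ w a₀))))))
      where
      a₀ : ℤ
      a₀ = rep o ⁺
      a₀-start : Start P a₀ a₀
      a₀-start = base (λ p → ¬Po (subst P (r⁺⁻ (rep o) (r-rep o)) p))
      stuck : ∀ y a → ¬ P (r y) → Start P y a → κ w (y ⁺) ≤ κ w a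
      stuck y a ¬p s with start-shift (r y) y a refl s
      ... | j , e , e′ = subst₂ (λ u v → κ w u ≤ κ w v) (trans (sym (⊕-⁺ (rep (r y)) j)) (cong _⁺ (sym e))) (sym e′)
             (κ-⊕-≤ w j (rep (r y) ⁺) (proj₁ (start (rep (r y)))) (ℤP.≮⇒≥ (λ l → none (r y) (¬p , l))))
      walk : ∀ d y a → Start P y a → κ w a ≤ κ w a₀ → ∀ a′ → Start P (y ↑ d) a′ → κ w a′ ≤ κ w a₀
      walk zero    y a s l a′ s′ = subst (λ z → κ w z ≤ κ w a₀) (Start-unique s s′) l
      walk (suc d) y a s l a′ s′ with P? (r y)
      ... | yes p = walk d (y ⁺) a (step (subst P (sym (r⁺⁻ y refl)) p) (subst (λ z → Start P z a) (sym (⁺⁻ y)) s)) l a′ s′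
      ... | no ¬p = walk d (y ⁺) (y ⁺) (base (λ p → ¬p (subst P (r⁺⁻ y refl) p))) (ℤP.≤-trans (stuck y a ¬p s) l) a′ s′

    addable : ∃ Addable
    addable with FinP.any? addable?
    ... | yes h = h
    ... | no ¬h = contradiction (λ t a → ¬h (t , a)) not-addable

    addable-shift : ∀ t → Addable t → ∀ y a → r y ≡ t → Start P y a → κ w a < κ w (y ⁺)
    addable-shift t (_ , l) y a e s with start-shift t y a e s
    ... | j , e₁ , e₂ = subst₂ _<_ (trans (sym (κ-⊕ w _ j)) (cong (κ w) (sym e₂)))
            (trans (sym (κ-⊕ w _ j)) (cong (κ w) (trans (sym (⊕-⁺ (rep t) j)) (cong _⁺ (sym e₁))))) (ℤP.+-monoˡ-< j l)

    -- Adding t may join two runs. By addability the start of the lower run lies in an earlier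
    -- window than the start of the upper one, so the old inequalities only become stronger.
    Strip-add : ∀ t → Addable t → Strip w P → Strip w (λ u → P u ⊎ u ≡ t)
    Strip-add t ad h x a x∈ s with lower s
      where
      lower : ∀ {x a} → Start (λ u → P u ⊎ u ≡ t) x a → ∃ λ a′ → Start P x a′ × κ w a ≤ κ w a′
      lower {x} (base ¬p) = x , base (¬p ∘ inj₁) , ℤP.≤-refl
      lower {x} {a} (step p s) with lower s | P? (r (x ⁻)) | p
      ... | a′ , s′ , l | yes q | _ = a′ , step q s′ , l
      ... | a′ , s′ , l | no ¬q | inj₁ q = contradiction q ¬q
      ... | a′ , s′ , l | no ¬q | inj₂ e = x , base ¬q ,
            ℤP.≤-trans l (ℤP.<⇒≤ (subst (λ y → κ w a′ < κ w y) (⁻⁺ x) (addable-shift t ad (x ⁻) a′ e s′)))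
    ... | a′ , s′ , l with x∈
    ...   | inj₁ p = ℤP.≤-<-trans l (h x a′ p s′)
    ...   | inj₂ e = ℤP.≤-<-trans l (addable-shift t ad x a′ e s′)

  -- Least sets of letters

  ∣∣-update : ∀ {j} (A : Subset j) t → lookup A t ≡ true → ∣ A ∣ ≡ suc ∣ A [ t ]≔ false ∣
  ∣∣-update (true Vec.∷ A)  Fin.zero    refl = refl
  ∣∣-update (true Vec.∷ A)  (Fin.suc t) e = cong suc (∣∣-update A t e)
  ∣∣-update (false Vec.∷ A) (Fin.suc t) e = ∣∣-update A t e

  ∣∣-insert : ∀ {j} (A : Subset j) t → lookup A t ≡ false → ∣ A [ t ]≔ true ∣ ≡ suc ∣ A ∣
  ∣∣-insert (false Vec.∷ A) Fin.zero    refl = refl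
  ∣∣-insert (true Vec.∷ A)  (Fin.suc t) e = cong suc (∣∣-insert A t e)
  ∣∣-insert (false Vec.∷ A) (Fin.suc t) e = ∣∣-insert A t e

  ∣∣-mono : ∀ {j} (A B : Subset j) → (∀ t → lookup A t ≡ true → lookup B t ≡ true) → ∣ A ∣ ℕ.≤ ∣ B ∣
  ∣∣-mono Vec.[] Vec.[] h = z≤n
  ∣∣-mono (false Vec.∷ A) (true Vec.∷ B) h = ℕP.m≤n⇒m≤1+n (∣∣-mono A B (h ∘ Fin.suc))
  ∣∣-mono (false Vec.∷ A) (false Vec.∷ B) h = ∣∣-mono A B (h ∘ Fin.suc)
  ∣∣-mono (true Vec.∷ A) (b Vec.∷ B) h with b | h Fin.zero refl
  ... | true | _ = s≤s (∣∣-mono A B (h ∘ Fin.suc))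

  ∣∣<⇒out : ∀ {j} (A : Subset j) → ∣ A ∣ ℕ.< j → ∃ λ t → lookup A t ≡ false
  ∣∣<⇒out (false Vec.∷ A) _ = Fin.zero , refl
  ∣∣<⇒out (true Vec.∷ A) (s≤s p) with ∣∣<⇒out A p
  ... | t , e = Fin.suc t , e

  ∣∣-empty : ∀ {j} (A : Subset j) → (∀ t → lookup A t ≢ true) → ∣ A ∣ ≡ 0
  ∣∣-empty Vec.[] h = refl
  ∣∣-empty (true Vec.∷ A) h = contradiction refl (h Fin.zero)
  ∣∣-empty (false Vec.∷ A) h = ∣∣-empty A (h ∘ Fin.suc)

  lookup-ext : ∀ {j} (A B : Subset j) → (∀ t → lookup A t ≡ lookup B t) → A ≡ B
  lookup-ext Vec.[] Vec.[] h = refl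
  lookup-ext (a Vec.∷ A) (b Vec.∷ B) h = cong₂ Vec._∷_ (h Fin.zero) (lookup-ext A B (h ∘ Fin.suc))

  _∈ₛ?_ : ∀ t A → Dec (t ∈ₛ A)
  t ∈ₛ? A = lookup A t BoolP.≟ true

  remove : Subset n → I → Subset n
  remove A t = A [ t ]≔ false

  insert : Subset n → I → Subset n
  insert A t = A [ t ]≔ true

  ∈-remove⁻ : ∀ A t u → u ∈ₛ remove A t → u ∈ₛ A × u ≢ t
  ∈-remove⁻ A t u e with u FinP.≟ t
  ... | yes refl = contradiction (trans (sym (VecP.lookup∘update t A false)) e) λ ()
  ... | no ¬e = trans (sym (VecP.lookup∘update′ ¬e A false)) e , ¬e

  ∈-remove⁺ : ∀ A t u → u ∈ₛ A × u ≢ t → u ∈ₛ remove A t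
  ∈-remove⁺ A t u (e , ¬e) = trans (VecP.lookup∘update′ ¬e A false) e

  ∈-insert⁻ : ∀ A t u → u ∈ₛ insert A t → u ∈ₛ A ⊎ u ≡ t
  ∈-insert⁻ A t u e with u FinP.≟ t
  ... | yes q = inj₂ q
  ... | no ¬e = inj₁ (trans (sym (VecP.lookup∘update′ ¬e A true)) e)

  ∈-insert⁺ : ∀ A t u → u ∈ₛ A ⊎ u ≡ t → u ∈ₛ insert A t
  ∈-insert⁺ A t u h with u FinP.≟ t
  ∈-insert⁺ A t u h | yes refl = VecP.lookup∘update t A true
  ∈-insert⁺ A t u (inj₁ e) | no ¬e = trans (VecP.lookup∘update′ ¬e A true) e
  ∈-insert⁺ A t u (inj₂ e) | no ¬e = contradiction e ¬e

  ∉ₛ⇒false : ∀ A t → ¬ (t ∈ₛ A) → lookup A t ≡ false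
  ∉ₛ⇒false A t h with lookup A t
  ... | true = contradiction refl h
  ... | false = refl

  CycDec-length : ∀ {b} A → CycDec b → (∀ t → t ∈ₛ A → t ∈ b) → (∀ t → t ∈ b → t ∈ₛ A) → length b ≡ ∣ A ∣
  CycDec-length A [] f g = sym (∣∣-empty A (λ t e → contradiction (f t e) λ ()))
  CycDec-length {t ∷ b} A (cons t∉ _ c) f g = trans (cong suc (CycDec-length (remove A t) c
     (λ u e → tail-∈ (f u (proj₁ (∈-remove⁻ A t u e))) (proj₂ (∈-remove⁻ A t u e)))
     (λ u p → ∈-remove⁺ A t u (g u (there p) , λ { refl → t∉ p }))))
     (sym (∣∣-update A t (g t (here refl))))

  length-dword : ∀ A → Proper A → length (dword A) ≡ ∣ A ∣
  length-dword A pr = CycDec-length A (CycDec-dword A) (λ t → ∈-dword⁺ A pr) (λ t → ∈-dword⁻ A)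

  Q-dword : ∀ w ν A → Proper A → Q w ν (_∈ₛ A) → Q w ν (_∈ dword A)
  Q-dword w ν A pr = Q-mono (λ t → ∈-dword⁺ A pr)

  Q-dword⁻ : ∀ w ν A → Q w ν (_∈ dword A) → Q w ν (_∈ₛ A)
  Q-dword⁻ w ν A = Q-mono (λ t → ∈-dword⁻ A)

  IsStrip : Word → ℕ → Subset n → Set
  IsStrip w j A = Proper A × ∣ A ∣ ≡ j × Strip w (_∈ₛ A)

  Strip-dword : ∀ {w A} → Proper A → Strip w (_∈ₛ A) → Strip w (_∈ dword A)
  Strip-dword {w} {A} pr = Strip-cong {w} (λ t → ∈-dword⁺ A pr) (λ t → ∈-dword⁻ A)

  stripᵇ : Word → ℕ → Subset n → Bool
  stripᵇ w j A = properᵇ A ∧ (∣ A ∣ ≡ᵇ j) ∧ grassᵇ (dword A ++ w) ∧ leftWeakᵇ w (dword A ++ w)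

  len-cancel : ∀ b w → len ((b ++ w) ++ inv w) ≡ len b
  len-cancel b w = len-cong ((b ++ w) ++ inv w) b (mk~ λ y → begin
    ia ((b ++ w) ++ reverse w) y     ≡⟨ ia-++ (b ++ w) (reverse w) y ⟩
    ia (reverse w) (ia (b ++ w) y)   ≡⟨ ia-reverse w _ ⟩
    act w (ia (b ++ w) y)            ≡⟨ cong (act w) (ia-++ b w y) ⟩
    act w (ia w (ia b y))            ≡⟨ act-ia w (ia b y) ⟩
    ia b y                           ∎) where open ≡-Reasoning

  T∧⁻ : ∀ a b → T (a ∧ b) → T a × T b
  T∧⁻ true b h = tt , h

  T∧⁺ : ∀ a b → T a → T b → T (a ∧ b)
  T∧⁺ true b _ h = h

  len-quotient : ∀ A w → len ((dword A ++ w) ++ inv w) ℕ.+ len w ≡ length (dword A) ℕ.+ len w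
  len-quotient A w = cong (ℕ._+ len w) (trans (len-cancel (dword A) w) (Reduced-CycDec (CycDec-dword A)))

  stripᵇ⇒ : ∀ w j A → T (stripᵇ w j A) → IsStrip w j A
  stripᵇ⇒ w j A h =
    let (h₁ , h′) = T∧⁻ (properᵇ A) ((∣ A ∣ ≡ᵇ j) ∧ grassᵇ (dword A ++ w) ∧ leftWeakᵇ w (dword A ++ w)) h
        (h₂ , h″) = T∧⁻ (∣ A ∣ ≡ᵇ j) (grassᵇ (dword A ++ w) ∧ leftWeakᵇ w (dword A ++ w)) h′
        (h₃ , h₄) = T∧⁻ (grassᵇ (dword A ++ w)) (leftWeakᵇ w (dword A ++ w)) h″
        pr = properᵇ⁻ A h₁
    in pr , ℕP.≡ᵇ⇒≡ ∣ A ∣ j h₂ , Strip-cong {w} (λ t → ∈-dword⁻ A) (λ t → ∈-dword⁺ A pr)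
         (⇒Strip w (CycDec-dword A) (Grass⇒Inc (dword A ++ w) h₃)
           (trans (sym (ℕP.≡ᵇ⇒≡ (len ((dword A ++ w) ++ inv w) ℕ.+ len w) (len (dword A ++ w)) h₄)) (len-quotient A w)))

  ⇒stripᵇ : ∀ w j A → Inc₀ w → IsStrip w j A → T (stripᵇ w j A)
  ⇒stripᵇ w j A g (pr , e , st) =
    let (g′ , l , _) = Strip⇒ w (CycDec-dword A) g (Strip-dword {w} {A} pr st)
    in T∧⁺ (properᵇ A) ((∣ A ∣ ≡ᵇ j) ∧ grassᵇ (dword A ++ w) ∧ leftWeakᵇ w (dword A ++ w)) (properᵇ⁺ A pr)
        (T∧⁺ (∣ A ∣ ≡ᵇ j) (grassᵇ (dword A ++ w) ∧ leftWeakᵇ w (dword A ++ w)) (ℕP.≡⇒≡ᵇ ∣ A ∣ j e)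
          (T∧⁺ (grassᵇ (dword A ++ w)) (leftWeakᵇ w (dword A ++ w)) (Inc⇒Grass (dword A ++ w) g′)
            (ℕP.≡⇒≡ᵇ (len ((dword A ++ w) ++ inv w) ℕ.+ len w) (len (dword A ++ w)) (trans (len-quotient A w) (sym l)))))

  -- Only the removal of single letters is tested. Since `Q` is closed under intersections and
  -- supersets, such an M already lies in every set satisfying `Q`; see `Least-⊆`.
  Least : Word → Word → Subset n → Set
  Least w ν M = Q w ν (_∈ₛ M) × (∀ t → t ∈ₛ M → ¬ Q w ν (λ u → u ∈ₛ M × u ≢ t))

  Least⇒Strip : ∀ w ν M → Least w ν M → Strip w (_∈ₛ M)
  Least⇒Strip w ν M (q , h) = minimal⇒Strip w ν q h

  Least-⊆ : ∀ w ν M M′ → Least w ν M → Q w ν (_∈ₛ M′) → ∀ t → t ∈ₛ M → t ∈ₛ M′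
  Least-⊆ w ν M M′ (q , h) q′ t t∈ with t ∈ₛ? M′
  ... | yes p = p
  ... | no ¬p = contradiction (Q-mono (λ u (a , b) → a , λ { refl → ¬p b }) (Q-∩ q q′)) (h t t∈)

  Least-unique : ∀ w ν M M′ → Least w ν M → Least w ν M′ → M ≡ M′
  Least-unique w ν M M′ l l′ = lookup-ext M M′ λ t → lemma (lookup M t) (lookup M′ t) refl refl
       (Least-⊆ w ν M M′ l (proj₁ l′) t) (Least-⊆ w ν M′ M l′ (proj₁ l) t)
    where
    lemma : ∀ {x y : Bool} a b → x ≡ a → y ≡ b → (x ≡ true → y ≡ true) → (y ≡ true → x ≡ true) → x ≡ y
    lemma true _ refl _ f _ = sym (f refl)
    lemma false true refl refl _ g = g refl
    lemma false false refl refl _ _ = refl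

  Proper-⊆ : ∀ {A B} → Proper A → (∀ t → t ∈ₛ B → t ∈ₛ A) → Proper B
  Proper-⊆ {A} {B} (o , e) h = o , ∉ₛ⇒false B o (λ p → contradiction (trans (sym e) (h o p)) λ ())

  dn-Incₜ : ∀ t u → Inc₀ u → Inc₀ (dn t u)
  dn-Incₜ t u g = subst (λ i → Inc₀ (dn i u)) (r-rep t) (dn-Inc u g (rep t))

  dn*-Inc : ∀ b u → Inc₀ u → Inc₀ (dn* b u)
  dn*-Inc []      u g = g
  dn*-Inc (t ∷ b) u g = dn*-Inc b (dn t u) (dn-Incₜ t u g)

  -- Strips and least sets over a fixed Grassmannian element

  module Over (w : Word) (g : Inc₀ w) where
    -- ν ≤ b * w, decided by moving b to the other side.
    below? : Word → Word → Bool
    below? ν b = bruhatᵇ (dn* b ν) w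

    below?⇒Q : ∀ ν {b} → CycDec b → below? ν b ≡ true → Q w ν (_∈ b)
    below?⇒Q ν {b} c e = ⊑⇒Q w ν c (dn*⊑⇒ b ν w (≤B⇒⊑ (dn* b ν) w (≡⇒T e)))

    Q⇒below? : ∀ ν {b} → Inc₀ ν → CycDec b → Q w ν (_∈ b) → below? ν b ≡ true
    Q⇒below? ν {b} gν c q = T⇒≡ (⊑⇒≤B (dn* b ν) w (Inc⇒Grass (dn* b ν) (dn*-Inc b ν gν)) (Inc⇒Grass w g)
        (⇒dn*⊑ b ν w (Q⇒⊑ w ν c q)))

    Q? : ∀ ν → Inc₀ ν → ∀ A → Proper A → Dec (Q w ν (_∈ₛ A))
    Q? ν gν A pr = map′ (λ e → Q-dword⁻ w ν A (below?⇒Q ν (CycDec-dword A) e))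
                        (λ q → Q⇒below? ν gν (CycDec-dword A) (Q-dword w ν A pr q)) (below? ν (dword A) BoolP.≟ true)

    -- For a weak strip the Demazure product `d_A * w` is the ordinary product and is Grassmannian,
    -- so here `Q` coincides with the Bruhat order.
    strip-≤ : ∀ ν A → Inc₀ ν → Proper A → Strip w (_∈ₛ A) →
              (ν ≤B (dword A ++ w) → Q w ν (_∈ₛ A)) × (Q w ν (_∈ₛ A) → ν ≤B (dword A ++ w))
    strip-≤ ν A gν pr st = let (g′ , _ , d) = Strip⇒ w (CycDec-dword A) g (Strip-dword {w} {A} pr st) in
                       (λ h → Q-dword⁻ w ν A (⊑⇒Q w ν (CycDec-dword A) (subst (ν ⊑_) (sym d) (≤B⇒⊑ ν (dword A ++ w) h))))
                     , (λ q → ⊑⇒≤B ν (dword A ++ w) (Inc⇒Grass ν gν) (Inc⇒Grass (dword A ++ w) g′)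
                          (subst (ν ⊑_) d (Q⇒⊑ w ν (CycDec-dword A) (Q-dword w ν A pr q))))

    strip-Inc : ∀ A → Proper A → Strip w (_∈ₛ A) → Inc₀ (dword A ++ w)
    strip-Inc A pr st = proj₁ (Strip⇒ w (CycDec-dword A) g (Strip-dword {w} {A} pr st))

    Removable : Word → Subset n → I → Set
    Removable ν A t = t ∈ₛ A × Q w ν (_∈ₛ remove A t)

    Proper-remove : ∀ A t → Proper A → Proper (remove A t)
    Proper-remove A t pr = Proper-⊆ {A} {remove A t} pr (λ u e → proj₁ (∈-remove⁻ A t u e))

    removable? : ∀ ν → Inc₀ ν → ∀ A → Proper A → ∀ t → Dec (Removable ν A t)
    removable? ν gν A pr t = (t ∈ₛ? A) ×-dec Q? ν gν (remove A t) (Proper-remove A t pr)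

    shrink : ∀ ν → Inc₀ ν → ∀ j A → ∣ A ∣ ℕ.≤ j → Proper A → Q w ν (_∈ₛ A) →
             ∃ λ M → Proper M × Least w ν M × ∣ M ∣ ℕ.≤ ∣ A ∣
    shrink-by : ∀ ν → Inc₀ ν → ∀ j A → ∣ A ∣ ℕ.≤ j → Proper A → Q w ν (_∈ₛ A) → Dec (∃ (Removable ν A)) →
                ∃ λ M → Proper M × Least w ν M × ∣ M ∣ ℕ.≤ ∣ A ∣
    shrink ν gν j A sz pr q = shrink-by ν gν j A sz pr q (FinP.any? (removable? ν gν A pr))
    shrink-by ν gν j A sz pr q (no ¬h) = A , pr , (q , λ t t∈ q′ → ¬h (t , t∈ , Q-mono (∈-remove⁺ A t) q′)) , ℕP.≤-refl
    shrink-by ν gν zero A sz pr q (yes (t , t∈ , _)) = contradiction (trans (sym (∣∣-update A t t∈)) (ℕP.n≤0⇒n≡0 sz)) ℕP.1+n≢0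
    shrink-by ν gν (suc j) A sz pr q (yes (t , t∈ , q′)) =
      let (M , prM , l , szM) = shrink ν gν j (remove A t) (ℕ.s≤s⁻¹ (ℕP.≤-trans (ℕP.≤-reflexive (sym (∣∣-update A t t∈))) sz)) (Proper-remove A t pr) q′
      in M , prM , l , ℕP.≤-trans szM (ℕP.≤-trans (ℕP.n≤1+n _) (ℕP.≤-reflexive (sym (∣∣-update A t t∈))))

    -- The bound k on the final size keeps every intermediate set proper, so that a missing letter
    -- is available for the next application of `Extend`.
    grow : ∀ d A → ∣ A ∣ ℕ.+ d ℕ.≤ suc k' → Proper A → Strip w (_∈ₛ A) →
           ∃ λ B → IsStrip w (∣ A ∣ ℕ.+ d) B × (∀ t → t ∈ₛ A → t ∈ₛ B)
    grow-by : ∀ d A → ∣ A ∣ ℕ.+ suc d ℕ.≤ suc k' → ∀ t → lookup A t ≡ false → Strip w (_∈ₛ insert A t) →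
           ∃ λ B → IsStrip w (∣ A ∣ ℕ.+ suc d) B × (∀ t → t ∈ₛ A → t ∈ₛ B)
    grow zero A sz pr st = A , (pr , sym (ℕP.+-identityʳ ∣ A ∣) , st) , λ t p → p
    grow (suc d) A sz (o , ¬o) st = grow-by d A sz (proj₁ addable) (∉ₛ⇒false A (proj₁ addable) (proj₁ (proj₂ addable)))
        (Strip-cong {w} (∈-insert⁺ A (proj₁ addable)) (∈-insert⁻ A (proj₁ addable)) (Strip-add (proj₁ addable) (proj₂ addable) st))
      where open Extend w (_∈ₛ? A) o (λ p → contradiction (trans (sym ¬o) p) λ ())
    grow-by d A sz t t∉ st =
      let (B , (prB , szB , stB) , sub) = grow d (insert A t) sz′ (∣∣<⇒out (insert A t) (s≤s (ℕP.≤-trans (ℕP.m≤m+n _ d) sz′))) st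
      in B , (prB , trans szB (sym size) , stB) , λ u u∈ → sub u (∈-insert⁺ A t u (inj₁ u∈))
      where
      size : ∣ A ∣ ℕ.+ suc d ≡ ∣ insert A t ∣ ℕ.+ d
      size = trans (ℕP.+-suc ∣ A ∣ d) (cong (ℕ._+ d) (sym (∣∣-insert A t t∉)))
      sz′ : ∣ insert A t ∣ ℕ.+ d ℕ.≤ suc k'
      sz′ = subst (ℕ._≤ suc k') size sz

    least⇒strip : ∀ ν → Inc₀ ν → ∀ j → j ℕ.≤ suc k' → ∀ M → Proper M → ∣ M ∣ ℕ.≤ j → Least w ν M →
                  ∃ λ A → IsStrip w j A × ν ≤B (dword A ++ w)
    least⇒strip ν gν j j≤k M pr sz l =
      let (A , (prA , szA , stA) , sub) = grow (j ∸ ∣ M ∣) M (subst (ℕ._≤ suc k') (sym (ℕP.m+[n∸m]≡n sz)) j≤k) pr (Least⇒Strip w ν M l)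
      in A , (prA , trans szA (ℕP.m+[n∸m]≡n sz) , stA) , proj₂ (strip-≤ ν A gν prA stA) (Q-mono sub (proj₁ l))

    strip⇒least : ∀ ν → Inc₀ ν → ∀ j A → IsStrip w j A → ν ≤B (dword A ++ w) →
                  ∃ λ M → Proper M × ∣ M ∣ ℕ.≤ j × Least w ν M
    strip⇒least ν gν j A (pr , sz , st) h =
      let (M , prM , l , szM) = shrink ν gν ∣ A ∣ A ℕP.≤-refl pr (proj₁ (strip-≤ ν A gν pr st) h)
      in M , prM , ℕP.≤-trans szM (ℕP.≤-reflexive sz) , l

    lookup-∩ : ∀ {j} (A B : Subset j) t → lookup (A ∩ˢ B) t ≡ lookup A t ∧ lookup B t
    lookup-∩ (a Vec.∷ A) (b Vec.∷ B) Fin.zero = refl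
    lookup-∩ (a Vec.∷ A) (b Vec.∷ B) (Fin.suc t) = lookup-∩ A B t

    ∈-∩ : ∀ A B t → (t ∈ₛ (A ∩ˢ B) → t ∈ₛ A × t ∈ₛ B) × (t ∈ₛ A × t ∈ₛ B → t ∈ₛ (A ∩ˢ B))
    ∈-∩ A B t = (λ e → BoolP.∧-conicalˡ _ _ (trans (sym (lookup-∩ A B t)) e) , BoolP.∧-conicalʳ (lookup A t) _ (trans (sym (lookup-∩ A B t)) e))
              , (λ (a , b) → trans (lookup-∩ A B t) (cong₂ _∧_ a b))

    ∈-full : ∀ {j} (t : Fin j) → lookup (full {j}) t ≡ true
    ∈-full Fin.zero = refl
    ∈-full (Fin.suc t) = ∈-full t

    ProperStrip : Subset n → Set
    ProperStrip A = Proper A × Strip w (_∈ₛ A)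

    -- The list is kept nonempty because the empty intersection is all of I, which is not proper.
    ⋂-strip : ∀ A S → All ProperStrip (A ∷ S) → ProperStrip (⋂ (A ∷ S))
    ⋂-strip A [] ((pr , st) ∷ []) = Proper-⊆ {A} {A ∩ˢ full} pr (λ t e → proj₁ (proj₁ (∈-∩ A full t) e))
        , Strip-cong {w} (λ t e → proj₂ (∈-∩ A full t) (e , ∈-full t)) (λ t e → proj₁ (proj₁ (∈-∩ A full t) e)) st
    ⋂-strip A (B ∷ S) ((pr , st) ∷ ps) = Proper-⊆ {A} {A ∩ˢ X} pr (λ t e → proj₁ (proj₁ (∈-∩ A X t) e))
        , Strip-cong {w} (λ t → proj₂ (∈-∩ A X t)) (λ t → proj₁ (∈-∩ A X t)) (Strip-∩ {w} (_∈ₛ? A) st (proj₂ (⋂-strip B S ps)))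
      where
      X : Subset n
      X = ⋂ (B ∷ S)

    ⋂-Q : ∀ ν A S → All (λ B → Q w ν (_∈ₛ B)) (A ∷ S) → Q w ν (_∈ₛ ⋂ (A ∷ S))
    ⋂-Q ν A [] (q ∷ []) = Q-mono (λ t e → proj₂ (∈-∩ A full t) (e , ∈-full t)) q
    ⋂-Q ν A (B ∷ S) (q ∷ qs) = Q-mono (λ t → proj₂ (∈-∩ A (⋂ (B ∷ S)) t)) (Q-∩ q (⋂-Q ν B S qs))

    ⋂-Q⁻ : ∀ ν S → Q w ν (_∈ₛ ⋂ S) → All (λ B → Q w ν (_∈ₛ B)) S
    ⋂-Q⁻ ν [] q = []
    ⋂-Q⁻ ν (B ∷ S) q = Q-mono (λ t e → proj₁ (proj₁ (∈-∩ B (⋂ S) t) e)) q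
                     ∷ ⋂-Q⁻ ν S (Q-mono (λ t e → proj₂ (proj₁ (∈-∩ B (⋂ S) t) e)) q)

    ⋂-Inc : ∀ A S → All ProperStrip (A ∷ S) → Inc₀ (dword (⋂ (A ∷ S)) ++ w)
    ⋂-Inc A S ps = let (pr , st) = ⋂-strip A S ps in strip-Inc (⋂ (A ∷ S)) pr st

    ⋂-≤⇒ : ∀ ν A S → Inc₀ ν → All ProperStrip (A ∷ S) → ν ≤B (dword (⋂ (A ∷ S)) ++ w) → All (λ B → ν ≤B (dword B ++ w)) (A ∷ S)
    ⋂-≤⇒ ν A S gν ps h = let (pr , st) = ⋂-strip A S ps in
      All.zipWith (λ {B} ((prB , stB) , q) → proj₂ (strip-≤ ν B gν prB stB) q)
        (ps , ⋂-Q⁻ ν (A ∷ S) (proj₁ (strip-≤ ν (⋂ (A ∷ S)) gν pr st) h))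

    ⋂-≤⇐ : ∀ ν A S → Inc₀ ν → All ProperStrip (A ∷ S) → All (λ B → ν ≤B (dword B ++ w)) (A ∷ S) → ν ≤B (dword (⋂ (A ∷ S)) ++ w)
    ⋂-≤⇐ ν A S gν ps h = let (pr , st) = ⋂-strip A S ps in
      proj₂ (strip-≤ ν (⋂ (A ∷ S)) gν pr st) (⋂-Q ν A S (All.zipWith (λ {B} ((prB , stB) , q) → proj₁ (strip-≤ ν B gν prB stB) q) (ps , h)))

  -- Unfolded: q holds of the whole word and fails whenever one letter is omitted. Letters already
  -- passed are kept inside q, so the recursion runs parallel to that of `alt`.
  minimalᵇ : Word → (Word → Bool) → Bool
  minimalᵇ []      q = q []
  minimalᵇ (t ∷ d) q = not (q d) ∧ minimalᵇ d (q ∘ (t ∷_))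

  -- E collects the letters already passed and kept; q b decides `Q` for E together with the letters
  -- of the subword b of what remains.
  Decides : Word → Word → (I → Set) → Word → (Word → Bool) → Set
  Decides w ν E d q = ∀ b → b ⊆ d → (q b ≡ true → Q w ν (λ u → E u ⊎ u ∈ b)) × (Q w ν (λ u → E u ⊎ u ∈ b) → q b ≡ true)

  Decides-∷ : ∀ {w ν E t d q} → Decides w ν E (t ∷ d) q → Decides w ν (λ u → E u ⊎ u ≡ t) d (q ∘ (t ∷_))
  Decides-∷ {w} {ν} {E} {t} h b p = (λ e → Q-mono (λ { u (inj₁ a) → inj₁ (inj₁ a) ; u (inj₂ (here a)) → inj₁ (inj₂ a) ; u (inj₂ (there a)) → inj₂ a }) (proj₁ (h (t ∷ b) (refl ∷ p)) e))
     , (λ e → proj₂ (h (t ∷ b) (refl ∷ p)) (Q-mono (λ { u (inj₁ (inj₁ a)) → inj₁ a ; u (inj₁ (inj₂ a)) → inj₂ (here a) ; u (inj₂ a) → inj₂ (there a) }) e))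

  minimalᵇ⇒ : ∀ {w ν d} E q → CycDec d → (∀ t → t ∈ d → ¬ E t) → Decides w ν E d q → minimalᵇ d q ≡ true →
              Q w ν (λ u → E u ⊎ u ∈ d) × (∀ t → t ∈ d → ¬ Q w ν (λ u → (E u ⊎ u ∈ d) × u ≢ t))
  minimalᵇ⇒ E q [] dj h e = proj₁ (h [] []) e , λ t ()
  minimalᵇ⇒ {w} {ν} {t ∷ d} E q (cons t∉ _ c) dj h e with q d in eq
  ... | false with minimalᵇ⇒ {w} {ν} {d} (λ u → E u ⊎ u ≡ t) (q ∘ (t ∷_)) c
                   (λ { u u∈ (inj₁ a) → dj u (there u∈) a ; u u∈ (inj₂ refl) → t∉ u∈ }) (Decides-∷ {w} {ν} {E} {t} {d} {q} h) e
  ...   | q₁ , q₂ = Q-mono (λ { u (inj₁ (inj₁ a)) → inj₁ a ; u (inj₁ (inj₂ a)) → inj₂ (here a) ; u (inj₂ a) → inj₂ (there a) }) q₁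
      , λ { u (here refl) q′ → contradiction (trans (sym eq) (proj₂ (h d (t ∷ʳ Sub.⊆-refl)) (Q-mono (drop u) q′))) λ ()
          ; u (there u∈) q′ → q₂ u u∈ (Q-mono (λ { v (inj₁ a , b) → inj₁ (inj₁ a) , b ; v (inj₂ (here a) , b) → inj₁ (inj₂ a) , b ; v (inj₂ (there a) , b) → inj₂ a , b }) q′) }
    where
    drop : ∀ u v → (E v ⊎ v ∈ u ∷ d) × v ≢ u → E v ⊎ v ∈ d
    drop u v (inj₁ a , _) = inj₁ a
    drop u v (inj₂ a , b) = inj₂ (tail-∈ a b)

  ⇒minimalᵇ : ∀ {w ν d} E q → CycDec d → (∀ t → t ∈ d → ¬ E t) → Decides w ν E d q →
              Q w ν (λ u → E u ⊎ u ∈ d) × (∀ t → t ∈ d → ¬ Q w ν (λ u → (E u ⊎ u ∈ d) × u ≢ t)) → minimalᵇ d q ≡ true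
  ⇒minimalᵇ E q [] dj h (e , _) = proj₂ (h [] []) e
  ⇒minimalᵇ {w} {ν} {t ∷ d} E q (cons t∉ _ c) dj h (q₁ , q₂) with q d in eq
  ... | true = contradiction (Q-mono (λ { u (inj₁ a) → inj₁ a , (λ { refl → dj t (here refl) a }) ; u (inj₂ a) → inj₂ (there a) , λ { refl → t∉ a } })
                  (proj₁ (h d (t ∷ʳ Sub.⊆-refl)) eq)) (q₂ t (here refl))
  ... | false = ⇒minimalᵇ {w} {ν} {d} (λ u → E u ⊎ u ≡ t) (q ∘ (t ∷_)) c
                   (λ { u u∈ (inj₁ a) → dj u (there u∈) a ; u u∈ (inj₂ refl) → t∉ u∈ }) (Decides-∷ {w} {ν} {E} {t} {d} {q} h)
       (Q-mono (λ { u (inj₁ a) → inj₁ (inj₁ a) ; u (inj₂ (here a)) → inj₁ (inj₂ a) ; u (inj₂ (there a)) → inj₂ a }) q₁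
       , λ u u∈ q′ → q₂ u (there u∈) (Q-mono (λ { v (inj₁ (inj₁ a) , b) → inj₁ a , b ; v (inj₁ (inj₂ a) , b) → inj₂ (here a) , b ; v (inj₂ a , b) → inj₂ (there a) , b }) q′))

  below?-Decides : ∀ w (g : Inc₀ w) ν → Inc₀ ν → ∀ {d} → CycDec d → Decides w ν (λ _ → ⊥) d (Over.below? w g ν)
  below?-Decides w g ν gν c b p = (λ e → Q-mono (λ u a → inj₂ a) (Over.below?⇒Q w g ν (CycDec-⊆ p c) e))
     , (λ q → Over.Q⇒below? w g ν gν (CycDec-⊆ p c) (Q-mono (λ { u (inj₂ a) → a }) q))

  minimal⇒Least : ∀ w (g : Inc₀ w) ν → Inc₀ ν → ∀ A → Proper A → minimalᵇ (dword A) (Over.below? w g ν) ≡ true → Least w ν A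
  minimal⇒Least w g ν gν A pr e =
    let (q , h) = minimalᵇ⇒ {w} {ν} {dword A} (λ _ → ⊥) (Over.below? w g ν) (CycDec-dword A) (λ _ _ ()) (below?-Decides w g ν gν (CycDec-dword A)) e in Q-mono (λ { u (inj₂ a) → ∈-dword⁻ A a }) q
              , λ t t∈ q′ → h t (∈-dword⁺ A pr t∈) (Q-mono (λ u (a , b) → inj₂ (∈-dword⁺ A pr a) , b) q′)

  Least⇒minimal : ∀ w (g : Inc₀ w) ν → Inc₀ ν → ∀ A → Proper A → Least w ν A → minimalᵇ (dword A) (Over.below? w g ν) ≡ true
  Least⇒minimal w g ν gν A pr (q , h) = ⇒minimalᵇ {w} {ν} {dword A} (λ _ → ⊥) (Over.below? w g ν) (CycDec-dword A) (λ _ _ ()) (below?-Decides w g ν gν (CycDec-dword A))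
     (Q-mono (λ u a → inj₂ (∈-dword⁺ A pr a)) q
     , λ t t∈ q′ → h t (∈-dword⁻ A t∈) (Q-mono (λ { u (inj₂ a , b) → ∈-dword⁻ A a , b }) q′))

  -- Bounded partitions

  ↑-⁺ : ∀ d y → (y ↑ d) ⁺ ≡ y ⁺ ↑ d
  ↑-⁺ zero    y = refl
  ↑-⁺ (suc d) y = ↑-⁺ d (y ⁺)

  ↑-⊕ : ∀ d y j → (y ⊕ j) ↑ d ≡ (y ↑ d) ⊕ j
  ↑-⊕ zero    y j = refl
  ↑-⊕ (suc d) y j = trans (cong (_↑ d) (⊕-⁺ y j)) (↑-⊕ d (y ⁺) j)

  ⁻↑suc : ∀ d y → y ⁻ ↑ suc d ≡ y ↑ d
  ⁻↑suc d y = cong (_↑ d) (⁻⁺ y)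

  ↑-⁻ : ∀ d y → (y ↑ d) ⁻ ≡ y ⁻ ↑ d
  ↑-⁻ d y = trans (cong _⁻ (sym (trans (↑-⁺ d (y ⁻)) (⁻↑suc d y)))) (⁺⁻ (y ⁻ ↑ d))

  y<⊕1 : ∀ y → y < y ⊕ + 1
  y<⊕1 y = subst (y <_) (↑n y) (ℤP.<-≤-trans (y<y⁺ y) (≤↑ (y ⁺) (suc k')))

  r-↑-≢ : ∀ z {i j} → i ℕ.< j → j ℕ.< n → r (z ↑ i) ≢ r (z ↑ j)
  r-↑-≢ z {i} {j} i<j j<n e with r-≡⇒⊕ (z ↑ i) (z ↑ j) e
  ... | q , h = ℕP.<⇒≢ i<j (sym (proj₁ (÷n-unique {j} {i} (+ 0) q j<n (ℕP.<-trans i<j j<n) (ℤG.∙-cancelʳ z _ _ (begin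
      + j + + 0 + z           ≡⟨ cong (_+ z) (ℤP.+-identityʳ (+ j)) ⟩
      + j + z                 ≡⟨ sym (↑-def j z) ⟩
      z ↑ j                   ≡⟨ trans h (⊕-def (z ↑ i) q) ⟩
      z ↑ i + q * + n         ≡⟨ cong (_+ q * + n) (↑-def i z) ⟩
      + i + z + q * + n       ≡⟨ ℤP.+-assoc (+ i) z (q * + n) ⟩
      + i + (z + q * + n)     ≡⟨ cong (λ x → + i + x) (ℤP.+-comm z (q * + n)) ⟩
      + i + (q * + n + z)     ≡⟨ sym (ℤP.+-assoc (+ i) (q * + n) z) ⟩
      + i + q * + n + z       ∎)))))
    where open ≡-Reasoning

  ↑-cover : ∀ z y → ∃₂ λ i q → i ℕ.< n × y ≡ (z ↑ i) ⊕ q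
  ↑-cover z y = toℕ (r (y - z)) , block (y - z) , FinP.toℕ<n (r (y - z)) , (begin
      y                                  ≡⟨ sym (cancel z y) ⟩
      z + (y - z)                        ≡⟨ cong (λ x → z + x) (÷n (y - z)) ⟩
      z + (+ i + q * + n)                ≡⟨ sym (ℤP.+-assoc z (+ i) (q * + n)) ⟩
      z + + i + q * + n                  ≡⟨ cong (_+ q * + n) (trans (ℤP.+-comm z (+ i)) (sym (↑-def i z))) ⟩
      z ↑ i + q * + n                    ≡⟨ sym (⊕-def (z ↑ i) q) ⟩
      (z ↑ i) ⊕ q                        ∎)
    where
    open ≡-Reasoning
    i : ℕ
    i = toℕ (r (y - z))
    q : ℤ
    q = block (y - z)

  -- As a permutation this is a cycle on each translate of the window: z goes to z + a, and z + 1,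
  -- ..., z + a each go down by one.
  rowAt : ℤ → ℕ → Word
  rowAt z zero    = []
  rowAt z (suc a) = r (z ↑ a) ∷ rowAt z a

  -- wλ with the first row starting at residue z.
  rowsAt : ℤ → List ℕ → Word
  rowsAt z []       = []
  rowsAt z (a ∷ as) = rowsAt (z ⁻) as ++ rowAt z a

  row-top : ∀ z a → act (rowAt z a) z ≡ z ↑ a
  row-top z zero    = refl
  row-top z (suc a) = trans (cong (s (r (z ↑ a))) (row-top z a)) (trans (s-lo refl) (↑-⁺ a z))

  s-fix : ∀ z {i j} → j ℕ.< i → suc i ℕ.< n → s (r (z ↑ i)) (z ↑ j) ≡ z ↑ j
  s-fix z {i} {j} j<i i<n = s-off (r-↑-≢ z j<i (ℕP.<-trans (ℕP.n<1+n i) i<n))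
    (λ e → r-↑-≢ (z ⁻) (ℕP.m≤n⇒m≤1+n j<i) i<n (trans (cong r (sym (↑-⁻ j z))) (trans e (cong r (sym (⁻↑suc i z))))))

  s-fix′ : ∀ z {i j} → suc i ℕ.< j → j ℕ.< n → s (r (z ↑ i)) (z ↑ j) ≡ z ↑ j
  s-fix′ z {i} {suc j} (s≤s i<j) j<n = s-off (λ e → r-↑-≢ z (ℕP.m≤n⇒m≤1+n i<j) j<n (sym e))
    (λ e → r-↑-≢ z i<j (ℕP.<-trans (ℕP.n<1+n j) j<n) (sym (trans (cong r (sym (trans (cong _⁻ (sym (↑-⁺ j z))) (⁺⁻ (z ↑ j))))) e)))

  row-hi : ∀ z a {j} → a ℕ.< j → j ℕ.< n → act (rowAt z a) (z ↑ j) ≡ z ↑ j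
  row-hi z zero    _ _ = refl
  row-hi z (suc a) a<j j<n = trans (cong (s (r (z ↑ a))) (row-hi z a (ℕP.<-trans (ℕP.n<1+n a) a<j) j<n)) (s-fix′ z a<j j<n)

  row-lo : ∀ z a {j} → j ℕ.< a → a ℕ.< n → act (rowAt z a) (z ↑ suc j) ≡ z ↑ j
  row-lo z (suc a) {j} j<a a<n with ℕP.m≤n⇒m<n∨m≡n (ℕ.s≤s⁻¹ j<a)
  ... | inj₁ j<a′ = trans (cong (s (r (z ↑ a))) (row-lo z a j<a′ (ℕP.<-trans (ℕP.n<1+n a) a<n))) (s-fix z j<a′ a<n)
  ... | inj₂ refl = trans (cong (s (r (z ↑ a))) (trans (row-hi z a ℕP.≤-refl a<n) (sym (↑-⁺ a z)))) (s-⁺ refl)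

  -- The condition `Inc (r z)` on the single window z + 1, ..., z + n, the form in which a row can
  -- be appended explicitly.
  IncAbove : ℤ → Word → Set
  IncAbove z w = ∀ j → suc j ℕ.< n → act w (z ↑ suc j) < act w (z ↑ suc (suc j))

  Inc⇒IncAbove : ∀ z w → Inc (r z) w → IncAbove z w
  Inc⇒IncAbove z w g j j<n = subst (λ y → act w (z ↑ suc j) < act w y) (↑-⁺ (suc j) z)
    (g (z ↑ suc j) (λ e → r-↑-≢ z {0} {suc j} (s≤s z≤n) j<n (sym e)))

  IncAbove⇒Inc : ∀ z w → IncAbove z w → Inc (r z) w
  IncAbove⇒Inc z w h y ¬e with ↑-cover z y
  ... | zero  , q , _ , refl = contradiction (r-⊕ z q) ¬e
  ... | suc i , q , i<n , refl = subst₂ _<_ (sym (act-⊕ w (z ↑ suc i) q))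
      (trans (sym (act-⊕ w (z ↑ suc (suc i)) q)) (cong (act w) (trans (cong (_⊕ q) (sym (↑-⁺ (suc i) z))) (sym (⊕-⁺ (z ↑ suc i) q)))))
      (⊕-mono-< q (h i i<n))

  -- Written from z⁻: u increases on z, z + 1, …, z + k.
  module _ {z u} (g : IncAbove (z ⁻) u) where
    inc-step : ∀ j → suc j ℕ.< n → act u (z ↑ j) < act u (z ↑ suc j)
    inc-step j p = subst₂ (λ a b → act u a < act u b) (⁻↑suc j z) (⁻↑suc (suc j) z) (g j p)

    inc-< : ∀ {i j} → i ℕ.< j → j ℕ.< n → act u (z ↑ i) < act u (z ↑ j)
    inc-< {i} {suc j} i<j j<n with ℕP.m≤n⇒m<n∨m≡n (ℕ.s≤s⁻¹ i<j)
    ... | inj₂ refl = inc-step j j<n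
    ... | inj₁ p = ℤP.<-trans (inc-< p (ℕP.<-trans (ℕP.n<1+n j) j<n)) (inc-step j j<n)

  inc-≤ᵏ : ∀ {z w} → IncAbove z w → ∀ {i j} → i ℕ.≤ j → suc j ℕ.≤ n → act w (z ↑ suc i) ≤ act w (z ↑ suc j)
  inc-≤ᵏ {z} {w} g {i} {j} i≤j p with ℕP.m≤n⇒m<n∨m≡n i≤j
  ... | inj₂ refl = ℤP.≤-refl
  inc-≤ᵏ {z} {w} g {i} {suc j} i≤j p | inj₁ q = ℤP.≤-trans (inc-≤ᵏ {z} {w} g {i} {j} (ℕ.s≤s⁻¹ q) (ℕP.≤-trans (ℕP.n≤1+n _) p)) (ℤP.<⇒≤ (g j p))

  -- a is the length of the row at z read off from the values of w.
  Part : Word → ℤ → ℕ → Set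
  Part w z a = (∀ j → j ℕ.< a → act w (z ↑ suc j) < act w z) × (∀ j → a ℕ.≤ j → suc j ℕ.< n → act w z < act w (z ↑ suc j))

  Part-unique : ∀ {w z a b} → a ℕ.< n → b ℕ.< n → Part w z a → Part w z b → a ≡ b
  Part-unique {a = a} {b} a<n b<n (p , q) (p′ , q′) with ℕP.<-cmp a b
  ... | tri≈ _ e _ = e
  ... | tri< l _ _ = contradiction (p′ a l) (ℤP.<-asym (q a ℕP.≤-refl (ℕP.≤-<-trans l b<n)))
  ... | tri> _ _ l = contradiction (p b l) (ℤP.<-asym (q′ b ℕP.≤-refl (ℕP.≤-<-trans l a<n)))

  Part-cong : ∀ {u v z a} → u ~ v → Part u z a → Part v z a
  Part-cong {u} {v} e (p , q) = (λ j l → subst₂ _<_ (~⇒act u v e _) (~⇒act u v e _) (p j l))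
                              , (λ j l l′ → subst₂ _<_ (~⇒act u v e _) (~⇒act u v e _) (q j l l′))

  -- Appending the row takes the entry at z + a out of the increasing sequence u(z), ..., u(z + k)
  -- and, seen on z + 1, ..., z + n, puts it back at the end, raised by n. `Fit` is the one new
  -- inequality. As u(z + k) = u(z - 1) + n, it amounts to the next row of the partition being at
  -- most a.
  module AddRow (u w : Word) (z : ℤ) (a : ℕ) (a<n : a ℕ.< n) (w≡ : ∀ y → act w y ≡ act u (act (rowAt z a) y)) where
    top : act w z ≡ act u (z ↑ a)
    top = trans (w≡ z) (cong (act u) (row-top z a))

    lo′ : ∀ {j} → j ℕ.< a → act w (z ↑ suc j) ≡ act u (z ↑ j)
    lo′ j<a = trans (w≡ _) (cong (act u) (row-lo z a j<a a<n))

    hi′ : ∀ {j} → a ℕ.< j → j ℕ.< n → act w (z ↑ j) ≡ act u (z ↑ j)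
    hi′ a<j j<n = trans (w≡ _) (cong (act u) (row-hi z a a<j j<n))

    wrap : act w (z ↑ n) ≡ act u (z ↑ a) ⊕ + 1
    wrap = trans (cong (act w) (↑n z)) (trans (act-⊕ w z (+ 1)) (cong (_⊕ + 1) top))

    Fit : Set
    Fit = act u (z ↑ suc k') < act u (z ↑ a) ⊕ + 1

    part : IncAbove (z ⁻) u → Part w z a
    part g = (λ j l → subst₂ _<_ (sym (lo′ l)) (sym top) (inc-< {z} {u} g l a<n))
           , (λ j l l′ → subst₂ _<_ (sym top) (sym (hi′ (s≤s l) l′)) (inc-< {z} {u} g (s≤s l) l′))

    next-value : ∀ j → j ℕ.≤ suc k' → IncAbove (z ⁻) u → Fit → ∀ {v} → v < act u (z ↑ suc k') ⊎ v ≡ act u (z ↑ suc k') → (suc j ℕ.< n → v < act u (z ↑ suc j)) → a ℕ.≤ j → v < act w (z ↑ suc j)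
    next-value j j≤k g f {v} v≤ h a≤j with ℕP.m≤n⇒m<n∨m≡n j≤k
    ... | inj₁ l = subst (v <_) (sym (hi′ (s≤s a≤j) (s≤s l))) (h (s≤s l))
    ... | inj₂ refl = subst (v <_) (sym wrap) (lemma v≤)
      where
      lemma : v < act u (z ↑ suc k') ⊎ v ≡ act u (z ↑ suc k') → v < act u (z ↑ a) ⊕ + 1
      lemma (inj₁ p) = ℤP.<-trans p f
      lemma (inj₂ refl) = f

    incAbove : IncAbove (z ⁻) u → Fit → IncAbove z w
    incAbove g f j j<n with ℕP.<-cmp (suc j) a
    ... | tri< l _ _ = subst₂ _<_ (sym (lo′ (ℕP.<-trans (ℕP.n<1+n j) l))) (sym (lo′ l)) (inc-step {z} {u} g j j<n)
    ... | tri≈ _ refl _ = subst (_< act w (z ↑ suc (suc j))) (sym (lo′ ℕP.≤-refl))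
            (next-value (suc j) (ℕ.s≤s⁻¹ j<n) g f (inj₁ (inc-< {z} {u} g (ℕ.s≤s⁻¹ j<n) ℕP.≤-refl))
               (λ l → inc-< {z} {u} g (ℕP.m≤n⇒m≤1+n ℕP.≤-refl) l) ℕP.≤-refl)
    ... | tri> _ _ l = subst (_< act w (z ↑ suc (suc j))) (sym (hi′ l j<n))
            (next-value (suc j) (ℕ.s≤s⁻¹ j<n) g f v≤ (λ l′ → inc-step {z} {u} g (suc j) l′) (ℕP.<⇒≤ l))
      where
      v≤ : act u (z ↑ suc j) < act u (z ↑ suc k') ⊎ act u (z ↑ suc j) ≡ act u (z ↑ suc k')
      v≤ with ℕP.m≤n⇒m<n∨m≡n (ℕ.s≤s⁻¹ j<n)
      ... | inj₁ p = inj₁ (inc-< {z} {u} g p ℕP.≤-refl)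
      ... | inj₂ refl = inj₂ refl

    z⁻⊕1 : act u (z ↑ suc k') ≡ act u (z ⁻) ⊕ + 1
    z⁻⊕1 = trans (cong (act u) (trans (sym (⁻↑suc (suc k') z)) (↑n (z ⁻)))) (act-⊕ u (z ⁻) (+ 1))

    fit : ∀ {b} → Part u (z ⁻) b → b ℕ.≤ a → Fit
    fit {b} (_ , q) b≤a with ℕP.m≤n⇒m<n∨m≡n (ℕ.s≤s⁻¹ a<n)
    ... | inj₂ refl = y<⊕1 (act u (z ↑ a))
    ... | inj₁ l = subst (_< act u (z ↑ a) ⊕ + 1) (sym z⁻⊕1)
          (⊕-mono-< (+ 1) (subst (λ y → act u (z ⁻) < act u y) (⁻↑suc a z) (q a b≤a (s≤s l))))

    fit⁻¹ : ∀ {b} → b ℕ.≤ suc k' → Part u (z ⁻) b → IncAbove z w → b ℕ.≤ a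
    fit⁻¹ {b} b≤k (p , _) g with ℕP.m≤n⇒m<n∨m≡n (ℕ.s≤s⁻¹ a<n) | b ℕP.≤? a
    ... | _ | yes l = l
    ... | inj₂ refl | no _ = b≤k
    ... | inj₁ l | no ¬l = contradiction (p a (ℕP.≰⇒> ¬l)) (ℤP.<-asym (subst (λ y → act u (z ⁻) < act u y) (sym (⁻↑suc a z))
            (⊕-cancel-< (+ 1) (subst₂ _<_ (trans (hi′ l ℕP.≤-refl) z⁻⊕1) wrap (g k' ℕP.≤-refl)))))

    incAbove⁻¹ : IncAbove z w → Part w z a → IncAbove (z ⁻) u
    incAbove⁻¹ g (p , q) j j<n = subst₂ (λ x y → act u x < act u y) (sym (⁻↑suc j z)) (sym (⁻↑suc (suc j) z)) cases
      where
      cases : act u (z ↑ j) < act u (z ↑ suc j)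
      cases with ℕP.<-cmp j a
      ... | tri≈ _ refl _ = subst₂ _<_ top (hi′ ℕP.≤-refl j<n) (q j ℕP.≤-refl j<n)
      ... | tri> _ _ l = subst₂ _<_ (hi′ l (ℕP.<-trans (ℕP.n<1+n j) j<n)) (hi′ (ℕP.m≤n⇒m≤1+n l) j<n) (step-at j l j<n)
        where
        step-at : ∀ j → a ℕ.< j → suc j ℕ.< n → act w (z ↑ j) < act w (z ↑ suc j)
        step-at (suc j) _ l = g j (ℕP.<-trans (ℕP.n<1+n _) l)
      ... | tri< l _ _ with ℕP.m≤n⇒m<n∨m≡n l
      ...   | inj₁ l′ = subst₂ _<_ (lo′ l) (lo′ l′) (g j j<n)
      ...   | inj₂ refl = subst₂ _<_ (lo′ l) top (p j l)

  len-row : ∀ a u z → a ℕ.< n → (∀ j → j ℕ.< a → act u (z ↑ j) < act u (z ↑ a)) → len (u ++ rowAt z a) ≡ len u ℕ.+ a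
  len-row zero u z _ h = trans (cong len (ListP.++-identityʳ u)) (sym (ℕP.+-identityʳ (len u)))
  len-row (suc a) u z a<n h = begin
    len (u ++ r (z ↑ a) ∷ rowAt z a)          ≡⟨ cong len (sym (ListP.++-assoc u [ r (z ↑ a) ] (rowAt z a))) ⟩
    len ((u ++ [ r (z ↑ a) ]) ++ rowAt z a)   ≡⟨ len-row a (u ++ [ r (z ↑ a) ]) z (ℕP.<-trans (ℕP.n<1+n a) a<n) h′ ⟩
    len (u ++ [ r (z ↑ a) ]) ℕ.+ a            ≡⟨ cong (ℕ._+ a) (ascentʳ u (z ↑ a) (subst (λ y → act u (z ↑ a) < act u y) (sym (↑-⁺ a z)) (h a ℕP.≤-refl))) ⟩
    suc (len u ℕ.+ a)                         ≡⟨ sym (ℕP.+-suc (len u) a) ⟩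
    len u ℕ.+ suc a                           ∎
    where
    open ≡-Reasoning
    h′ : ∀ j → j ℕ.< a → act (u ++ [ r (z ↑ a) ]) (z ↑ j) < act (u ++ [ r (z ↑ a) ]) (z ↑ a)
    h′ j j<a = subst₂ _<_ (sym (trans (act-++ u [ r (z ↑ a) ] (z ↑ j)) (cong (act u) (s-fix z j<a a<n))))
        (sym (trans (act-++ u [ r (z ↑ a) ] (z ↑ a)) (cong (act u) (trans (s-lo refl) (↑-⁺ a z)))))
        (h j (ℕP.m≤n⇒m≤1+n j<a))

  head₀ : List ℕ → ℕ
  head₀ []      = 0
  head₀ (a ∷ _) = a

  size : List ℕ → ℕ
  size = foldr ℕ._+_ 0

  IsPk-tail : ∀ {a as} → IsPk (suc k') (a ∷ as) → IsPk (suc k') as × 1 ℕ.≤ a × a ℕ.≤ suc k' × head₀ as ℕ.≤ a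
  IsPk-tail ((a≤ , a≥) ∷ [] , [-]) = ([] , []) , a≤ , a≥ , z≤n
  IsPk-tail ((a≤ , a≥) ∷ ps , p ∷ l) = (ps , l) , a≤ , a≥ , p

  IsPk-cons : ∀ {a as} → 1 ℕ.≤ a → a ℕ.≤ suc k' → head₀ as ℕ.≤ a → IsPk (suc k') as → IsPk (suc k') (a ∷ as)
  IsPk-cons p q h (ps , []) = (p , q) ∷ ps , [-]
  IsPk-cons p q h (ps , [-]) = (p , q) ∷ ps , h ∷ [-]
  IsPk-cons p q h (ps , l@(_ ∷ _)) = (p , q) ∷ ps , h ∷ l

  head₀≤ : ∀ {as} → IsPk (suc k') as → head₀ as ℕ.≤ suc k'
  head₀≤ ([] , _) = z≤n
  head₀≤ ((_ , p) ∷ _ , _) = p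

  z<↑suc : ∀ z j → z < z ↑ suc j
  z<↑suc z j = ℤP.<-≤-trans (y<y⁺ z) (≤↑ (z ⁺) j)

  Part-[] : ∀ z → Part [] z 0
  Part-[] z = (λ j ()) , (λ j _ _ → z<↑suc z j)

  rows : ∀ z as → IsPk (suc k') as → IncAbove z (rowsAt z as) × Part (rowsAt z as) z (head₀ as) × len (rowsAt z as) ≡ size as
  rows z [] _ = (λ j _ → subst (z ↑ suc j <_) (↑-⁺ (suc j) z) (y<y⁺ _)) , Part-[] z , ℕP.n≤0⇒n≡0 (len≤length [])
  rows z (a ∷ as) pk =
    let (pk′ , 1≤a , a≤k , h≤a) = IsPk-tail pk
        (g , p , l) = rows (z ⁻) as pk′
        u = rowsAt (z ⁻) as
        module A = AddRow u (u ++ rowAt z a) z a (s≤s a≤k) (act-++ u (rowAt z a))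
    in A.incAbove g (A.fit p h≤a) , A.part g ,
       trans (len-row a u z (s≤s a≤k) (λ j j<a → inc-< {z} {u} g j<a (s≤s a≤k))) (trans (ℕP.+-comm (len u) a) (cong (a ℕ.+_) l))

  part-exists : ∀ w z → IncAbove z w → ∀ j → j ℕ.< n →
                ∃ λ a → a ℕ.≤ j × (∀ i → i ℕ.< a → act w (z ↑ suc i) < act w z) × (∀ i → a ℕ.≤ i → i ℕ.< j → act w z < act w (z ↑ suc i))
  part-exists w z g zero _ = 0 , z≤n , (λ i ()) , (λ i _ ())
  part-exists w z g (suc j) j<n with part-exists w z g j (ℕP.<-trans (ℕP.n<1+n j) j<n) | ℤP.<-cmp (act w z) (act w (z ↑ suc j))
  ... | a , a≤j , p , q | tri< l _ _ = a , ℕP.m≤n⇒m≤1+n a≤j , p , q′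
    where
    q′ : ∀ i → a ℕ.≤ i → i ℕ.< suc j → act w z < act w (z ↑ suc i)
    q′ i a≤i i≤j with ℕP.m≤n⇒m<n∨m≡n (ℕ.s≤s⁻¹ i≤j)
    ... | inj₁ i<j = q i a≤i i<j
    ... | inj₂ refl = l
  ... | a , _ | tri≈ _ e _ = contradiction (act-inj w e) (ℤP.<⇒≢ (z<↑suc z j))
  ... | a , _ | tri> _ _ l = suc j , ℕP.≤-refl
      , (λ i i≤j → ℤP.≤-<-trans (inc-≤ᵏ {z} {w} g (ℕ.s≤s⁻¹ i≤j) (ℕP.<⇒≤ j<n)) l)
      , (λ i j<i i<j → contradiction (ℕP.<-≤-trans i<j j<i) (ℕP.<-irrefl refl))

  ascending⇒len≡0 : ∀ w → (∀ y → act w y < act w (y ⁺)) → len w ≡ 0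
  ascending⇒len≡0 w h = trans (sym (len-reverse w)) (zero-len (len (reverse w)) refl)
    where
    zero-len : ∀ L → len (reverse w) ≡ L → len (reverse w) ≡ 0
    zero-len zero e = e
    zero-len (suc L) e with has-descent (reverse w) L e
    ... | y , p = contradiction (subst₂ _<_ (ia-reverse w (y ⁺)) (ia-reverse w y) p) (ℤP.<-asym (h y))

  unrow : ∀ w z a y → act w y ≡ act (w ++ reverse (rowAt z a)) (act (rowAt z a) y)
  unrow w z a y = sym (trans (act-++ w (reverse (rowAt z a)) _) (cong (act w)
     (trans (sym (ia-reverse (reverse (rowAt z a)) (act (rowAt z a) y)))
       (trans (cong (λ v → ia v (act (rowAt z a) y)) (ListP.reverse-involutive (rowAt z a))) (ia-act (rowAt z a) y)))))

  -- The first row has as many cells as there are entries at z + 1, ..., z + k smaller than w(z).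
  -- Undoing it lowers the length by that number, so the bound L serves as the measure.
  rows-surj : ∀ L w z → len w ℕ.≤ L → IncAbove z w →
              ∃ λ as → IsPk (suc k') as × rowsAt z as ~ w × Part w z (head₀ as)
  rows-surj L w z lw g with part-exists w z g (suc k') ℕP.≤-refl
  -- If no entry is smaller than w(z), then w increases at residue r z as well, hence everywhere,
  -- and is the identity.
  ... | zero , _ , p , q = [] , ([] , []) , ~-sym (len≡0⇒~[] w (ascending⇒len≡0 w asc)) , (p , λ j l l′ → q j l (ℕ.s≤s⁻¹ l′))
    where
    asc : ∀ y → act w y < act w (y ⁺)
    asc y with r y FinP.≟ r z
    ... | no ¬e = IncAbove⇒Inc z w g y ¬e
    ... | yes e with r-≡⇒⊕ z y (sym e)
    ...   | j , refl = subst₂ _<_ (sym (act-⊕ w z j)) (trans (sym (act-⊕ w (z ⁺) j)) (cong (act w) (sym (⊕-⁺ z j))))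
                         (⊕-mono-< j (q 0 z≤n (s≤s z≤n)))
  rows-surj zero w z lw g | suc a , a≤k , p , q = contradiction (ℕP.n≤0⇒n≡0 lw) (λ e → ℕP.1+n≢0 (trans (sym (ℕP.+-suc (len u) a)) (trans (sym l) e)))
    where
    u : Word
    u = w ++ reverse (rowAt z (suc a))
    module A = AddRow u w z (suc a) (s≤s a≤k) (unrow w z (suc a))
    l : len w ≡ len u ℕ.+ suc a
    l = trans (len-cong w (u ++ rowAt z (suc a)) (act⇒~ w (u ++ rowAt z (suc a)) (λ y → trans (unrow w z (suc a) y) (sym (act-++ u (rowAt z (suc a)) y)))))
          (len-row (suc a) u z (s≤s a≤k) (λ j j<a → inc-< {z} {u} (A.incAbove⁻¹ g (p , λ j l l′ → q j l (ℕ.s≤s⁻¹ l′))) j<a (s≤s a≤k)))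
  rows-surj (suc L) w z lw g | suc a , a≤k , p , q =
      let (as , pk , e , pt) = rows-surj L u (z ⁻) (ℕ.s≤s⁻¹ (ℕP.≤-trans (ℕP.≤-trans (s≤s (ℕP.m≤m+n (len u) a)) (ℕP.≤-reflexive (trans (sym (ℕP.+-suc (len u) a)) (sym l)))) lw)) gu
      in suc a ∷ as , IsPk-cons (s≤s z≤n) a≤k (A.fit⁻¹ (head₀≤ pk) pt g) pk
         , ~-trans (~-++ e ~-refl) (~-sym w~)
         , part-w
    where
    u : Word
    u = w ++ reverse (rowAt z (suc a))
    module A = AddRow u w z (suc a) (s≤s a≤k) (unrow w z (suc a))
    part-w : Part w z (suc a)
    part-w = p , λ j l l′ → q j l (ℕ.s≤s⁻¹ l′)
    gu : IncAbove (z ⁻) u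
    gu = A.incAbove⁻¹ g part-w
    w~ : w ~ (u ++ rowAt z (suc a))
    w~ = act⇒~ w (u ++ rowAt z (suc a)) (λ y → trans (unrow w z (suc a) y) (sym (act-++ u (rowAt z (suc a)) y)))
    l : len w ≡ len u ℕ.+ suc a
    l = trans (len-cong w (u ++ rowAt z (suc a)) w~) (len-row (suc a) u z (s≤s a≤k) (λ j j<a → inc-< {z} {u} gu j<a (s≤s a≤k)))

  rows-inj : ∀ z as bs → IsPk (suc k') as → IsPk (suc k') bs → rowsAt z as ~ rowsAt z bs → as ≡ bs
  rows-inj z as bs pa pb e with Part-unique {rowsAt z bs} {z} (s≤s (head₀≤ pa)) (s≤s (head₀≤ pb))
        (Part-cong {rowsAt z as} {rowsAt z bs} {z} e (proj₁ (proj₂ (rows z as pa)))) (proj₁ (proj₂ (rows z bs pb)))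
  rows-inj z [] [] pa pb e | _ = refl
  rows-inj z [] (b ∷ bs) pa pb e | refl = contradiction (proj₁ (proj₂ (IsPk-tail pb))) λ ()
  rows-inj z (a ∷ as) [] pa pb e | refl = contradiction (proj₁ (proj₂ (IsPk-tail pa))) λ ()
  rows-inj z (a ∷ as) (.a ∷ bs) pa pb e | refl = cong (a ∷_) (rows-inj (z ⁻) as bs (proj₁ (IsPk-tail pa)) (proj₁ (IsPk-tail pb))
     (act⇒~ (rowsAt (z ⁻) as) (rowsAt (z ⁻) bs) λ y → subst (λ x → act (rowsAt (z ⁻) as) x ≡ act (rowsAt (z ⁻) bs) x) (act-ia (rowAt z a) y)
        (trans (sym (act-++ (rowsAt (z ⁻) as) (rowAt z a) _)) (trans (~⇒act (rowsAt z (a ∷ as)) (rowsAt z (a ∷ bs)) e _) (act-++ (rowsAt (z ⁻) bs) (rowAt z a) _)))))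

  -- Unification recovers the local function build of wλ, with the last row kept apart.
  mutual
    build-rows : ∀ k → List ℕ → ℕ → List ℕ → ℕ → ℕ → List (Fin (suc k))
    build-rows = _
    wλ-build : ∀ k a as → Aff.wλ k (a ∷ as) ≡ build-rows k (a ∷ as) 2 as 1 a
    wλ-build k a as with a ∷ as | 1 | 2
    ... | lam | i | j = refl

  ↓-⁻ : ∀ d y → (y ↓ d) ⁻ ≡ y ⁻ ↓ d
  ↓-⁻ zero    y = refl
  ↓-⁻ (suc d) y = ↓-⁻ d (y ⁻)

  -- Multiplication by k stands for the sign, as k = n - 1: the summand k i is i steps down together
  -- with a translation by i blocks.
  res-r : ∀ i t → res i (suc t) ≡ r ((+ 1 ↓ i) ↑ t)
  res-r i t = trans (mod-r (suc t ℕ.+ suc k' ℕ.* i)) (trans (cong r eq) (r-⊕ _ (+ i)))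
    where
    open ≡-Reasoning
    c : ℤ
    c = + 1 ↓ i
    eq : + (suc t ℕ.+ suc k' ℕ.* i) ≡ (c ↑ t) ⊕ + i
    eq = begin
      + (suc t ℕ.+ suc k' ℕ.* i)              ≡⟨ cong (λ x → + (suc t ℕ.+ x)) (ℕP.*-comm (suc k') i) ⟩
      + (suc t ℕ.+ i ℕ.* suc k')              ≡⟨ cong (λ x → + (x ℕ.+ i ℕ.* suc k')) (ℕP.+-comm 1 t) ⟩
      + t + + 1 + + (i ℕ.* suc k')            ≡⟨ cong (λ x → + t + x + + (i ℕ.* suc k')) (trans (↓-def i (+ 1)) (ℤP.+-comm (+ i) c)) ⟩
      + t + (c + + i) + + (i ℕ.* suc k')      ≡⟨ cong (_+ + (i ℕ.* suc k')) (sym (ℤP.+-assoc (+ t) c (+ i))) ⟩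
      + t + c + + i + + (i ℕ.* suc k')        ≡⟨ ℤP.+-assoc (+ t + c) (+ i) _ ⟩
      + t + c + + (i ℕ.+ i ℕ.* suc k')        ≡⟨ cong₂ _+_ (sym (↑-def t c)) (trans (cong +_ (sym (ℕP.*-suc i (suc k')))) (ℤP.pos-* i n)) ⟩
      (c ↑ t) + + i * + n                     ≡⟨ sym (⊕-def (c ↑ t) (+ i)) ⟩
      (c ↑ t) ⊕ + i                           ∎

  row-rowAt : ∀ i a → map (λ t → res i (suc t)) (downFrom a) ≡ rowAt (+ 1 ↓ i) a
  row-rowAt i zero = refl
  row-rowAt i (suc a) = cong₂ _∷_ (res-r i a) (row-rowAt i a)

  build-rowsAt : ∀ lam j as i a → build-rows (suc k') lam j as i a ≡ rowsAt (+ 1 ↓ j) as ++ rowAt (+ 1 ↓ i) a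
  build-rowsAt lam j [] i a = row-rowAt i a
  build-rowsAt lam j (b ∷ as) i a = cong₂ _++_ (trans (build-rowsAt lam (suc j) as j b) (cong (λ z → rowsAt z as ++ rowAt (+ 1 ↓ j) b) (sym (↓-⁻ j (+ 1)))))
                                               (row-rowAt i a)

  wλ-rowsAt : ∀ as → wλ as ≡ rowsAt (+ 0) as
  wλ-rowsAt [] = refl
  wλ-rowsAt (a ∷ as) = trans (wλ-build (suc k') a as) (trans (build-rowsAt (a ∷ as) 2 as 1 a) (cong (λ z → rowsAt (z ⁻) as ++ rowAt z a) (+suc 0)))

  r0 : r (+ 0) ≡ Fin.zero
  r0 = FinP.toℕ-injective (r-+ 0 (s≤s z≤n))

  wλ-Inc : ∀ as → IsPk (suc k') as → Inc₀ (wλ as)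
  wλ-Inc as pk = subst₂ Inc r0 (sym (wλ-rowsAt as)) (IncAbove⇒Inc (+ 0) (rowsAt (+ 0) as) (proj₁ (rows (+ 0) as pk)))

  len-wλ : ∀ as → IsPk (suc k') as → len (wλ as) ≡ size as
  len-wλ as pk = trans (cong len (wλ-rowsAt as)) (proj₂ (proj₂ (rows (+ 0) as pk)))

  wλ-surj : ∀ w → Inc₀ w → ∃ λ as → IsPk (suc k') as × wλ as ~ w
  wλ-surj w g = let (as , pk , e , _) = rows-surj (len w) w (+ 0) ℕP.≤-refl (Inc⇒IncAbove (+ 0) w (subst (λ c → Inc c w) (sym r0) g))
                in as , pk , subst (_~ w) (sym (wλ-rowsAt as)) e

  wλ-inj : ∀ as bs → IsPk (suc k') as → IsPk (suc k') bs → wλ as ~ wλ bs → as ≡ bs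
  wλ-inj as bs pa pb e = rows-inj (+ 0) as bs pa pb (subst₂ _~_ (wλ-rowsAt as) (wλ-rowsAt bs) e)

  -- Enumerations and finite sums

  Unique-concatMap : ∀ {a b} {A : Set a} {B : Set b} (f : A → List B) {xs} → Unique xs → (∀ {x} → x ∈ xs → Unique (f x)) →
                     (∀ {x y z} → x ∈ xs → y ∈ xs → z ∈ f x → z ∈ f y → x ≡ y) → Unique (concatMap f xs)
  Unique-concatMap f {[]} _ _ _ = []
  Unique-concatMap f {x ∷ xs} (x∉ ∷ u) h d = UniqueP.++⁺ (h (here refl)) (Unique-concatMap f u (h ∘ there) (λ p q → d (there p) (there q))) disjoint
    where
    disjoint : Disjoint (f x) (concatMap f xs)
    disjoint (p , q) with find (MemP.∈-concatMap⁻ f {xs = xs} q)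
    ... | y , y∈ , r′ = contradiction (d (here refl) (there y∈) p r′) (All.lookup x∉ y∈)

  IsPk-weaken : ∀ {a b xs} → a ℕ.≤ b → IsPk a xs → IsPk b xs
  IsPk-weaken a≤b (ps , l) = All.map (λ (p , q) → p , ℕP.≤-trans q a≤b) ps , l

  IsPk-∷ : ∀ {a b xs} → 1 ℕ.≤ a → a ℕ.≤ b → IsPk a xs → IsPk b (a ∷ xs)
  IsPk-∷ p q ([] , []) = (p , q) ∷ [] , [-]
  IsPk-∷ p q h@((_ , y≤a) ∷ _ , l) = (p , q) ∷ proj₁ (IsPk-weaken q h) , y≤a ∷ l

  IsPk-∷⁻ : ∀ {b a xs} → IsPk b (a ∷ xs) → 1 ℕ.≤ a × a ℕ.≤ b × IsPk a xs
  IsPk-∷⁻ ((p , q) ∷ [] , [-]) = p , q , ([] , [])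
  IsPk-∷⁻ {b} {a} ((p , q) ∷ ps@((1≤y , _) ∷ _) , y≤a ∷ l) with IsPk-∷⁻ {b} (ps , l)
  ... | _ , _ , h = p , q , ((1≤y , y≤a) ∷ proj₁ (IsPk-weaken y≤a h) , l)

  ptnsF-sound : ∀ f N b {xs} → xs ∈ ptnsF f N b → IsPk b xs × size xs ≡ N
  ptnsF-sound f zero b (here refl) = ([] , []) , refl
  ptnsF-sound (suc f) (suc N) b p with find (MemP.∈-concatMap⁻ (λ a → map (suc a ∷_) (ptnsF f (N ∸ a) (suc a))) {xs = filterᵇ (λ a → suc a ≤ᵇ b) (upTo (suc N))} p)
  ... | a , a∈ , q with MemP.∈-map⁻ (suc a ∷_) q | ∈-filterᵇ⁻ (λ a → suc a ≤ᵇ b) {a} {upTo (suc N)} a∈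
  ...   | ys , ys∈ , refl | a∈′ , a≤b with ptnsF-sound f (N ∸ a) (suc a) ys∈
  ...     | pk , sz = IsPk-∷ (s≤s z≤n) (ℕP.≤ᵇ⇒≤ (suc a) b a≤b) pk ,
             cong suc (trans (cong (a ℕ.+_) sz) (ℕP.m+[n∸m]≡n (ℕ.s≤s⁻¹ (MemP.∈-upTo⁻ a∈′))))

  ptnsF-complete : ∀ f N b xs → N ℕ.≤ f → IsPk b xs → size xs ≡ N → xs ∈ ptnsF f N b
  ptnsF-complete f N b [] _ _ refl = here refl
  ptnsF-complete f N b (zero ∷ ys) _ pk _ = contradiction (proj₁ (IsPk-∷⁻ pk)) λ ()
  ptnsF-complete (suc f) .(suc (a ℕ.+ size ys)) b (suc a ∷ ys) (s≤s N≤f) pk refl =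
    MemP.∈-concatMap⁺ (λ a′ → map (suc a′ ∷_) (ptnsF f (a ℕ.+ size ys ∸ a′) (suc a′))) {xs = filterᵇ (λ a → suc a ≤ᵇ b) (upTo (suc (a ℕ.+ size ys)))}
      (lose (∈-filterᵇ⁺ (λ a → suc a ≤ᵇ b) (MemP.∈-upTo⁺ (s≤s (ℕP.m≤m+n a (size ys)))) (ℕP.≤⇒≤ᵇ (proj₁ (proj₂ (IsPk-∷⁻ pk)))))
        (MemP.∈-map⁺ (suc a ∷_) (ptnsF-complete f (a ℕ.+ size ys ∸ a) (suc a) ys (ℕP.≤-trans (ℕP.m∸n≤m _ a) N≤f) (proj₂ (proj₂ (IsPk-∷⁻ pk)))
          (sym (ℕP.m+n∸m≡n a (size ys))))))

  ptnsF-unique : ∀ f N b → Unique (ptnsF f N b)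
  ptnsF-unique f zero b = [] ∷ []
  ptnsF-unique zero (suc N) b = []
  ptnsF-unique (suc f) (suc N) b = Unique-concatMap (λ a → map (suc a ∷_) (ptnsF f (N ∸ a) (suc a)))
      (UniqueP.filter⁺ (λ a → BoolP.T? (suc a ≤ᵇ b)) (UniqueP.upTo⁺ (suc N)))
      (λ {a} _ → UniqueP.map⁺ ListP.∷-injectiveʳ (ptnsF-unique f (N ∸ a) (suc a)))
      (λ {x} {y} _ _ p q → same x y p q)
    where
    same : ∀ x y {z} → z ∈ map (suc x ∷_) (ptnsF f (N ∸ x) (suc x)) → z ∈ map (suc y ∷_) (ptnsF f (N ∸ y) (suc y)) → x ≡ y
    same x y p q with MemP.∈-map⁻ (suc x ∷_) p | MemP.∈-map⁻ (suc y ∷_) q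
    ... | _ , _ , refl | _ , _ , e = ℕP.suc-injective (ListP.∷-injectiveˡ e)

  kparts-sound : ∀ k N {xs} → xs ∈ kparts k N → IsPk k xs × size xs ℕ.≤ N
  kparts-sound k N p with find (MemP.∈-concatMap⁻ (λ s → ptnsF s s k) {xs = upTo (suc N)} p)
  ... | s , s∈ , q with ptnsF-sound s s k q
  ...   | pk , e = pk , ℕP.≤-trans (ℕP.≤-reflexive e) (ℕ.s≤s⁻¹ (MemP.∈-upTo⁻ s∈))

  kparts-complete : ∀ k N xs → IsPk k xs → size xs ℕ.≤ N → xs ∈ kparts k N
  kparts-complete k N xs pk l = MemP.∈-concatMap⁺ (λ s → ptnsF s s k) {xs = upTo (suc N)}
    (lose (MemP.∈-upTo⁺ (s≤s l)) (ptnsF-complete (size xs) (size xs) k xs ℕP.≤-refl pk refl))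

  -- The sums run over lists, so each partition must be shown to be counted only once.
  kparts-unique : ∀ k N → Unique (kparts k N)
  kparts-unique k N = Unique-concatMap (λ s → ptnsF s s k) (UniqueP.upTo⁺ (suc N)) (λ {s} _ → ptnsF-unique s s k)
    (λ {x} {y} _ _ p q → trans (sym (proj₂ (ptnsF-sound x x k p))) (proj₂ (ptnsF-sound y y k q)))

  ∈-allSubsets : ∀ {j} (A : Subset j) → A ∈ allSubsets j
  ∈-allSubsets Vec.[] = here refl
  ∈-allSubsets {suc j} (b Vec.∷ A) = MemP.∈-concatMap⁺ (λ A → (true Vec.∷ A) ∷ (false Vec.∷ A) ∷ []) {xs = allSubsets j} (lose (∈-allSubsets A) (pick b))
    where
    pick : ∀ b → (b Vec.∷ A) ∈ (true Vec.∷ A) ∷ (false Vec.∷ A) ∷ []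
    pick true = here refl
    pick false = there (here refl)

  allSubsets-unique : ∀ j → Unique (allSubsets j)
  allSubsets-unique zero = [] ∷ []
  allSubsets-unique (suc j) = Unique-concatMap (λ A → (true Vec.∷ A) ∷ (false Vec.∷ A) ∷ []) (allSubsets-unique j)
    (λ _ → ((λ ()) ∷ []) ∷ [] ∷ []) (λ {x} {y} _ _ p q → trans (sym (tail≡ p)) (tail≡ q))
    where
    tail≡ : ∀ {x z} → z ∈ (true Vec.∷ x) ∷ (false Vec.∷ x) ∷ [] → Vec.tail z ≡ x
    tail≡ (here refl) = refl
    tail≡ (there (here refl)) = refl

  bool-ext : ∀ {x y} → (x ≡ true → y ≡ true) → (y ≡ true → x ≡ true) → x ≡ y
  bool-ext {true} f g = sym (f refl)
  bool-ext {false} {true} f g = g refl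
  bool-ext {false} {false} f g = refl

  -- Sums and alternating sums in a commutative ring

  module RingSums {c ℓ} (R : CommutativeRing c ℓ) where
    module R = CommutativeRing R
    open R using (Carrier; _≈_; 0#; 1#) renaming (_+_ to infixl 6 _⊞_; _*_ to infixl 7 _⊠_; -_ to infix 8 ⊟_)
    open KS R (suc k')
    open import Relation.Binary.Reasoning.Setoid R.setoid
    open import Algebra.Properties.Ring R.ring using (-‿distribˡ-*; -‿distribʳ-*; -0#≈0#; -‿involutive; -‿+-comm)
    open import Algebra.Properties.CommutativeSemigroup R.+-commutativeSemigroup using (interchange; x∙yz≈y∙xz)

    Σᴸ : ∀ {a} {A : Set a} → List A → (A → Carrier) → Carrier
    Σᴸ L f = sumR (map f L)

    ⟦_⟧ : Bool → Carrier
    ⟦ true ⟧  = 1#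
    ⟦ false ⟧ = 0#

    Σ-cong : ∀ {a} {A : Set a} (L : List A) {f g : A → Carrier} → (∀ {x} → x ∈ L → f x ≈ g x) → Σᴸ L f ≈ Σᴸ L g
    Σ-cong []      h = R.refl
    Σ-cong (x ∷ L) h = R.+-cong (h (here refl)) (Σ-cong L (h ∘ there))

    Σ-0 : ∀ {a} {A : Set a} (L : List A) {f : A → Carrier} → (∀ {x} → x ∈ L → f x ≈ 0#) → Σᴸ L f ≈ 0#
    Σ-0 []      h = R.refl
    Σ-0 (x ∷ L) h = R.trans (R.+-cong (h (here refl)) (Σ-0 L (h ∘ there))) (R.+-identityˡ 0#)

    Σ-+ : ∀ {a} {A : Set a} (L : List A) (f g : A → Carrier) → Σᴸ L (λ x → f x ⊞ g x) ≈ Σᴸ L f ⊞ Σᴸ L g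
    Σ-+ []      f g = R.sym (R.+-identityˡ 0#)
    Σ-+ (x ∷ L) f g = R.trans (R.+-congˡ (Σ-+ L f g)) (interchange (f x) (g x) (Σᴸ L f) (Σᴸ L g))

    Σ-*ˡ : ∀ {a} {A : Set a} (L : List A) z (f : A → Carrier) → z ⊠ Σᴸ L f ≈ Σᴸ L (λ x → z ⊠ f x)
    Σ-*ˡ []      z f = R.zeroʳ z
    Σ-*ˡ (x ∷ L) z f = R.trans (R.distribˡ z (f x) (Σᴸ L f)) (R.+-congˡ (Σ-*ˡ L z f))

    Σ-*ʳ : ∀ {a} {A : Set a} (L : List A) z (f : A → Carrier) → Σᴸ L f ⊠ z ≈ Σᴸ L (λ x → f x ⊠ z)
    Σ-*ʳ []      z f = R.zeroˡ z
    Σ-*ʳ (x ∷ L) z f = R.trans (R.distribʳ z (f x) (Σᴸ L f)) (R.+-congˡ (Σ-*ʳ L z f))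

    Σ-swap : ∀ {a b} {A : Set a} {B : Set b} (L : List A) (M : List B) (f : A → B → Carrier) →
             Σᴸ L (λ x → Σᴸ M (f x)) ≈ Σᴸ M (λ y → Σᴸ L (λ x → f x y))
    Σ-swap []      M f = R.sym (Σ-0 M (λ _ → R.refl))
    Σ-swap (x ∷ L) M f = R.trans (R.+-congˡ (Σ-swap L M f)) (R.sym (Σ-+ M (f x) (λ y → Σᴸ L (λ x → f x y))))

    Σ-filter : ∀ {a} {A : Set a} (p : A → Bool) (L : List A) (f : A → Carrier) → Σᴸ (filterᵇ p L) f ≈ Σᴸ L (λ x → ⟦ p x ⟧ ⊠ f x)
    Σ-filter p []      f = R.refl
    Σ-filter p (x ∷ L) f with p x
    ... | true  = R.+-cong (R.sym (R.*-identityˡ (f x))) (Σ-filter p L f)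
    ... | false = R.trans (Σ-filter p L f) (R.trans (R.sym (R.+-identityˡ _)) (R.+-congʳ (R.sym (R.zeroˡ (f x)))))

    Σ-++ : ∀ {a} {A : Set a} (L M : List A) (f : A → Carrier) → Σᴸ (L ++ M) f ≈ Σᴸ L f ⊞ Σᴸ M f
    Σ-++ []      M f = R.sym (R.+-identityˡ _)
    Σ-++ (x ∷ L) M f = R.trans (R.+-congˡ (Σ-++ L M f)) (R.sym (R.+-assoc (f x) (Σᴸ L f) (Σᴸ M f)))

    Σ-map : ∀ {a b} {A : Set a} {B : Set b} (φ : A → B) (L : List A) (f : B → Carrier) → Σᴸ (map φ L) f ≈ Σᴸ L (f ∘ φ)
    Σ-map φ []      f = R.refl
    Σ-map φ (x ∷ L) f = R.+-congˡ (Σ-map φ L f)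

    false⇒0 : ∀ b z → (b ≢ true) → ⟦ b ⟧ ⊠ z ≈ 0#
    false⇒0 true  z h = contradiction refl h
    false⇒0 false z h = R.zeroˡ z

    true⇒1 : ∀ b z → b ≡ true → ⟦ b ⟧ ⊠ z ≈ z
    true⇒1 true z _ = R.*-identityˡ z

    Σ-δ : ∀ {a} {A : Set a} {L : List A} (p : A → Bool) (f : A → Carrier) {x} → Unique L → x ∈ L → p x ≡ true →
          (∀ {y} → y ∈ L → p y ≡ true → y ≡ x) → Σᴸ L (λ y → ⟦ p y ⟧ ⊠ f y) ≈ f x
    Σ-δ {L = x ∷ L} p f (x∉ ∷ u) (here refl) px h = R.trans (R.+-cong (true⇒1 (p x) (f x) px)
        (Σ-0 L (λ {y} y∈ → false⇒0 (p y) (f y) (λ py → contradiction (sym (h (there y∈) py)) (All.lookup x∉ y∈))))) (R.+-identityʳ (f x))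
    Σ-δ {L = z ∷ L} p f (z∉ ∷ u) (there x∈) px h = R.trans (R.+-cong
        (false⇒0 (p z) (f z) (λ pz → contradiction (h (here refl) pz) (All.lookup z∉ x∈))) (Σ-δ p f u x∈ px (h ∘ there))) (R.+-identityˡ _)

    -- Double counting of a kernel K. With K the weighted graph of a partial bijection, it matches
    -- two sums whose unmatched terms vanish.
    reindex : ∀ {a b} {A : Set a} {B : Set b} (L : List A) (M : List B) (K : A → B → Carrier) {f : A → Carrier} {g : B → Carrier} →
              (∀ {x} → x ∈ L → f x ≈ Σᴸ M (K x)) → (∀ {y} → y ∈ M → g y ≈ Σᴸ L (λ x → K x y)) → Σᴸ L f ≈ Σᴸ M g
    reindex L M K h h′ = R.trans (Σ-cong L h) (R.trans (Σ-swap L M K) (Σ-cong M (λ y∈ → R.sym (h′ y∈))))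

    x-x≈0 : ∀ {x y} → x ≈ y → x ⊞ ⊟ y ≈ 0#
    x-x≈0 {x} {y} e = R.trans (R.+-congʳ e) (R.-‿inverseʳ y)

    x-0≈x : ∀ {x y} → y ≈ 0# → x ⊞ ⊟ y ≈ x
    x-0≈x {x} e = R.trans (R.+-congˡ (R.trans (R.-‿cong e) -0#≈0#)) (R.+-identityʳ x)

    -- Σ over the subwords b of d of (-1)^(|d| - |b|) q b.
    alt : Word → (Word → Bool) → Carrier
    alt []      q = ⟦ q [] ⟧
    alt (t ∷ d) q = alt d (q ∘ (t ∷_)) ⊞ ⊟ alt d q

    alt-cong : ∀ d {q q′ : Word → Bool} → (∀ b → b ⊆ d → q b ≡ q′ b) → alt d q ≈ alt d q′
    alt-cong []      h = R.reflexive (cong ⟦_⟧ (h [] []))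
    alt-cong (t ∷ d) h = R.+-cong (alt-cong d (λ b p → h (t ∷ b) (refl ∷ p))) (R.-‿cong (alt-cong d (λ b p → h b (t ∷ʳ p))))

    alt-0 : ∀ d {q} → (∀ b → b ⊆ d → q b ≡ false) → alt d q ≈ 0#
    alt-0 []      h = R.reflexive (cong ⟦_⟧ (h [] []))
    alt-0 (t ∷ d) h = R.trans (x-0≈x (alt-0 d (λ b p → h b (t ∷ʳ p)))) (alt-0 d (λ b p → h (t ∷ b) (refl ∷ p)))

    -- If the word without t still satisfies q, then intersecting with it shows that t never
    -- matters, and the two halves of `alt` cancel. Otherwise, by monotonicity, no subword without t
    -- satisfies q, and only the half that keeps t survives.
    alt-minimal : ∀ {w ν d} E q → CycDec d → (∀ t → t ∈ d → ¬ E t) → Decides w ν E d q → alt d q ≈ ⟦ minimalᵇ d q ⟧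
    alt-minimal E q [] dj h = R.refl
    alt-minimal {w} {ν} {t ∷ d} E q (cons t∉ _ c) dj h with q d in eq
    ... | true = x-x≈0 (alt-cong d same)
      where
      same : ∀ b → b ⊆ d → q (t ∷ b) ≡ q b
      same b p = bool-ext
        (λ e → proj₂ (h b (t ∷ʳ p)) (Q-mono narrow (Q-∩ (proj₁ (h (t ∷ b) (refl ∷ p)) e) (proj₁ (h d (t ∷ʳ Sub.⊆-refl)) eq))))
        (λ e → proj₂ (h (t ∷ b) (refl ∷ p)) (Q-mono (λ { u (inj₁ a) → inj₁ a ; u (inj₂ a) → inj₂ (there a) }) (proj₁ (h b (t ∷ʳ p)) e)))
        where
        narrow : ∀ u → (E u ⊎ u ∈ t ∷ b) × (E u ⊎ u ∈ d) → E u ⊎ u ∈ b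
        narrow u (inj₁ a , _) = inj₁ a
        narrow u (inj₂ (there a) , _) = inj₂ a
        narrow u (inj₂ (here refl) , inj₁ a) = inj₁ a
        narrow u (inj₂ (here refl) , inj₂ a) = contradiction a t∉
    ... | false = R.trans (x-0≈x (alt-0 d none))
        (alt-minimal {w} {ν} {d} (λ u → E u ⊎ u ≡ t) (q ∘ (t ∷_)) c
          (λ { u u∈ (inj₁ a) → dj u (there u∈) a ; u u∈ (inj₂ refl) → t∉ u∈ }) (Decides-∷ {w} {ν} {E} {t} {d} {q} h))
      where
      none : ∀ b → b ⊆ d → q b ≡ false
      none b p = BoolP.¬-not (λ e → contradiction (trans (sym eq) (proj₂ (h d (t ∷ʳ Sub.⊆-refl))
        (Q-mono (λ { u (inj₁ a) → inj₁ a ; u (inj₂ a) → inj₂ (Sub.lookup p a) }) (proj₁ (h b (t ∷ʳ p)) e)))) λ ())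

    even-step : ∀ e → (suc (suc e) ℕ.% 2 ≡ᵇ 0) ≡ (e ℕ.% 2 ≡ᵇ 0)
    even-step e = cong (_≡ᵇ 0) (trans (cong (ℕ._% 2) (ℕP.+-comm 2 e)) ([m+n]%n≡m%n e 2))

    even-suc : ∀ e → (suc e ℕ.% 2 ≡ᵇ 0) ≡ not (e ℕ.% 2 ≡ᵇ 0)
    even-suc zero = refl
    even-suc (suc e) = trans (even-step e) (sym (trans (cong not (even-suc e)) (BoolP.not-involutive _)))

    signed-suc : ∀ e x → signed (suc e) x ≈ ⊟ signed e x
    signed-suc e x with suc e ℕ.% 2 ≡ᵇ 0 | e ℕ.% 2 ≡ᵇ 0 | even-suc e
    ... | true  | false | _ = R.sym (-‿involutive x)
    ... | false | true  | _ = R.refl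

    signed-2 : ∀ e x → signed (suc (suc e)) x ≈ signed e x
    signed-2 e x = R.trans (signed-suc (suc e) x) (R.trans (R.-‿cong (signed-suc e x)) (-‿involutive _))

    signed-cong : ∀ e {x y} → x ≈ y → signed e x ≈ signed e y
    signed-cong e h with e ℕ.% 2 ≡ᵇ 0
    ... | true  = h
    ... | false = R.-‿cong h

    signed-neg : ∀ e x → signed e (⊟ x) ≈ ⊟ signed e x
    signed-neg e x with e ℕ.% 2 ≡ᵇ 0
    ... | true  = R.refl
    ... | false = R.refl

    signed-0 : ∀ e → signed e 0# ≈ 0#
    signed-0 e with e ℕ.% 2 ≡ᵇ 0
    ... | true  = R.refl
    ... | false = -0#≈0#

    signed-* : ∀ e x y → signed e x ⊠ y ≈ signed e (x ⊠ y)
    signed-* e x y with e ℕ.% 2 ≡ᵇ 0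
    ... | true  = R.refl
    ... | false = R.sym (-‿distribˡ-* x y)

    signed-Σ : ∀ {a} {A : Set a} e (L : List A) (f : A → Carrier) → signed e (Σᴸ L f) ≈ Σᴸ L (λ x → signed e (f x))
    signed-Σ e []      f = signed-0 e
    signed-Σ e (x ∷ L) f = R.trans (signed-+ (f x) (Σᴸ L f)) (R.+-congˡ (signed-Σ e L f))
      where
      signed-+ : ∀ x y → signed e (x ⊞ y) ≈ signed e x ⊞ signed e y
      signed-+ x y with e ℕ.% 2 ≡ᵇ 0
      ... | true  = R.refl
      ... | false = R.sym (-‿+-comm x y)

    Σ-sublists : ∀ {A : Set} (xs : List A) (φ : List A → Carrier) → Σᴸ (sublists xs) φ ≈ φ [] ⊞ Σᴸ (nonemptySublists xs) φ
    Σ-sublists xs φ = R.trans (lemma xs) (R.+-congˡ (R.sym (Σ-filter _ (sublists xs) φ)))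
      where
      ψ : List _ → Carrier
      ψ S = ⟦ not (length S ≡ᵇ 0) ⟧ ⊠ φ S
      lemma : ∀ xs → Σᴸ (sublists xs) φ ≈ φ [] ⊞ Σᴸ (sublists xs) ψ
      lemma [] = R.+-congˡ (R.sym (R.trans (R.+-identityʳ _) (R.zeroˡ (φ []))))
      lemma (x ∷ xs) = begin
        Σᴸ (map (x ∷_) L ++ L) φ                   ≈⟨ Σ-++ (map (x ∷_) L) L φ ⟩
        Σᴸ (map (x ∷_) L) φ ⊞ Σᴸ L φ               ≈⟨ R.+-cong (Σ-map (x ∷_) L φ) (lemma xs) ⟩
        Σᴸ L (φ ∘ (x ∷_)) ⊞ (φ [] ⊞ Σᴸ L ψ)        ≈⟨ x∙yz≈y∙xz _ (φ []) _ ⟩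
        φ [] ⊞ (Σᴸ L (φ ∘ (x ∷_)) ⊞ Σᴸ L ψ)        ≈⟨ R.+-congˡ (R.+-congʳ (Σ-cong L (λ {S} _ → R.sym (R.*-identityˡ (φ (x ∷ S)))))) ⟩
        φ [] ⊞ (Σᴸ L (ψ ∘ (x ∷_)) ⊞ Σᴸ L ψ)        ≈⟨ R.+-congˡ (R.+-congʳ (R.sym (Σ-map (x ∷_) L ψ))) ⟩
        φ [] ⊞ (Σᴸ (map (x ∷_) L) ψ ⊞ Σᴸ L ψ)      ≈⟨ R.+-congˡ (R.sym (Σ-++ (map (x ∷_) L) L ψ)) ⟩
        φ [] ⊞ Σᴸ (map (x ∷_) L ++ L) ψ            ∎
        where L = sublists xs

    -- The sum is the expansion of the product of the factors 1 - `⟦ p x ⟧`.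
    Σ-sublists-all : ∀ {A : Set} (p : A → Bool) (xs : List A) →
                     Σᴸ (sublists xs) (λ S → signed (length S) ⟦ all p S ⟧) ≈ ⟦ not (any p xs) ⟧
    Σ-sublists-all p [] = R.+-identityʳ 1#
    Σ-sublists-all p (x ∷ xs) = R.trans (Σ-++ (map (x ∷_) L) L φ) (R.trans (R.+-congʳ (Σ-map (x ∷_) L φ)) (cases (p x) refl))
      where
      L : List (List _)
      L = sublists xs
      φ : List _ → Carrier
      φ S = signed (length S) ⟦ all p S ⟧
      cases : ∀ b → p x ≡ b → Σᴸ L (φ ∘ (x ∷_)) ⊞ Σᴸ L φ ≈ ⟦ not (any p (x ∷ xs)) ⟧
      cases true e rewrite e = R.trans (R.+-congʳ (R.trans (Σ-cong L (λ {S} _ → signed-suc (length S) _)) (neg L φ))) (R.-‿inverseˡ _)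
        where
        neg : ∀ L φ → Σᴸ L (λ S → ⊟ φ S) ≈ ⊟ Σᴸ L φ
        neg [] φ = R.sym -0#≈0#
        neg (S ∷ L) φ = R.trans (R.+-congˡ (neg L φ)) (-‿+-comm _ _)
      cases false e rewrite e = R.trans (R.+-congʳ (Σ-0 L (λ {S} _ → signed-0 (suc (length S))))) (R.trans (R.+-identityˡ _) (Σ-sublists-all p xs))

    inclusion–exclusion : ∀ {A : Set} (p : A → Bool) (xs : List A) →
                          Σᴸ (nonemptySublists xs) (λ S → signed (suc (length S)) ⟦ all p S ⟧) ≈ ⟦ any p xs ⟧
    inclusion–exclusion p xs = begin
      Σᴸ M (λ S → signed (suc (length S)) ⟦ all p S ⟧)   ≈⟨ Σ-cong M (λ {S} _ → signed-suc (length S) _) ⟩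
      Σᴸ M (λ S → ⊟ φ S)                                 ≈⟨ R.trans (Σ-cong M (λ {S} _ → R.trans (R.-‿cong (R.sym (R.*-identityˡ (φ S)))) (-‿distribˡ-* 1# (φ S)))) (R.sym (Σ-*ˡ M (⊟ 1#) φ)) ⟩
      ⊟ 1# ⊠ Σᴸ M φ                                      ≈⟨ R.trans (R.sym (-‿distribˡ-* 1# _)) (R.-‿cong (R.*-identityˡ _)) ⟩
      ⊟ Σᴸ M φ                                           ≈⟨ solve (any p xs) (R.trans (R.sym (Σ-sublists xs φ)) (Σ-sublists-all p xs)) ⟩
      ⟦ any p xs ⟧                                       ∎
      where
      M : List (List _)
      M = nonemptySublists xs
      φ : List _ → Carrier
      φ S = signed (length S) ⟦ all p S ⟧
      solve : ∀ b {X} → 1# ⊞ X ≈ ⟦ not b ⟧ → ⊟ X ≈ ⟦ b ⟧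
      solve b {X} e = begin
        ⊟ X                      ≈⟨ R.sym (R.trans (R.+-congʳ (R.-‿inverseʳ 1#)) (R.+-identityˡ _)) ⟩
        1# ⊞ ⊟ 1# ⊞ ⊟ X          ≈⟨ R.trans (R.+-assoc 1# (⊟ 1#) (⊟ X)) (R.+-congˡ (-‿+-comm 1# X)) ⟩
        1# ⊞ ⊟ (1# ⊞ X)          ≈⟨ R.+-congˡ (R.-‿cong e) ⟩
        1# ⊞ ⊟ ⟦ not b ⟧         ≈⟨ complement b ⟩
        ⟦ b ⟧                    ∎
        where
        complement : ∀ b → 1# ⊞ ⊟ ⟦ not b ⟧ ≈ ⟦ b ⟧
        complement true  = x-0≈x R.refl
        complement false = R.-‿inverseʳ 1#

  -- The Pieri operators and their adjoints

  if-~ : ∀ b b′ {u u′ v v′} → b ≡ b′ → u ~ u′ → v ~ v′ → (if b then u else v) ~ (if b′ then u′ else v′)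
  if-~ true  .true  refl e _ = e
  if-~ false .false refl _ e = e

  up : I → Word → Bool
  up t v = len v <ᵇ len (t ∷ v)

  dn-cong : ∀ t u v → u ~ v → dn t u ~ dn t v
  dn-cong t u v e = if-~ (up t u) (up t v) {u} {v} {t ∷ u} {t ∷ v}
    (cong₂ _<ᵇ_ (len-cong u v e) (len-cong (t ∷ u) (t ∷ v) (~-∷ t e))) e (~-∷ t e)

  dn*-cong : ∀ b u v → u ~ v → dn* b u ~ dn* b v
  dn*-cong []      u v e = e
  dn*-cong (t ∷ b) u v e = dn*-cong b (dn t u) (dn t v) (dn-cong t u v e)

  len-if : ∀ b t v → len v ℕ.≤ suc (len (if b then v else t ∷ v))
  len-if true  t v = ℕP.n≤1+n _
  len-if false t v = len-∷-≥ t v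

  len-dn* : ∀ b v → len v ℕ.≤ length b ℕ.+ len (dn* b v)
  len-dn* []      v = ℕP.≤-refl
  len-dn* (t ∷ b) v = ℕP.≤-trans (len-if (up t v) t v) (s≤s (len-dn* b (dn t v)))

  ≤B⇒len≤ : ∀ u v → u ≤B v → len u ℕ.≤ len v
  ≤B⇒len≤ u v p =
    let (w , w∈ , q) = find (AnyP.any⁻ _ (reducedWords v) p)
        (x , x∈ , c) = find (AnyP.any⁻ _ (sublists w) q)
        (l , _) = T∧⁻ (length x ≡ᵇ len u) (x ≈ᵇ u) c
        (w∈′ , _) = ∈-filterᵇ⁻ (_≈ᵇ v) {w} {words (len v)} w∈
    in subst₂ ℕ._≤_ (ℕP.≡ᵇ⇒≡ (length x) (len u) l) (words-length (len v) w w∈′) (SubP.length-mono-≤ {as = x} {bs = w} (∈-sublists⇒⊆ {xs = x} {ys = w} x∈))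

  bruhatᵇ-cong : ∀ u v w → Inc₀ u → Inc₀ v → Inc₀ w → u ~ v → bruhatᵇ u w ≡ bruhatᵇ v w
  bruhatᵇ-cong u v w gu gv gw e = bool-ext (one-way u v gv (~-sym e)) (one-way v u gu e)
    where
    one-way : ∀ u v → Inc₀ v → v ~ u → bruhatᵇ u w ≡ true → bruhatᵇ v w ≡ true
    one-way u v gv e p = T⇒≡ (⊑⇒≤B v w (Inc⇒Grass v gv) (Inc⇒Grass w gw)
      (⊑-trans {v} {u} {w} (~⇒⊑ v u e) (≤B⇒⊑ u w (≡⇒T p))))

  true⊎false : ∀ b → b ≡ true ⊎ b ≡ false
  true⊎false true  = inj₁ refl
  true⊎false false = inj₂ refl

  module Step (t : I) (v : Word) where
    asc : up t v ≡ true → ia v (rep t) < ia v (rep t ⁺)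
    asc e = ascent⁻¹ v (rep t) (subst (λ i → len v ℕ.< len (i ∷ v)) (sym (r-rep t)) (ℕP.<ᵇ⇒< (len v) (len (t ∷ v)) (≡⇒T e)))

    desc : up t v ≡ false → ia v (rep t ⁺) < ia v (rep t)
    desc e with ℤP.<-cmp (ia v (rep t)) (ia v (rep t ⁺))
    ... | tri> _ _ p = p
    ... | tri≈ _ q _ = contradiction q (ia-≢⁺ v (rep t))
    ... | tri< p _ _ = ⊥-elim (subst T e (ℕP.<⇒<ᵇ (ℕP.≤-reflexive (sym (subst (λ i → len (i ∷ v) ≡ suc (len v)) (r-rep t) (ascent v (rep t) p))))))

    len-up : up t v ≡ true → len (t ∷ v) ≡ suc (len v)
    len-up e = subst (λ i → len (i ∷ v) ≡ suc (len v)) (r-rep t) (ascent v (rep t) (asc e))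

    len-down : up t v ≡ false → len v ≡ suc (len (t ∷ v))
    len-down e = subst (λ i → len v ≡ suc (len (i ∷ v))) (r-rep t) (descent v (rep t) (desc e))

    Inc-up : up t v ≡ true → Inc₀ (t ∷ v) → Inc₀ v
    Inc-up e g = proj₁ (Inc-∷⁻¹ v (rep t) (subst (λ i → Inc₀ (i ∷ v)) (sym (r-rep t)) g) (asc e))

    Inc-down : up t v ≡ false → Inc₀ v → Inc₀ (t ∷ v)
    Inc-down e g = subst (λ i → Inc₀ (i ∷ v)) (r-rep t) (Inc-descent-Inc v g (rep t) (desc e))

  ∣∣≡0⇒out : ∀ (A : Subset n) → ∣ A ∣ ≡ 0 → ∀ t → lookup A t ≡ false
  ∣∣≡0⇒out A e t = ∉ₛ⇒false A t (λ p → ℕP.1+n≢0 (trans (sym (∣∣-update A t p)) e))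

  length≡0⇒[] : ∀ {A : Set} (xs : List A) → length xs ≡ 0 → xs ≡ []
  length≡0⇒[] [] _ = refl

  module _ {c ℓ} (R : CommutativeRing c ℓ) where
    open RingSums R
    open R using (Carrier; _≈_; 0#; 1#) renaming (_+_ to infixl 6 _⊞_; _*_ to infixl 7 _⊠_; -_ to infix 8 ⊟_)
    open KS R (suc k')
    open import Relation.Binary.Reasoning.Setoid R.setoid
    open import Algebra.Properties.Ring R.ring using (-‿distribˡ-*; -‿distribʳ-*; -0#≈0#)
    open import Algebra.Properties.CommutativeSemigroup R.*-commutativeSemigroup using (x∙yz≈y∙xz)

    ⟦∧⟧ : ∀ a b → ⟦ a ∧ b ⟧ ≈ ⟦ a ⟧ ⊠ ⟦ b ⟧
    ⟦∧⟧ true  b = R.sym (R.*-identityˡ ⟦ b ⟧)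
    ⟦∧⟧ false b = R.sym (R.zeroˡ ⟦ b ⟧)

    when : ∀ b {x y} → (b ≡ true → x ≈ y) → ⟦ b ⟧ ⊠ x ≈ ⟦ b ⟧ ⊠ y
    when true  h = R.*-congˡ (h refl)
    when false h = R.trans (R.zeroˡ _) (R.sym (R.zeroˡ _))

    ΣΣ-pull : ∀ {a b d} {A : Set a} {B : Set b} {D : Set d} (L : List A) (J : List B) (M : List D)
              (β : A → Carrier) (P : B → D → Carrier) (X : D → A → Carrier) →
              Σᴸ L (λ μ → β μ ⊠ Σᴸ J (λ j → Σᴸ M (λ S → P j S ⊠ X S μ))) ≈
              Σᴸ J (λ j → Σᴸ M (λ S → P j S ⊠ Σᴸ L (λ μ → β μ ⊠ X S μ)))
    ΣΣ-pull L J M β P X = begin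
      Σᴸ L (λ μ → β μ ⊠ Σᴸ J (λ j → Σᴸ M (λ S → P j S ⊠ X S μ)))
        ≈⟨ Σ-cong L (λ {μ} _ → R.trans (Σ-*ˡ J (β μ) _) (Σ-cong J (λ {j} _ → R.trans (Σ-*ˡ M (β μ) _) (Σ-cong M (λ {S} _ → x∙yz≈y∙xz (β μ) (P j S) (X S μ)))))) ⟩
      Σᴸ L (λ μ → Σᴸ J (λ j → Σᴸ M (λ S → P j S ⊠ (β μ ⊠ X S μ))))
        ≈⟨ Σ-swap L J _ ⟩
      Σᴸ J (λ j → Σᴸ L (λ μ → Σᴸ M (λ S → P j S ⊠ (β μ ⊠ X S μ))))
        ≈⟨ Σ-cong J (λ {j} _ → R.trans (Σ-swap L M _) (Σ-cong M (λ {S} _ → R.sym (Σ-*ˡ L (P j S) _)))) ⟩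
      Σᴸ J (λ j → Σᴸ M (λ S → P j S ⊠ Σᴸ L (λ μ → β μ ⊠ X S μ))) ∎

    Class Vanish : (Word → Carrier) → Set _
    Class f = ∀ u v → u ~ v → f u ≈ f v
    Vanish f = ∀ v → ¬ Inc₀ v → f v ≈ 0#

    -- The action of the generator T_t on functions on W, in the signed form entering the Pieri rule.
    τ : I → (Word → Carrier) → Word → Carrier
    τ t f v = if up t v then f (t ∷ v) else ⊟ f v

    τ* : Word → (Word → Carrier) → Word → Carrier
    τ* []      f = f
    τ* (t ∷ d) f = τ* d (τ t f)

    τ-up : ∀ t f v → up t v ≡ true → τ t f v ≡ f (t ∷ v)
    τ-up t f v = cong (λ b → if b then f (t ∷ v) else ⊟ f v)

    τ-down : ∀ t f v → up t v ≡ false → τ t f v ≡ ⊟ f v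
    τ-down t f v = cong (λ b → if b then f (t ∷ v) else ⊟ f v)

    phi-up : ∀ t v → up t v ≡ true → phi t v ≡ t ∷ v
    phi-up t v = cong (λ b → if b then t ∷ v else v)

    phi-down : ∀ t v → up t v ≡ false → phi t v ≡ v
    phi-down t v = cong (λ b → if b then t ∷ v else v)

    τ-Class : ∀ t f → Class f → Class (τ t f)
    τ-Class t f h u v e = if-≈ (up t u) (up t v) (cong₂ _<ᵇ_ (len-cong u v e) (len-cong (t ∷ u) (t ∷ v) (~-∷ t e)))
        (h (t ∷ u) (t ∷ v) (~-∷ t e)) (R.-‿cong (h u v e))
      where
      if-≈ : ∀ b b′ {x x′ y y′} → b ≡ b′ → x ≈ x′ → y ≈ y′ → (if b then x else y) ≈ (if b′ then x′ else y′)
      if-≈ true  .true  refl e _ = e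
      if-≈ false .false refl _ e = e

    -- An ascent never leads from a non-Grassmannian to a Grassmannian element (`Step.Inc-up`).
    -- Hence the operators for the letters of `dword A` can be applied one after another to a
    -- function supported on Grassmannian elements.
    τ-Vanish : ∀ t f → Vanish f → Vanish (τ t f)
    τ-Vanish t f h v ¬g = [ (λ e → R.trans (R.reflexive (τ-up t f v e)) (h (t ∷ v) (¬g ∘ Step.Inc-up t v e)))
                          , (λ e → R.trans (R.reflexive (τ-down t f v e)) (R.trans (R.-‿cong (h v ¬g)) -0#≈0#)) ]′ (true⊎false (up t v))

    signed-double : ∀ e x → signed (e ℕ.+ e) x ≈ x
    signed-double zero    x = R.refl
    signed-double (suc e) x = R.trans (R.reflexive (cong (λ j → signed (suc j) x) (ℕP.+-suc e e))) (R.trans (signed-2 (e ℕ.+ e) x) (signed-double e x))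

    -- The Pieri sign factors over the letters: one that raises the length changes the exponent by
    -- two, one that acts trivially by one.
    signed-τ* : ∀ d f v → signed (length d ℕ.+ len v ℕ.+ len (demazure d v)) (f (demazure d v)) ≈ τ* d f v
    signed-τ* []      f v = signed-double (len v) (f v)
    signed-τ* (t ∷ d) f v = R.trans ([ case-up , case-down ]′ (true⊎false (up t W))) (signed-τ* d (τ t f) v)
      where
      W : Word
      W = demazure d v
      E : ℕ
      E = length d ℕ.+ len v
      case-up : up t W ≡ true → signed (suc (E ℕ.+ len (phi t W))) (f (phi t W)) ≈ signed (E ℕ.+ len W) (τ t f W)
      case-up e = begin
        signed (suc (E ℕ.+ len (phi t W))) (f (phi t W))   ≡⟨ cong (λ x → signed (suc (E ℕ.+ len x)) (f x)) (phi-up t W e) ⟩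
        signed (suc (E ℕ.+ len (t ∷ W))) (f (t ∷ W))       ≡⟨ cong (λ j → signed (suc j) (f (t ∷ W))) (trans (cong (E ℕ.+_) (Step.len-up t W e)) (ℕP.+-suc E (len W))) ⟩
        signed (suc (suc (E ℕ.+ len W))) (f (t ∷ W))       ≈⟨ signed-2 (E ℕ.+ len W) _ ⟩
        signed (E ℕ.+ len W) (f (t ∷ W))                   ≡⟨ cong (signed (E ℕ.+ len W)) (sym (τ-up t f W e)) ⟩
        signed (E ℕ.+ len W) (τ t f W)                     ∎
      case-down : up t W ≡ false → signed (suc (E ℕ.+ len (phi t W))) (f (phi t W)) ≈ signed (E ℕ.+ len W) (τ t f W)
      case-down e = begin
        signed (suc (E ℕ.+ len (phi t W))) (f (phi t W))   ≡⟨ cong (λ x → signed (suc (E ℕ.+ len x)) (f x)) (phi-down t W e) ⟩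
        signed (suc (E ℕ.+ len W)) (f W)                   ≈⟨ R.trans (signed-suc (E ℕ.+ len W) (f W)) (R.sym (signed-neg (E ℕ.+ len W) (f W))) ⟩
        signed (E ℕ.+ len W) (⊟ f W)                       ≡⟨ cong (signed (E ℕ.+ len W)) (sym (τ-down t f W e)) ⟩
        signed (E ℕ.+ len W) (τ t f W)                     ∎

    parts : ℕ → List (List ℕ)
    parts = kparts (suc k')

    IncW : List ℕ → Set
    IncW μ = Inc₀ (wλ μ)

    ∈parts⇒Inc : ∀ {N μ} → μ ∈ parts N → IncW μ
    ∈parts⇒Inc {N} {μ} p = wλ-Inc μ (proj₁ (kparts-sound (suc k') N p))

    -- The transpose of `τ t`: A holds the contributions of the ascents of μ, C the diagonal ones of
    -- the descents. Substituting ν = t μ turns the ascents into the descents B, which together with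
    -- C give χ at `dn t ν` minus χ at ν.
    module Adjoint (t : I) (f χ : Word → Carrier) (N : ℕ) (f-class : Class f) (f-vanish : Vanish f)
                   (χ-class : ∀ u v → Inc₀ u → Inc₀ v → u ~ v → χ u ≈ χ v)
                   (χ-support : ∀ v → N ℕ.≤ len v → χ v ≈ 0#) where
      L : List (List ℕ)
      L = parts N

      A B C : List ℕ → Carrier
      A μ = ⟦ up t (wλ μ) ⟧ ⊠ (χ (wλ μ) ⊠ f (t ∷ wλ μ))
      B μ = ⟦ not (up t (wλ μ)) ⟧ ⊠ (χ (t ∷ wλ μ) ⊠ f (wλ μ))
      C μ = ⟦ not (up t (wλ μ)) ⟧ ⊠ ⊟ (χ (wλ μ) ⊠ f (wλ μ))

      split-τ : ∀ μ → χ (wλ μ) ⊠ τ t f (wλ μ) ≈ A μ ⊞ C μ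
      split-τ μ = lemma (up t (wλ μ))
        where
        lemma : ∀ b → χ (wλ μ) ⊠ (if b then f (t ∷ wλ μ) else ⊟ f (wλ μ)) ≈
                ⟦ b ⟧ ⊠ (χ (wλ μ) ⊠ f (t ∷ wλ μ)) ⊞ ⟦ not b ⟧ ⊠ ⊟ (χ (wλ μ) ⊠ f (wλ μ))
        lemma true  = R.sym (R.trans (R.+-cong (R.*-identityˡ _) (R.zeroˡ _)) (R.+-identityʳ _))
        lemma false = R.trans (R.sym (-‿distribʳ-* _ _)) (R.sym (R.trans (R.+-cong (R.zeroˡ _) (R.*-identityˡ _)) (R.+-identityˡ _)))

      split-dn : ∀ μ → (χ (dn t (wλ μ)) ⊞ ⊟ χ (wλ μ)) ⊠ f (wλ μ) ≈ B μ ⊞ C μ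
      split-dn μ = lemma (up t (wλ μ))
        where
        lemma : ∀ b → (χ (if b then wλ μ else t ∷ wλ μ) ⊞ ⊟ χ (wλ μ)) ⊠ f (wλ μ) ≈
                ⟦ not b ⟧ ⊠ (χ (t ∷ wλ μ) ⊠ f (wλ μ)) ⊞ ⟦ not b ⟧ ⊠ ⊟ (χ (wλ μ) ⊠ f (wλ μ))
        lemma true  = R.trans (R.trans (R.*-congʳ (R.-‿inverseʳ _)) (R.zeroˡ _)) (R.sym (R.trans (R.+-cong (R.zeroˡ _) (R.zeroˡ _)) (R.+-identityˡ 0#)))
        lemma false = R.trans (R.distribʳ _ _ _) (R.+-cong (R.sym (R.*-identityˡ _)) (R.trans (R.sym (-‿distribˡ-* _ _)) (R.sym (R.*-identityˡ _))))

      cover : List ℕ → List ℕ → Bool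
      cover μ ν = up t (wλ μ) ∧ ((t ∷ wλ μ) ≈ᵇ wλ ν)

      cover⇒ : ∀ μ ν → cover μ ν ≡ true → up t (wλ μ) ≡ true × (t ∷ wλ μ) ~ wλ ν
      cover⇒ μ ν e = let (a , b) = T∧⁻ (up t (wλ μ)) ((t ∷ wλ μ) ≈ᵇ wλ ν) (≡⇒T e)
                     in T⇒≡ a , ≈ᵇ⇒~ (t ∷ wλ μ) (wλ ν) b

      ⇒cover : ∀ μ ν → up t (wλ μ) ≡ true → (t ∷ wλ μ) ~ wλ ν → cover μ ν ≡ true
      ⇒cover μ ν a e = T⇒≡ (T∧⁺ (up t (wλ μ)) ((t ∷ wλ μ) ≈ᵇ wλ ν) (≡⇒T a) (~⇒≈ᵇ (t ∷ wλ μ) (wλ ν) e))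

      K : List ℕ → List ℕ → Carrier
      K μ ν = ⟦ cover μ ν ⟧ ⊠ (χ (wλ μ) ⊠ f (wλ ν))

      size-len : ∀ μ → μ ∈ L → size μ ≡ len (wλ μ)
      size-len μ p = sym (len-wλ μ (proj₁ (kparts-sound (suc k') N p)))

      row : ∀ {μ} → μ ∈ L → A μ ≈ Σᴸ L (K μ)
      row {μ} μ∈ = [ case-up , case-down ]′ (true⊎false (up t u))
        where
        u : Word
        u = wλ μ
        case-down : up t u ≡ false → A μ ≈ Σᴸ L (K μ)
        case-down e = R.trans (false⇒0 (up t u) _ (λ e′ → contradiction (trans (sym e′) e) λ ()))
          (R.sym (Σ-0 L (λ {ν} _ → false⇒0 (cover μ ν) _ (λ c → contradiction (trans (sym (proj₁ (cover⇒ μ ν c))) e) λ ()))))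
        case-up : up t u ≡ true → A μ ≈ Σᴸ L (K μ)
        case-up e = [ (λ gr → grassmannian (Grass⇒Inc (t ∷ u) (≡⇒T gr)))
                    , (λ ¬gr → not-grassmannian (λ g → contradiction (trans (sym (T⇒≡ (Inc⇒Grass (t ∷ u) g))) ¬gr) λ ())) ]′
                    (true⊎false (grassᵇ (t ∷ u)))
          where
          not-grassmannian : ¬ Inc₀ (t ∷ u) → A μ ≈ Σᴸ L (K μ)
          not-grassmannian ¬g = R.trans (R.trans (R.*-congˡ (R.trans (R.*-congˡ (f-vanish (t ∷ u) ¬g)) (R.zeroʳ _))) (R.zeroʳ _))
            (R.sym (Σ-0 L (λ {ν} ν∈ → false⇒0 (cover μ ν) _ (λ c → ¬g (Inc-cong (wλ ν) (t ∷ u) (~-sym (proj₂ (cover⇒ μ ν c))) (∈parts⇒Inc {N} ν∈))))))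
          grassmannian : Inc₀ (t ∷ u) → A μ ≈ Σᴸ L (K μ)
          grassmannian g = bounded (size ν₀ ℕP.≤? N)
            where
            ν₀ : List ℕ
            ν₀ = proj₁ (wλ-surj (t ∷ u) g)
            pk₀ : IsPk (suc k') ν₀
            pk₀ = proj₁ (proj₂ (wλ-surj (t ∷ u) g))
            e₀ : wλ ν₀ ~ (t ∷ u)
            e₀ = proj₂ (proj₂ (wλ-surj (t ∷ u) g))
            bounded : Dec (size ν₀ ℕ.≤ N) → A μ ≈ Σᴸ L (K μ)
            bounded (yes l) = R.trans (true⇒1 (up t u) _ e) (R.trans (R.*-congˡ (f-class (t ∷ u) (wλ ν₀) (~-sym e₀)))
              (R.sym (Σ-δ (cover μ) (λ ν → χ u ⊠ f (wλ ν)) (kparts-unique (suc k') N) (kparts-complete (suc k') N ν₀ pk₀ l)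
                (⇒cover μ ν₀ e (~-sym e₀))
                (λ {ν} ν∈ c → wλ-inj ν ν₀ (proj₁ (kparts-sound (suc k') N ν∈)) pk₀
                   (~-trans (~-sym (proj₂ (cover⇒ μ ν c))) (~-sym e₀))))))
            -- Here t u has left the truncated list. Then u has length at least N, where χ vanishes,
            -- so nothing is lost at the boundary.
            bounded (no ¬l) = R.trans (R.trans (R.*-congˡ (zero-at _)) (R.zeroʳ _))
                (R.sym (Σ-0 L (λ _ → R.trans (R.*-congˡ (zero-at _)) (R.zeroʳ _))))
              where
              big : N ℕ.≤ len u
              big = ℕ.s≤s⁻¹ (ℕP.≤-trans (ℕP.≰⇒> ¬l) (ℕP.≤-reflexive (trans (sym (len-wλ ν₀ pk₀)) (trans (len-cong (wλ ν₀) (t ∷ u) e₀) (Step.len-up t u e)))))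
              zero-at : ∀ x → χ u ⊠ x ≈ 0#
              zero-at x = R.trans (R.*-congʳ (χ-support u big)) (R.zeroˡ x)

      col : ∀ {ν} → ν ∈ L → B ν ≈ Σᴸ L (λ μ → K μ ν)
      col {ν} ν∈ = [ case-up , case-down ]′ (true⊎false (up t v))
        where
        v : Word
        v = wλ ν
        case-up : up t v ≡ true → B ν ≈ Σᴸ L (λ μ → K μ ν)
        case-up e = R.trans (false⇒0 (not (up t v)) _ (λ e′ → contradiction (trans (sym e′) (cong not e)) λ ()))
          (R.sym (Σ-0 L (λ {μ} _ → false⇒0 (cover μ ν) _ (impossible μ))))
          where
          impossible : ∀ μ → cover μ ν ≢ true
          impossible μ c = let (up-μ , e~) = cover⇒ μ ν c in ℕP.m≢1+n+m (len (wλ μ)) {1}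
            (trans (sym (len-cong (t ∷ v) (wλ μ) (~-trans (~-∷ t (~-sym e~)) (tt~ t (wλ μ)))))
              (trans (Step.len-up t v e) (cong suc (trans (sym (len-cong (t ∷ wλ μ) v e~)) (Step.len-up t (wλ μ) up-μ)))))
        case-down : up t v ≡ false → B ν ≈ Σᴸ L (λ μ → K μ ν)
        case-down e = R.trans (true⇒1 (not (up t v)) _ (cong not e)) (R.trans (R.*-congʳ (χ-class (t ∷ v) (wλ μ₀) g (wλ-Inc μ₀ pk₀) (~-sym e₀)))
            (R.sym (Σ-δ (λ μ → cover μ ν) (λ μ → χ (wλ μ) ⊠ f v) (kparts-unique (suc k') N) (kparts-complete (suc k') N μ₀ pk₀ small)
              (⇒cover μ₀ ν up₀ back)
              (λ {μ} μ∈ c → wλ-inj μ μ₀ (proj₁ (kparts-sound (suc k') N μ∈)) pk₀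
                 (~-trans (~-sym (tt~ t (wλ μ)))
                   (~-trans (~-∷ t (proj₂ (cover⇒ μ ν c))) (~-sym e₀)))))))
          where
          g : Inc₀ (t ∷ v)
          g = Step.Inc-down t v e (∈parts⇒Inc {N} ν∈)
          μ₀ : List ℕ
          μ₀ = proj₁ (wλ-surj (t ∷ v) g)
          pk₀ : IsPk (suc k') μ₀
          pk₀ = proj₁ (proj₂ (wλ-surj (t ∷ v) g))
          e₀ : wλ μ₀ ~ (t ∷ v)
          e₀ = proj₂ (proj₂ (wλ-surj (t ∷ v) g))
          back : (t ∷ wλ μ₀) ~ v
          back = ~-trans (~-∷ t e₀) (tt~ t v)
          len₀ : len v ≡ suc (len (wλ μ₀))
          len₀ = trans (Step.len-down t v e) (cong suc (sym (len-cong (wλ μ₀) (t ∷ v) e₀)))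
          small : size μ₀ ℕ.≤ N
          small = ℕP.≤-trans (ℕP.≤-reflexive (sym (len-wλ μ₀ pk₀))) (ℕP.≤-trans (ℕP.n≤1+n _) (ℕP.≤-trans (ℕP.≤-reflexive (sym len₀))
                    (ℕP.≤-trans (ℕP.≤-reflexive (sym (size-len ν ν∈))) (proj₂ (kparts-sound (suc k') N ν∈)))))
          up₀ : up t (wλ μ₀) ≡ true
          up₀ = T⇒≡ (ℕP.<⇒<ᵇ (ℕP.≤-reflexive (trans (sym len₀) (sym (len-cong (t ∷ wλ μ₀) v back)))))

      adjoint : Σᴸ L (λ μ → χ (wλ μ) ⊠ τ t f (wλ μ)) ≈ Σᴸ L (λ ν → (χ (dn t (wλ ν)) ⊞ ⊟ χ (wλ ν)) ⊠ f (wλ ν))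
      adjoint = begin
        Σᴸ L (λ μ → χ (wλ μ) ⊠ τ t f (wλ μ))                         ≈⟨ Σ-cong L (λ {μ} _ → split-τ μ) ⟩
        Σᴸ L (λ μ → A μ ⊞ C μ)                                       ≈⟨ Σ-+ L A C ⟩
        Σᴸ L A ⊞ Σᴸ L C                                              ≈⟨ R.+-congʳ (reindex L L K row col) ⟩
        Σᴸ L B ⊞ Σᴸ L C                                              ≈⟨ R.sym (Σ-+ L B C) ⟩
        Σᴸ L (λ μ → B μ ⊞ C μ)                                       ≈⟨ Σ-cong L (λ {μ} _ → R.sym (split-dn μ)) ⟩
        Σᴸ L (λ ν → (χ (dn t (wλ ν)) ⊞ ⊟ χ (wλ ν)) ⊠ f (wλ ν))       ∎

  -- The Pieri rule for g̃

  module Main {c ℓ} (R : CommutativeRing c ℓ) (lam : List ℕ) (pk : IsPk (suc k') lam) where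
    open RingSums R
    open R using (Carrier; _≈_; 0#; 1#) renaming (_+_ to infixl 6 _⊞_; _*_ to infixl 7 _⊠_; -_ to infix 8 ⊟_)
    open KS R (suc k')
    open import Relation.Binary.Reasoning.Setoid R.setoid

    w : Word
    w = wλ lam

    gw : Inc₀ w
    gw = wλ-Inc lam pk

    open Over w gw

    strips⇒ : ∀ j {A} → A ∈ strips lam j → IsStrip w j A
    strips⇒ j {A} p = stripᵇ⇒ w j A (proj₂ (∈-filterᵇ⁻ (stripᵇ w j) {A} {allSubsets n} p))

    ⇒strips : ∀ j {A} → IsStrip w j A → A ∈ strips lam j
    ⇒strips j {A} st = ∈-filterᵇ⁺ (stripᵇ w j) (∈-allSubsets A) (⇒stripᵇ w j A gw st)

    chosen : ∀ j {S} → S ∈ nonemptySublists (strips lam j) → ∃₂ λ A S′ → S ≡ A ∷ S′ × All ProperStrip (A ∷ S′)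
    chosen j {[]} p = ⊥-elim (proj₂ (∈-filterᵇ⁻ (λ ys → not (length ys ≡ᵇ 0)) {[]} {sublists (strips lam j)} p))
    chosen j {A ∷ S} p = A , S , refl , All.tabulate {xs = A ∷ S} (λ {B} B∈ →
       let (pr , _ , st) = strips⇒ j (Sub.lookup (∈-sublists⇒⊆ {xs = A ∷ S} {ys = strips lam j}
              (proj₁ (∈-filterᵇ⁻ (λ ys → not (length ys ≡ᵇ 0)) {A ∷ S} {sublists (strips lam j)} p))) B∈) in pr , st)

    meets : ∀ j S → S ∈ nonemptySublists (strips lam j) →
            Grass (dword (⋂ S) ++ w) × IsMeet (dword (⋂ S) ++ w) (map (λ A → dword A ++ w) S)
    meets j S p = by (chosen j p)
      where
      by : (∃₂ λ A S′ → S ≡ A ∷ S′ × All ProperStrip (A ∷ S′)) →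
           Grass (dword (⋂ S) ++ w) × IsMeet (dword (⋂ S) ++ w) (map (λ A → dword A ++ w) S)
      by (A , S′ , refl , ps) = Inc⇒Grass x gx
          -- That x is a lower bound follows by reading x ≤ x through the description of the
          -- elements below the intersection.
          , AllP.map⁺ (⋂-≤⇒ x A S′ gx ps (⊑⇒≤B x x (Inc⇒Grass x gx) (Inc⇒Grass x gx) (⊑-refl x)))
          , λ ν pν h → ⋂-≤⇐ (wλ ν) A S′ (wλ-Inc ν pν) ps (AllP.map⁻ h)
        where
        x : Word
        x = dword (⋂ S) ++ w
        gx : Inc₀ x
        gx = ⋂-Inc A S′ ps

    -- The indicator of lying below a meet is the conjunction of the indicators of the strips, the
    -- form to which `inclusion–exclusion` applies.
    below-all : ∀ ν → Inc₀ ν → ∀ j S → S ∈ nonemptySublists (strips lam j) →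
                bruhatᵇ ν (dword (⋂ S) ++ w) ≡ all (λ A → bruhatᵇ ν (dword A ++ w)) S
    below-all ν gν j S p = by (chosen j p)
      where
      le : Subset n → Bool
      le A = bruhatᵇ ν (dword A ++ w)
      by : (∃₂ λ A S′ → S ≡ A ∷ S′ × All ProperStrip (A ∷ S′)) → bruhatᵇ ν (dword (⋂ S) ++ w) ≡ all le S
      by (A , S′ , refl , ps) = bool-ext
        (λ e → T⇒≡ (AllP.all⁻ le (⋂-≤⇒ ν A S′ gν ps (≡⇒T e))))
        (λ e → T⇒≡ (⋂-≤⇐ ν A S′ gν ps (AllP.all⁺ le S (≡⇒T e))))

    -- A word `dword A` has at most n letters, so every coefficient in question vanishes on elements
    -- longer than this; each letter moved across uses up one unit of the margin n.
    N : ℕ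
    N = len w ℕ.+ n

    L : List (List ℕ)
    L = parts R N

    length-dword≤ : ∀ A → Proper A → length (dword A) ℕ.≤ n
    length-dword≤ A pr = ℕP.≤-trans (ℕP.≤-reflexive (length-dword A pr)) (∣p∣≤n A)

    χ : Word → Word → Carrier
    χ d v = alt d (below? v)

    χ-class : ∀ d u v → Inc₀ u → Inc₀ v → u ~ v → χ d u ≈ χ d v
    χ-class d u v gu gv e = alt-cong d (λ b _ → bruhatᵇ-cong (dn* b u) (dn* b v) w (dn*-Inc b u gu) (dn*-Inc b v gv) gw (dn*-cong b u v e))

    -- A subword of d lowers the length by at most the number of its letters, so from such a long v
    -- it cannot get down to an element below w.
    χ-support : ∀ d v → len w ℕ.+ length d ℕ.< len v → χ d v ≈ 0#
    χ-support d v l = alt-0 d (λ b p → BoolP.¬-not (λ e → ℕP.<⇒≱ l (ℕP.≤-trans (len-dn* b v) (ℕP.≤-trans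
      (ℕP.+-mono-≤ (SubP.length-mono-≤ {as = b} {bs = d} p) (≤B⇒len≤ (dn* b v) w (≡⇒T e)))
      (ℕP.≤-reflexive (ℕP.+-comm (length d) (len w)))))))

    -- By definition χ (t ∷ d) at v is χ d at `dn t v` minus χ d at v, exactly what `Adjoint`
    -- produces from χ d. The induction therefore ends in the alternating sum over the subwords of
    -- d.
    τ*-adjoint : ∀ d f → Class R f → Vanish R f → len w ℕ.+ length d ℕ.≤ N →
                 Σᴸ L (λ μ → χ [] (wλ μ) ⊠ τ* R d f (wλ μ)) ≈ Σᴸ L (λ ν → χ d (wλ ν) ⊠ f (wλ ν))
    τ*-adjoint []      f _ _ _ = R.refl
    τ*-adjoint (t ∷ d) f cl va l = R.trans
      (τ*-adjoint d (τ R t f) (τ-Class R t f cl) (τ-Vanish R t f va) (ℕP.<⇒≤ l′))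
      (Adjoint.adjoint R t f (χ d) N cl va (χ-class d) (λ v N≤ → χ-support d v (ℕP.<-≤-trans l′ N≤)))
      where
      l′ : len w ℕ.+ length d ℕ.< N
      l′ = ℕP.≤-trans (ℕP.≤-reflexive (sym (ℕP.+-suc (len w) (length d)))) l

    -- `gtilde` cuts its sum off at the length of a word; this passes to the common bound `N`,
    -- either bound being beyond the support of p.
    Σ-range : ∀ N₁ N₂ (p : List ℕ → Bool) (q : List ℕ → Carrier) → (∀ μ → IsPk (suc k') μ → p μ ≡ true → size μ ℕ.≤ N₁ × size μ ℕ.≤ N₂) →
              Σᴸ (parts R N₁) (λ μ → ⟦ p μ ⟧ ⊠ q μ) ≈ Σᴸ (parts R N₂) (λ μ → ⟦ p μ ⟧ ⊠ q μ)
    Σ-range N₁ N₂ p q h = reindex (parts R N₁) (parts R N₂) (λ μ ν → ⟦ same μ ν ⟧ ⊠ (⟦ p ν ⟧ ⊠ q ν)) row col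
      where
      same : List ℕ → List ℕ → Bool
      same μ ν = ⌊ ListP.≡-dec ℕ._≟_ μ ν ⌋
      same⇒ : ∀ μ ν → same μ ν ≡ true → μ ≡ ν
      same⇒ μ ν e = toWitness (≡⇒T e)
      same-refl : ∀ μ → same μ μ ≡ true
      same-refl μ = T⇒≡ (fromWitness refl)
      row : ∀ {μ} → μ ∈ parts R N₁ → ⟦ p μ ⟧ ⊠ q μ ≈ Σᴸ (parts R N₂) (λ ν → ⟦ same μ ν ⟧ ⊠ (⟦ p ν ⟧ ⊠ q ν))
      row {μ} μ∈ = R.sym ([ (λ e → Σ-δ (same μ) (λ ν → ⟦ p ν ⟧ ⊠ q ν) (kparts-unique (suc k') N₂)
              (kparts-complete (suc k') N₂ μ pkμ (proj₂ (h μ pkμ e))) (same-refl μ) (λ {ν} _ e′ → sym (same⇒ μ ν e′)))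
          , (λ e → R.trans (Σ-0 (parts R N₂) (λ {ν} _ → [ (λ s → R.trans (R.*-congˡ (false⇒0 (p ν) (q ν) (λ e′ → contradiction (trans (sym e′) (trans (cong p (sym (same⇒ μ ν s))) e)) λ ()))) (R.zeroʳ _))
                                                         , (λ s → false⇒0 (same μ ν) _ (λ s′ → contradiction (trans (sym s′) s) λ ())) ]′ (true⊎false (same μ ν))))
                     (R.sym (false⇒0 (p μ) (q μ) (λ e′ → contradiction (trans (sym e′) e) λ ())))) ]′ (true⊎false (p μ)))
        where pkμ = proj₁ (kparts-sound (suc k') N₁ μ∈)
      col : ∀ {ν} → ν ∈ parts R N₂ → ⟦ p ν ⟧ ⊠ q ν ≈ Σᴸ (parts R N₁) (λ μ → ⟦ same μ ν ⟧ ⊠ (⟦ p ν ⟧ ⊠ q ν))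
      col {ν} ν∈ = R.sym ([ (λ e → Σ-δ (λ μ → same μ ν) (λ _ → ⟦ p ν ⟧ ⊠ q ν) (kparts-unique (suc k') N₁)
              (kparts-complete (suc k') N₁ ν pkν (proj₁ (h ν pkν e))) (same-refl ν) (λ {μ} _ e′ → same⇒ μ ν e′))
          , (λ e → R.trans (Σ-0 (parts R N₁) (λ {μ} _ → R.trans (R.*-congˡ (false⇒0 (p ν) (q ν) (λ e′ → contradiction (trans (sym e′) e) λ ()))) (R.zeroʳ _)))
                     (R.sym (false⇒0 (p ν) (q ν) (λ e′ → contradiction (trans (sym e′) e) λ ())))) ]′ (true⊎false (p ν)))
        where pkν = proj₁ (kparts-sound (suc k') N₂ ν∈)

    module Rule (h : ℕ → Carrier) (g : Word → Carrier) (g-class : ∀ u v → u ≈W v → g u ≈ g v)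
                (pieri : ∀ v → Grass v → ∀ j → 1 ℕ.≤ j → j ℕ.≤ suc k' → h j ⊠ g v ≈ pieriRHS g v j)
                (r₀ : ℕ) (r≤k : r₀ ℕ.≤ suc k') where
      -- The extension of g by zero absorbs the restriction of the Pieri sum to Grassmannian
      -- `d_A * v`.
      f : Word → Carrier
      f v = ⟦ grassᵇ v ⟧ ⊠ g v

      grassᵇ-Inc : ∀ v → Inc₀ v → grassᵇ v ≡ true
      grassᵇ-Inc v g = T⇒≡ (Inc⇒Grass v g)

      f-Inc : ∀ v → Inc₀ v → f v ≈ g v
      f-Inc v gv = true⇒1 (grassᵇ v) (g v) (grassᵇ-Inc v gv)

      f-vanish : Vanish R f
      f-vanish v ¬g = false⇒0 (grassᵇ v) (g v) (λ e → ¬g (Grass⇒Inc v (≡⇒T e)))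

      f-class : Class R f
      f-class u v e = R.*-cong (R.reflexive (cong ⟦_⟧ (bool-ext (transport u v e) (transport v u (~-sym e))))) (g-class u v (~⇒≈W u v e))
        where
        transport : ∀ u v → u ~ v → grassᵇ u ≡ true → grassᵇ v ≡ true
        transport u v e p = T⇒≡ (Grass-cong u v e (≡⇒T p))

      of-size : ℕ → Subset n → Bool
      of-size j A = properᵇ A ∧ (∣ A ∣ ≡ᵇ j)

      of-size⇒ : ∀ j A → of-size j A ≡ true → Proper A × ∣ A ∣ ≡ j
      of-size⇒ j A e = let (a , b) = T∧⁻ (properᵇ A) (∣ A ∣ ≡ᵇ j) (≡⇒T e) in properᵇ⁻ A a , ℕP.≡ᵇ⇒≡ ∣ A ∣ j b

      ⇒of-size : ∀ j A → Proper A → ∣ A ∣ ≡ j → of-size j A ≡ true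
      ⇒of-size j A pr e = T⇒≡ (T∧⁺ (properᵇ A) (∣ A ∣ ≡ᵇ j) (properᵇ⁺ A pr) (ℕP.≡⇒≡ᵇ ∣ A ∣ j e))

      pieri-τ : ∀ v j → pieriRHS g v j ≈ Σᴸ (allSubsets n) (λ A → ⟦ of-size j A ⟧ ⊠ τ* R (dword A) f v)
      pieri-τ v j = R.trans (Σ-filter (λ A → properᵇ A ∧ (∣ A ∣ ≡ᵇ j) ∧ grassᵇ (D A)) (allSubsets n) (λ A → signed (e A) (g (D A))))
          (Σ-cong (allSubsets n) (λ {A} _ → term A))
        where
        D : Subset n → Word
        D A = demazure (dword A) v
        e : Subset n → ℕ
        e A = j ℕ.+ len v ℕ.+ len (D A)
        term : ∀ A → ⟦ properᵇ A ∧ (∣ A ∣ ≡ᵇ j) ∧ grassᵇ (D A) ⟧ ⊠ signed (e A) (g (D A)) ≈ ⟦ of-size j A ⟧ ⊠ τ* R (dword A) f v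
        term A = begin
          ⟦ properᵇ A ∧ (∣ A ∣ ≡ᵇ j) ∧ grassᵇ (D A) ⟧ ⊠ signed (e A) (g (D A))
            ≈⟨ R.*-congʳ (R.trans (R.reflexive (cong ⟦_⟧ (sym (BoolP.∧-assoc (properᵇ A) (∣ A ∣ ≡ᵇ j) (grassᵇ (D A)))))) (⟦∧⟧ R (of-size j A) (grassᵇ (D A)))) ⟩
          ⟦ of-size j A ⟧ ⊠ ⟦ grassᵇ (D A) ⟧ ⊠ signed (e A) (g (D A))
            ≈⟨ R.*-assoc _ _ _ ⟩
          ⟦ of-size j A ⟧ ⊠ (⟦ grassᵇ (D A) ⟧ ⊠ signed (e A) (g (D A)))
            ≈⟨ R.*-congˡ (R.trans (R.*-comm _ _) (R.trans (signed-* (e A) (g (D A)) ⟦ grassᵇ (D A) ⟧) (signed-cong (e A) (R.*-comm _ _)))) ⟩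
          ⟦ of-size j A ⟧ ⊠ signed (e A) (f (D A))
            ≈⟨ when R (of-size j A) (λ q → R.trans (R.reflexive (cong (λ i → signed (i ℕ.+ len v ℕ.+ len (D A)) (f (D A)))
                 (sym (trans (length-dword A (proj₁ (of-size⇒ j A q))) (proj₂ (of-size⇒ j A q)))))) (signed-τ* R (dword A) f v)) ⟩
          ⟦ of-size j A ⟧ ⊠ τ* R (dword A) f v ∎

      -- The summand 1 of `htilde` is treated as the case of size 0, where the only set is empty and
      -- its operator is the identity; so one formula covers all sizes up to `r₀`.
      h₀ : ℕ → Carrier
      h₀ zero    = 1#
      h₀ (suc i) = h (suc i)

      Sizes : List ℕ
      Sizes = 0 ∷ map suc (upTo r₀)

      ∈Sizes : ∀ {j} → j ∈ Sizes → j ℕ.≤ r₀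
      ∈Sizes (here refl) = z≤n
      ∈Sizes (there p) with MemP.∈-map⁻ suc p
      ... | i , i∈ , refl = MemP.∈-upTo⁻ i∈

      ∈Sizes⁺ : ∀ {j} → j ℕ.≤ r₀ → j ∈ Sizes
      ∈Sizes⁺ {zero}  _ = here refl
      ∈Sizes⁺ {suc j} p = there (MemP.∈-map⁺ suc (MemP.∈-upTo⁺ p))

      Sizes-unique : Unique Sizes
      Sizes-unique = All.tabulate {xs = map suc (upTo r₀)} (λ { p refl → zero∉ p }) ∷ UniqueP.map⁺ ℕP.suc-injective (UniqueP.upTo⁺ r₀)
        where
        zero∉ : 0 ∉ map suc (upTo r₀)
        zero∉ p with MemP.∈-map⁻ suc p
        ... | _ , _ , ()

      empty : Subset n
      empty = Vec.replicate n false

      empty-out : ∀ {j} (t : Fin j) → lookup (Vec.replicate j false) t ≡ false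
      empty-out t = VecP.lookup-replicate t false

      dword-empty : dword empty ≡ []
      dword-empty = length≡0⇒[] (dword empty) (trans (length-dword empty (Fin.zero , empty-out {n} Fin.zero))
         (∣∣-empty empty (λ t e → contradiction (trans (sym e) (empty-out t)) λ ())))

      h-term : ∀ {j} → j ∈ Sizes → ∀ v → Inc₀ v → h₀ j ⊠ g v ≈ Σᴸ (allSubsets n) (λ A → ⟦ of-size j A ⟧ ⊠ τ* R (dword A) f v)
      h-term {suc j} j∈ v gv = R.trans (pieri v (Inc⇒Grass v gv) (suc j) (s≤s z≤n) (ℕP.≤-trans (∈Sizes j∈) r≤k)) (pieri-τ v (suc j))
      h-term {zero}  j∈ v gv = R.trans (R.*-identityˡ (g v)) (R.sym (R.trans
        (Σ-δ (of-size 0) (λ A → τ* R (dword A) f v) (allSubsets-unique n) (∈-allSubsets empty)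
          (⇒of-size 0 empty (Fin.zero , empty-out {n} Fin.zero) (∣∣-empty empty (λ t e → contradiction (trans (sym e) (empty-out t)) λ ())))
          (λ {A} _ e → lookup-ext A empty (λ t → trans (∣∣≡0⇒out A (proj₂ (of-size⇒ 0 A e)) t) (sym (empty-out t)))))
        (R.trans (R.reflexive (cong (λ d → τ* R d f v) dword-empty)) (f-Inc v gv))))

      below-strip : Word → Bool
      below-strip ν = any (λ A → bruhatᵇ ν (dword A ++ w)) (strips lam r₀)

      count-least : ∀ ν → Inc₀ ν →
                    Σᴸ Sizes (λ j → Σᴸ (allSubsets n) (λ A → ⟦ of-size j A ⟧ ⊠ ⟦ minimalᵇ (dword A) (below? ν) ⟧)) ≈ ⟦ below-strip ν ⟧
      count-least ν gν = [ case-true , case-false ]′ (true⊎false (below-strip ν))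
        where
        le : Subset n → Bool
        le A = bruhatᵇ ν (dword A ++ w)
        least : ℕ → Subset n → Bool
        least j A = of-size j A ∧ minimalᵇ (dword A) (below? ν)
        least⇒ : ∀ j A → least j A ≡ true → Proper A × ∣ A ∣ ≡ j × Least w ν A
        least⇒ j A e =
          let (a , b) = T∧⁻ (of-size j A) (minimalᵇ (dword A) (below? ν)) (≡⇒T e)
              (pr , sz) = of-size⇒ j A (T⇒≡ a)
          in pr , sz , minimal⇒Least w gw ν gν A pr (T⇒≡ b)
        unit : ∀ j → Σᴸ (allSubsets n) (λ A → ⟦ of-size j A ⟧ ⊠ ⟦ minimalᵇ (dword A) (below? ν) ⟧) ≈ Σᴸ (allSubsets n) (λ A → ⟦ least j A ⟧ ⊠ 1#)
        unit j = Σ-cong (allSubsets n) (λ {A} _ → R.trans (R.sym (⟦∧⟧ R (of-size j A) (minimalᵇ (dword A) (below? ν)))) (R.sym (R.*-identityʳ ⟦ least j A ⟧)))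
        case-false : below-strip ν ≡ false → _ ≈ ⟦ below-strip ν ⟧
        case-false e = R.trans (Σ-0 Sizes (λ {j} j∈ → R.trans (unit j) (Σ-0 (allSubsets n) (λ {A} _ → false⇒0 (least j A) 1# (λ l →
            let (pr , sz , le-A) = least⇒ j A l
                (B , st , ν≤) = least⇒strip ν gν r₀ r≤k A pr (ℕP.≤-trans (ℕP.≤-reflexive sz) (∈Sizes j∈)) le-A
            in subst T e (AnyP.any⁺ le (lose {P = T ∘ le} (⇒strips r₀ {B} st) ν≤)))))))
          (R.reflexive (cong ⟦_⟧ (sym e)))
        case-true : below-strip ν ≡ true → _ ≈ ⟦ below-strip ν ⟧
        case-true e = begin
            Σᴸ Sizes (λ j → Σᴸ (allSubsets n) (λ A → ⟦ of-size j A ⟧ ⊠ ⟦ minimalᵇ (dword A) (below? ν) ⟧))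
              ≈⟨ Σ-cong Sizes (λ {j} _ → R.trans (unit j) (inner j)) ⟩
            Σᴸ Sizes (λ j → ⟦ ∣ M ∣ ≡ᵇ j ⟧ ⊠ 1#)
              ≈⟨ Σ-δ (λ j → ∣ M ∣ ≡ᵇ j) (λ _ → 1#) Sizes-unique (∈Sizes⁺ (proj₁ (proj₂ (proj₂ found)))) (T⇒≡ (ℕP.≡⇒≡ᵇ ∣ M ∣ ∣ M ∣ refl))
                   (λ {j} _ q → sym (≡ᵇ-true ∣ M ∣ j q)) ⟩
            1#
              ≡⟨ cong ⟦_⟧ (sym e) ⟩
            ⟦ below-strip ν ⟧ ∎
          where
          strip : ∃ λ A → A ∈ strips lam r₀ × T (le A)
          strip = find (AnyP.any⁻ le (strips lam r₀) (≡⇒T e))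
          found : ∃ λ M → Proper M × ∣ M ∣ ℕ.≤ r₀ × Least w ν M
          found = strip⇒least ν gν r₀ (proj₁ strip) (strips⇒ r₀ (proj₁ (proj₂ strip))) (proj₂ (proj₂ strip))
          M : Subset n
          M = proj₁ found
          prM : Proper M
          prM = proj₁ (proj₂ found)
          leastM : Least w ν M
          leastM = proj₂ (proj₂ (proj₂ found))
          inner : ∀ j → Σᴸ (allSubsets n) (λ A → ⟦ least j A ⟧ ⊠ 1#) ≈ ⟦ ∣ M ∣ ≡ᵇ j ⟧ ⊠ 1#
          inner j = [ (λ q → R.trans (Σ-δ (least j) (λ _ → 1#) (allSubsets-unique n) (∈-allSubsets M)
                              (T⇒≡ (T∧⁺ (of-size j M) (minimalᵇ (dword M) (below? ν))
                                (≡⇒T (⇒of-size j M prM (≡ᵇ-true ∣ M ∣ j q)))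
                                (≡⇒T (Least⇒minimal w gw ν gν M prM leastM))))
                              (λ {A} _ l → Least-unique w ν A M (proj₂ (proj₂ (least⇒ j A l))) leastM))
                            (R.sym (true⇒1 (∣ M ∣ ≡ᵇ j) 1# q)))
                    , (λ q → R.trans (Σ-0 (allSubsets n) (λ {A} _ → false⇒0 (least j A) 1# (λ l →
                                ≡ᵇ-false ∣ M ∣ j q (trans (cong ∣_∣ (Least-unique w ν M A leastM (proj₂ (proj₂ (least⇒ j A l))))) (proj₁ (proj₂ (least⇒ j A l)))))))
                            (R.sym (false⇒0 (∣ M ∣ ≡ᵇ j) 1# (λ q′ → contradiction (trans (sym q′) q) λ ())))) ]′ (true⊎false (∣ M ∣ ≡ᵇ j))

      gtilde-parts : ∀ x → len x ℕ.≤ N → gtilde g x ≈ Σᴸ L (λ μ → ⟦ bruhatᵇ (wλ μ) x ⟧ ⊠ g (wλ μ))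
      gtilde-parts x l = R.trans (Σ-filter (λ μ → bruhatᵇ (wλ μ) x) (kparts (suc k') (length x)) (λ μ → g (wλ μ)))
        (Σ-range (length x) N (λ μ → bruhatᵇ (wλ μ) x) (λ μ → g (wλ μ)) (λ μ pkμ e →
          let b = ℕP.≤-trans (ℕP.≤-reflexive (sym (len-wλ μ pkμ))) (≤B⇒len≤ (wλ μ) x (≡⇒T e))
          in ℕP.≤-trans b (len≤length x) , ℕP.≤-trans b l))

      total : Carrier
      total = Σᴸ L (λ ν → ⟦ below-strip (wλ ν) ⟧ ⊠ g (wλ ν))

      X : Subset n → List ℕ → Carrier
      X A μ = τ* R (dword A) f (wλ μ)

      Y : Subset n → List ℕ → Carrier
      Y A ν = ⟦ minimalᵇ (dword A) (below? (wλ ν)) ⟧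

      exchange-sums : ∀ {j} A → ⟦ of-size j A ⟧ ⊠ Σᴸ L (λ μ → ⟦ bruhatᵇ (wλ μ) w ⟧ ⊠ X A μ) ≈ ⟦ of-size j A ⟧ ⊠ Σᴸ L (λ ν → f (wλ ν) ⊠ Y A ν)
      exchange-sums {j} A = when R (of-size j A) (λ q → R.trans
        (τ*-adjoint (dword A) f f-class f-vanish (ℕP.+-monoʳ-≤ (len w) (length-dword≤ A (proj₁ (of-size⇒ j A q)))))
        (Σ-cong L (λ {ν} ν∈ → R.trans (R.*-comm _ _) (R.*-congˡ
          (alt-minimal {w} {wλ ν} {dword A} (λ _ → ⊥) (below? (wλ ν)) (CycDec-dword A) (λ _ _ ())
            (below?-Decides w gw (wλ ν) (∈parts⇒Inc R {N} ν∈) (CycDec-dword A)))))))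

      lhs : gtilde g w ⊠ htilde h r₀ ≈ total
      lhs = begin
        gtilde g w ⊠ htilde h r₀
          ≈⟨ R.*-cong (gtilde-parts w (ℕP.m≤m+n (len w) n)) (R.+-congˡ (R.sym (Σ-map suc (upTo r₀) h₀))) ⟩
        Σᴸ L (λ μ → ⟦ bruhatᵇ (wλ μ) w ⟧ ⊠ g (wλ μ)) ⊠ Σᴸ Sizes h₀
          ≈⟨ Σ-*ʳ L _ _ ⟩
        Σᴸ L (λ μ → ⟦ bruhatᵇ (wλ μ) w ⟧ ⊠ g (wλ μ) ⊠ Σᴸ Sizes h₀)
          ≈⟨ Σ-cong L (λ {μ} μ∈ → R.trans (R.*-assoc _ _ _) (R.*-congˡ (R.trans (R.*-comm _ _) (R.trans (Σ-*ʳ Sizes (g (wλ μ)) h₀)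
               (Σ-cong Sizes (λ j∈ → h-term j∈ (wλ μ) (∈parts⇒Inc R {N} μ∈))))))) ⟩
        Σᴸ L (λ μ → ⟦ bruhatᵇ (wλ μ) w ⟧ ⊠ Σᴸ Sizes (λ j → Σᴸ (allSubsets n) (λ A → ⟦ of-size j A ⟧ ⊠ X A μ)))
          ≈⟨ ΣΣ-pull R L Sizes (allSubsets n) (λ μ → ⟦ bruhatᵇ (wλ μ) w ⟧) (λ j A → ⟦ of-size j A ⟧) X ⟩
        Σᴸ Sizes (λ j → Σᴸ (allSubsets n) (λ A → ⟦ of-size j A ⟧ ⊠ Σᴸ L (λ μ → ⟦ bruhatᵇ (wλ μ) w ⟧ ⊠ X A μ)))
          ≈⟨ Σ-cong Sizes (λ {j} _ → Σ-cong (allSubsets n) (λ {A} _ → exchange-sums {j} A)) ⟩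
        Σᴸ Sizes (λ j → Σᴸ (allSubsets n) (λ A → ⟦ of-size j A ⟧ ⊠ Σᴸ L (λ ν → f (wλ ν) ⊠ Y A ν)))
          ≈⟨ R.sym (ΣΣ-pull R L Sizes (allSubsets n) (λ ν → f (wλ ν)) (λ j A → ⟦ of-size j A ⟧) Y) ⟩
        Σᴸ L (λ ν → f (wλ ν) ⊠ Σᴸ Sizes (λ j → Σᴸ (allSubsets n) (λ A → ⟦ of-size j A ⟧ ⊠ Y A ν)))
          ≈⟨ Σ-cong L (λ {ν} ν∈ → R.trans (R.*-cong (f-Inc (wλ ν) (∈parts⇒Inc R {N} ν∈)) (count-least (wλ ν) (∈parts⇒Inc R {N} ν∈))) (R.*-comm _ _)) ⟩
        total ∎

      short : ∀ {S} → S ∈ nonemptySublists (strips lam r₀) → len (dword (⋂ S) ++ w) ℕ.≤ N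
      short {S} p = by (chosen r₀ p)
        where
        by : (∃₂ λ A S′ → S ≡ A ∷ S′ × All ProperStrip (A ∷ S′)) → len (dword (⋂ S) ++ w) ℕ.≤ N
        by (A , S′ , refl , ps) = ℕP.≤-trans (len-++ (dword (⋂ S)) w) (ℕP.≤-trans
          (ℕP.+-monoˡ-≤ (len w) (ℕP.≤-trans (len≤length (dword (⋂ S))) (length-dword≤ (⋂ S) (proj₁ (⋂-strip A S′ ps)))))
          (ℕP.≤-reflexive (ℕP.+-comm n (len w))))

      rhs : inclExcl g lam r₀ ≈ total
      rhs = begin
        Σᴸ M (λ S → signed (suc (length S)) (gtilde g (dword (⋂ S) ++ w)))
          ≈⟨ Σ-cong M (λ {S} S∈ → R.trans (signed-cong (suc (length S)) (gtilde-parts (dword (⋂ S) ++ w) (short S∈)))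
               (R.trans (signed-Σ (suc (length S)) L _) (Σ-cong L (λ {ν} ν∈ → R.trans
                 (R.sym (signed-* (suc (length S)) _ _)) (R.*-congʳ (R.reflexive (cong (λ b → signed (suc (length S)) ⟦ b ⟧)
                   (below-all (wλ ν) (∈parts⇒Inc R {N} ν∈) r₀ S S∈)))))))) ⟩
        Σᴸ M (λ S → Σᴸ L (λ ν → signed (suc (length S)) ⟦ all (le ν) S ⟧ ⊠ g (wλ ν)))
          ≈⟨ Σ-swap M L _ ⟩
        Σᴸ L (λ ν → Σᴸ M (λ S → signed (suc (length S)) ⟦ all (le ν) S ⟧ ⊠ g (wλ ν)))
          ≈⟨ Σ-cong L (λ {ν} _ → R.trans (R.sym (Σ-*ʳ M (g (wλ ν)) _)) (R.*-congʳ (inclusion–exclusion (le ν) (strips lam r₀)))) ⟩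
        total ∎
        where
        M : List (List (Subset n))
        M = nonemptySublists (strips lam r₀)
        le : List ℕ → Subset n → Bool
        le ν A = bruhatᵇ (wλ ν) (dword A ++ w)

      rule : gtilde g w ⊠ htilde h r₀ ≈ inclExcl g lam r₀
      rule = R.trans lhs (R.sym rhs)

open import Defs
open import Level using (Level)
open import Data.Nat using (ℕ; _≤_; _<_; suc)
open import Data.List using (List; []; map; _++_)
open import Data.List.Membership.Propositional using (_∈_)
open import Data.Product using (_×_; _,_)
open import Algebra.Bundles using (CommutativeRing)

theorem1p3 : ∀ {c ℓ : Level} (R : CommutativeRing c ℓ) (k : ℕ) → 1 ≤ k →
  let open CommutativeRing R
      open Aff k
      open KS R k
  in (h : ℕ → Carrier) (g : Word → Carrier) →
     (∀ u v → u ≈W v → g u ≈ g v) →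
     g [] ≈ 1# →
     (∀ w → Grass w → ∀ r → 1 ≤ r → r ≤ k → h r * g w ≈ pieriRHS g w r) →
     ∀ (λ' : List ℕ) → IsPk k λ' → ∀ r → 1 ≤ r → r ≤ k →
     (∀ S → S ∈ nonemptySublists (strips λ' r) →
        Grass (dword (⋂ S) ++ wλ λ')
        × IsMeet (dword (⋂ S) ++ wλ λ') (map (λ A → dword A ++ wλ λ') S))
     × (gtilde g (wλ λ') * htilde h r ≈ inclExcl g λ' r)
theorem1p3 R (suc k') _ h g g-class _ pieri λ' pk r _ r≤k =
    Development.Main.meets k' R λ' pk r
  , Development.Main.Rule.rule k' R λ' pk h g g-class pieri r r≤k
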